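{- For every $h\in\mathbb{N}$, there are, up to isomorphism, only finitely many non-cyclic simple groups that are isomorphic to the automorphism group $\operatorname{Aut}(G)$ of some finite graph $G$ of Hadwiger number at most $h$.
   Context: Graphs are simple and undirected. A graph $H$ is a minor of $G$ if there is a partition of $V(G)$ into sets inducing connected subgraphs such that $H$ is isomorphic to a subgraph of the graph obtained by contracting each part to a vertex (two parts adjacent iff some edge of $G$ joins them). The Hadwiger number of $G$ is the largest $h$ such that $K_h$ is a minor of $G$. A group is represented by a graph $G$ if it is isomorphic to $\operatorname{Aut}(G)$. -}

module Defs where

open import Level using (Level; _⊔_; 0ℓ)
open import Data.Nat using (ℕ; zero; suc; _≤_)
open import Data.Integer using (ℤ; +_; -[1+_])
open import Data.Fin using (Fin)
open import Data.Bool using (Bool; true; false)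
open import Data.Product using (Σ; ∃; _×_; _,_; proj₁; proj₂)
open import Data.List using (List)
open import Data.List.Relation.Unary.Any using (Any)
open import Relation.Nullary using (¬_)
open import Relation.Binary.PropositionalEquality
  using (_≡_; _≢_; refl; sym; trans; cong)
open import Function.Definitions using (Injective; Surjective)
open import Algebra.Bundles using (Group)
open import Algebra.Structures using (IsGroup)
open import Algebra.Morphism.Structures using (module GroupMorphisms)

record Graph : Set where
  field
    n     : ℕ
    adj   : Fin n → Fin n → Bool
    adj-sym   : ∀ i j → adj i j ≡ adj j i
    adj-irrefl : ∀ i → adj i i ≡ false
open Graph public

open import Data.Fin.Properties using (_≟_)
open import Relation.Nullary using (yes; no; Dec)
open import Data.Empty using (⊥-elim)

complete : ℕ → Graph
complete k = record
  { n = k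
  ; adj = λ i j → isNo (i ≟ j)
  ; adj-sym = λ i j → symNo i j
  ; adj-irrefl = λ i → irr i
  }
  where
  isNo : ∀ {i j : Fin k} → Dec (i ≡ j) → Bool
  isNo (yes _) = false
  isNo (no _)  = true
  symNo : ∀ i j → isNo (i ≟ j) ≡ isNo (j ≟ i)
  symNo i j with i ≟ j | j ≟ i
  ... | yes _ | yes _ = refl
  ... | no _  | no _  = refl
  ... | yes p | no q  = ⊥-elim (q (sym p))
  ... | no p  | yes q = ⊥-elim (p (sym q))
  irr : ∀ i → isNo (i ≟ i) ≡ false
  irr i with i ≟ i
  ... | yes _ = refl
  ... | no p  = ⊥-elim (p refl)

data WalkIn (G : Graph) (S : Fin (n G) → Set) : Fin (n G) → Fin (n G) → Set where
  stop : ∀ {u} → S u → WalkIn G S u u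
  step : ∀ {u w v} → S u → adj G u w ≡ true → WalkIn G S w v → WalkIn G S u v

record ConnectedPartition (G : Graph) (m : ℕ) : Set where
  field
    part        : Fin (n G) → Fin m
    surjective  : ∀ a → ∃ λ u → part u ≡ a
    connected   : ∀ u v → part u ≡ part v → WalkIn G (λ w → part w ≡ part u) u v
open ConnectedPartition public

ContractAdj : (G : Graph) {m : ℕ} → ConnectedPartition G m → Fin m → Fin m → Set
ContractAdj G P a b =
  a ≢ b × Σ (Fin (n G)) λ u → Σ (Fin (n G)) λ v →
    part P u ≡ a × part P v ≡ b × adj G u v ≡ true

-- H is a minor of G: H is isomorphic to a subgraph of some contraction of G
-- (i.e. there is an injective map V(H) → parts sending edges to edges).
_≼_ : Graph → Graph → Set
H ≼ G = Σ ℕ λ m → Σ (ConnectedPartition G m) λ P →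
          Σ (Fin (n H) → Fin m) λ f →
            Injective _≡_ _≡_ f ×
            (∀ i j → adj H i j ≡ true → ContractAdj G P (f i) (f j))

HadwigerAtMost : ℕ → Graph → Set
HadwigerAtMost h G = ∀ k → complete k ≼ G → k ≤ h

record Automorphism (G : Graph) : Set where
  field
    to       : Fin (n G) → Fin (n G)
    from     : Fin (n G) → Fin (n G)
    to-from  : ∀ x → to (from x) ≡ x
    from-to  : ∀ x → from (to x) ≡ x
    preserves : ∀ i j → adj G (to i) (to j) ≡ adj G i j
open Automorphism public

module _ (G : Graph) where
  private
    V = Fin (n G)
    A = Automorphism G

  _≈ᴬ_ : A → A → Set
  σ ≈ᴬ τ = ∀ x → to σ x ≡ to τ x

  _∘ᴬ_ : A → A → A
  σ ∘ᴬ τ = record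
    { to = λ x → to σ (to τ x)
    ; from = λ x → from τ (from σ x)
    ; to-from = λ x → trans (cong (to σ) (to-from τ (from σ x))) (to-from σ x)
    ; from-to = λ x → trans (cong (from τ) (from-to σ (to τ x))) (from-to τ x)
    ; preserves = λ i j → trans (preserves σ (to τ i) (to τ j)) (preserves τ i j)
    }

  idᴬ : A
  idᴬ = record
    { to = λ x → x ; from = λ x → x
    ; to-from = λ _ → refl ; from-to = λ _ → refl
    ; preserves = λ _ _ → refl }

  invᴬ : A → A
  invᴬ σ = record
    { to = from σ ; from = to σ
    ; to-from = from-to σ ; from-to = to-from σ
    ; preserves = λ i j → sym (trans (cong₂ (adj G) (sym (to-from σ i)) (sym (to-from σ j)))
                                     (preserves σ (from σ i) (from σ j)))
    }
    where open Relation.Binary.PropositionalEquality using (cong₂)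

  Aut-isGroup : IsGroup _≈ᴬ_ _∘ᴬ_ idᴬ invᴬ
  Aut-isGroup = record
    { isMonoid = record
      { isSemigroup = record
        { isMagma = record
          { isEquivalence = record
            { refl = λ _ → refl
            ; sym = λ p x → sym (p x)
            ; trans = λ p q x → trans (p x) (q x) }
          ; ∙-cong = λ {σ} {σ'} {τ} {τ'} p q x →
              trans (cong (to σ) (q x)) (p (to τ' x)) }
        ; assoc = λ _ _ _ _ → refl }
      ; identity = (λ _ _ → refl) , (λ _ _ → refl) }
    ; inverse = (λ σ x → from-to σ x) , (λ σ x → to-from σ x)
    ; ⁻¹-cong = λ {σ} {τ} p x →
        trans (sym (from-to τ (from σ x)))
              (cong (from τ) (trans (sym (p (from σ x))) (to-from σ x)))
    }

Aut : Graph → Group 0ℓ 0ℓ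
Aut G = record { isGroup = Aut-isGroup G }

module _ {c ℓ : Level} (S : Group c ℓ) where
  open Group S

  powℕ : Carrier → ℕ → Carrier
  powℕ g zero    = ε
  powℕ g (suc k) = g ∙ powℕ g k

  powℤ : Carrier → ℤ → Carrier
  powℤ g (+ k)      = powℕ g k
  powℤ g -[1+ k ]   = (powℕ g (suc k)) ⁻¹

  IsCyclic : Set (c ⊔ ℓ)
  IsCyclic = Σ Carrier λ g → ∀ x → Σ ℤ λ k → x ≈ powℤ g k

  record IsNormalSubgroup (P : Carrier → Set (c ⊔ ℓ)) : Set (c ⊔ ℓ) where
    field
      respects : ∀ {x y} → x ≈ y → P x → P y
      has-ε    : P ε
      ∙-closed : ∀ {x y} → P x → P y → P (x ∙ y)
      ⁻¹-closed : ∀ {x} → P x → P (x ⁻¹)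
      conj-closed : ∀ g {x} → P x → P ((g ∙ x) ∙ (g ⁻¹))

  record IsSimple : Set (Level.suc (c ⊔ ℓ)) where
    field
      nontrivial : Σ Carrier λ x → ¬ (x ≈ ε)
      normal-trivial-or-all : ∀ (P : Carrier → Set (c ⊔ ℓ)) → IsNormalSubgroup P →
        (Σ Carrier λ x → P x × ¬ (x ≈ ε)) → ∀ x → P x

_≅_ : ∀ {a ℓ₁ b ℓ₂} → Group a ℓ₁ → Group b ℓ₂ → Set (a ⊔ ℓ₁ ⊔ b ⊔ ℓ₂)
G₁ ≅ G₂ = Σ (Group.Carrier G₁ → Group.Carrier G₂) λ f →
            GroupMorphisms.IsGroupIsomorphism (Group.rawGroup G₁) (Group.rawGroup G₂) f

-- Let S = Aut G be simple and non-abelian. Two components of G minus the fixed vertices of S cannot be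
-- exchanged by S, as the exchange alone would be an automorphism acting as a transposition, and S has no
-- non-trivial sign. Contracting blocks spanned by edge orbits, one therefore reaches a connected minor of G
-- on which S moves every vertex and acts transitively on the edges.
--
-- If S is large, no symmetric subset of bounded density needs more than five steps to fill S. Otherwise the
-- kernel of the subset has few large eigenvalues, and some h ≠ 1 almost fixes its rows; in the
-- Hilbert–Schmidt norms given by powers of the kernel, commutators with conjugates of h then shrink
-- geometrically, while simplicity bounds the norm of every non-trivial element from below. (This is
-- Gowers' quasirandomness together with Jordan's theorem, without representations.)
--
-- Hence balls of radius a fixed fraction of the diameter have small density in the orbit. Going down from
-- that scale there is one where the growth is doubling but the density still small compared with the
-- inverse fourth power of the number of steps to the diameter. Moving chains by random group elements
-- gives an isoperimetric inequality in the graph of Voronoi cells of that scale, which is strong enough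
-- to build a clique minor on h + 1 vertices. So the order of S is bounded in terms of h.
module Submission where

open import Defs
open import Level using (Level; 0ℓ; Lift; lift; lower; _⊔_)
open import Data.Nat as ℕ using (ℕ; zero; suc; _+_; _*_; _∸_; _^_; _≤_; _<_; z≤n; s≤s; _≤?_; _<?_)
open import Data.Nat.Properties as ℕₚ hiding (_≟_; suc-injective; ≡-decSetoid; ≡-irrelevant)
open import Data.Nat.Tactic.RingSolver using (solve-∀)
import Data.Integer as ℤ hiding (+_)
open import Data.Integer using (ℤ; -[1+_]; ∣_∣) renaming (+_ to ⁺_)
import Data.Integer.Properties as ℤₚ
import Data.Integer.Tactic.RingSolver as ℤSolver
open import Data.Bool using (Bool; true; false; if_then_else_; _∧_; _∨_; _xor_; not)
open import Data.Fin as Fin using (Fin; zero; suc; toℕ; fromℕ<; finToFun; funToFin; combine)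
open import Data.Fin.Properties as Finₚ using (_≟_; any?; all?; ¬∀⟶∃¬; pigeonhole; injective⇒≤; finToFun-funToFin; funToFin-finToFin)
open import Data.Fin.Permutation using (permutation)
open import Data.Product using (Σ; ∃; ∃₂; _×_; _,_; proj₁; proj₂)
open import Data.Sum using (_⊎_; inj₁; inj₂; [_,_]′)
open import Data.Maybe using (Maybe; just; nothing)
open import Data.Empty using (⊥; ⊥-elim)
open import Data.List as List using (List; []; _∷_; _++_; length; lookup)
import Data.List.Properties as Listₚ
open import Data.List.Relation.Unary.Any using (Any; here)
open import Data.List.Relation.Unary.All using (All; []; _∷_)
open import Data.List.Relation.Unary.AllPairs using (AllPairs; []; _∷_)
import Data.List.Relation.Unary.All.Properties as Allₚ
import Data.List.Relation.Unary.AllPairs.Properties as AllPairsₚ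
open import Relation.Nullary using (¬_; Dec; yes; no; _×-dec_; _⊎-dec_; ¬?)
open import Relation.Nullary.Decidable using (⌊_⌋; map′; decidable-stable)
import Relation.Binary.PropositionalEquality
open import Relation.Binary.PropositionalEquality using (_≡_; _≢_; refl; sym; trans; cong; cong₂; subst; subst₂; module ≡-Reasoning)
open import Relation.Binary.Construct.Closure.ReflexiveTransitive using (Star; ε; _◅_; _◅◅_)
open import Function using (_∘_; id; case_of_)
open import Algebra.Bundles using (Group)
open import Algebra.Morphism.Structures using (module GroupMorphisms)
import Algebra.Properties.Semiring.Sum

-- Finite sums

-- The fourth power comes from two quadratic costs. Let `p` be the number of steps of the current
-- scale to the diameter, up to a constant. The cell graph has isoperimetric constant `Λ`
-- proportional to `p`; trees of about `Λ` times a logarithm vertices, with a further factor `Λ` for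
-- what is discarded, need a ratio of total weight to cell weight beyond `Λ²` times that logarithm,
-- and squaring absorbs the logarithm. Radii are powers of 4: going down one scale multiplies `p⁴`
-- by `4⁴ = 256`, so a ball that shrinks by more than 256 keeps the density condition, while one
-- that does not has the doubling that cells require. No growth theorem enters, and at the bottom
-- the vertices themselves are the cells.
--
-- Eigenvalues are replaced by an integer kernel and the norms of its powers. The quotient of `M 0`
-- squared by `M 1` stands for the number of large eigenvalues, and log-convexity carries this one
-- bound to all powers.
--
-- Components are only assumed decidable under a double negation. This costs nothing, as the
-- conclusion drawn from them, an inequality between natural numbers, is stable.

module SumN = Algebra.Properties.Semiring.Sum ℕₚ.+-*-semiring

opaque
  Σℕ : ∀ {n} → (Fin n → ℕ) → ℕ
  Σℕ = SumN.sum

  Σℕ-cong : ∀ {n} {f g : Fin n → ℕ} → (∀ i → f i ≡ g i) → Σℕ f ≡ Σℕ g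
  Σℕ-cong = SumN.sum-cong-≗

  Σℕ-+ : ∀ {n} (f g : Fin n → ℕ) → Σℕ (λ i → f i + g i) ≡ Σℕ f + Σℕ g
  Σℕ-+ = SumN.∑-distrib-+

  Σℕ-comm : ∀ {m n} (f : Fin m → Fin n → ℕ) → Σℕ (λ i → Σℕ (f i)) ≡ Σℕ (λ j → Σℕ (λ i → f i j))
  Σℕ-comm = SumN.∑-comm

  Σℕ-*ˡ : ∀ {n} c (f : Fin n → ℕ) → Σℕ (λ i → c * f i) ≡ c * Σℕ f
  Σℕ-*ˡ c f = sym (SumN.*-distribˡ-sum c f)

  Σℕ-*ʳ : ∀ {n} (f : Fin n → ℕ) c → Σℕ (λ i → f i * c) ≡ Σℕ f * c
  Σℕ-*ʳ f c = sym (SumN.*-distribʳ-sum c f)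

  Σℕ-bij : ∀ {n} (f : Fin n → ℕ) (p q : Fin n → Fin n) → (∀ i → p (q i) ≡ i) → (∀ i → q (p i) ≡ i) →
    Σℕ (λ i → f (p i)) ≡ Σℕ f
  Σℕ-bij f p q pq qp = sym (SumN.sum-permute f (permutation p q pq qp))

  Σℕ-mono : ∀ {n} {f g : Fin n → ℕ} → (∀ i → f i ≤ g i) → Σℕ f ≤ Σℕ g
  Σℕ-mono {zero} le = z≤n
  Σℕ-mono {suc n} le = +-mono-≤ (le zero) (Σℕ-mono (le ∘ suc))

  Σℕ-const : ∀ n c → Σℕ {n} (λ _ → c) ≡ n * c
  Σℕ-const zero c = refl
  Σℕ-const (suc n) c = cong (c +_) (Σℕ-const n c)

  Σℕ-zero : ∀ {n} {f : Fin n → ℕ} → (∀ i → f i ≡ 0) → Σℕ f ≡ 0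
  Σℕ-zero {zero} e = refl
  Σℕ-zero {suc n} e = cong₂ _+_ (e zero) (Σℕ-zero (e ∘ suc))

  term≤Σℕ : ∀ {n} (f : Fin n → ℕ) i → f i ≤ Σℕ f
  term≤Σℕ f zero = m≤m+n _ _
  term≤Σℕ f (suc i) = ≤-trans (term≤Σℕ (f ∘ suc) i) (m≤n+m _ _)

  Σℕ-∃≤ : ∀ {n} (f g : Fin (suc n) → ℕ) → Σℕ f ≤ Σℕ g → ∃ λ i → f i ≤ g i
  Σℕ-∃≤ f g le with any? (λ i → f i ≤? g i)
  ... | yes p = p
  ... | no ¬p = ⊥-elim (<⇒≱ (lt f g (λ i → ≰⇒> (λ q → ¬p (i , q)))) le)
    where
    lt : ∀ {n} (f g : Fin (suc n) → ℕ) → (∀ i → g i < f i) → Σℕ g < Σℕ f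
    lt {zero} f g h = +-mono-<-≤ (h zero) z≤n
    lt {suc n} f g h = +-mono-< (h zero) (lt (f ∘ suc) (g ∘ suc) (h ∘ suc))

  Σℕ-pos : ∀ {n} (f : Fin n → ℕ) → 0 < Σℕ f → ∃ λ i → 0 < f i
  Σℕ-pos {suc n} f p with f zero in eq
  ... | suc a = zero , subst (0 <_) (sym eq) (s≤s z≤n)
  ... | zero = let (i , q) = Σℕ-pos (f ∘ suc) p in suc i , q

Σℕ-splitAt : ∀ m {n} (f : Fin (m + n) → ℕ) → Σℕ f ≡ Σℕ (λ i → f (i Fin.↑ˡ n)) + Σℕ (λ j → f (m Fin.↑ʳ j))
Σℕ-splitAt m {n} f = go m f
  where
  opaque
    unfolding Σℕ
    go : ∀ m (f : Fin (m + n) → ℕ) → Σℕ f ≡ Σℕ (λ i → f (i Fin.↑ˡ n)) + Σℕ (λ j → f (m Fin.↑ʳ j))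
    go zero f = refl
    go (suc m) f = trans (cong (f zero +_) (go m (f ∘ suc))) (sym (+-assoc (f zero) _ _))

Σℕ-*Σℕ : ∀ {m n} (f : Fin m → ℕ) (g : Fin n → ℕ) → Σℕ f * Σℕ g ≡ Σℕ (λ i → Σℕ (λ j → f i * g j))
Σℕ-*Σℕ f g = trans (sym (Σℕ-*ʳ f _)) (Σℕ-cong (λ i → sym (Σℕ-*ˡ (f i) g)))

𝟙 : Bool → ℕ
𝟙 true = 1
𝟙 false = 0

𝟙≤1 : ∀ b → 𝟙 b ≤ 1
𝟙≤1 true = s≤s z≤n
𝟙≤1 false = z≤n

𝟙-true : ∀ {b} → b ≡ true → 𝟙 b ≡ 1
𝟙-true refl = refl

𝟙-mono : ∀ {a b} → (a ≡ true → b ≡ true) → 𝟙 a ≤ 𝟙 b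
𝟙-mono {false} f = z≤n
𝟙-mono {true} f rewrite f refl = ≤-refl

𝟙-∨ : ∀ a b → 𝟙 (a ∨ b) ≤ 𝟙 a + 𝟙 b
𝟙-∨ true b = s≤s z≤n
𝟙-∨ false b = ≤-refl

count : ∀ {n} → (Fin n → Bool) → ℕ
count p = Σℕ (λ i → 𝟙 (p i))

count-mono : ∀ {n} {p q : Fin n → Bool} → (∀ i → p i ≡ true → q i ≡ true) → count p ≤ count q
count-mono h = Σℕ-mono (λ i → 𝟙-mono (h i))

count-≤n : ∀ {n} (p : Fin n → Bool) → count p ≤ n
count-≤n {n} p = ≤-trans (Σℕ-mono (λ i → 𝟙≤1 (p i))) (≤-reflexive (trans (Σℕ-const n 1) (*-identityʳ n)))

count-all : ∀ {n} {p : Fin n → Bool} → (∀ i → p i ≡ true) → count p ≡ n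
count-all {n} h = trans (Σℕ-cong (λ i → 𝟙-true (h i))) (trans (Σℕ-const n 1) (*-identityʳ n))

Σℕ-∃≤′ : ∀ {n} → Fin n → (f g : Fin n → ℕ) → Σℕ f ≤ Σℕ g → ∃ λ i → f i ≤ g i
Σℕ-∃≤′ {suc n} _ = Σℕ-∃≤

opaque
  unfolding Σℕ

  count-unique≤1 : ∀ {n} (p : Fin n → Bool) → (∀ i j → p i ≡ true → p j ≡ true → i ≡ j) → count p ≤ 1
  count-unique≤1 {zero} p u = z≤n
  count-unique≤1 {suc n} p u with p zero in eq
  ... | false = count-unique≤1 (p ∘ suc) (λ i j a b → Finₚ.suc-injective (u (suc i) (suc j) a b))
  ... | true = s≤s (≤-reflexive (Σℕ-zero (λ i → help i (p (suc i)) refl)))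
    where
    help : ∀ i b → p (suc i) ≡ b → 𝟙 b ≡ 0
    help i false e = refl
    help i true e with u zero (suc i) eq e
    ... | ()

  Σℕ-δ : ∀ {n} (h : Fin n → ℕ) a → Σℕ (λ z → h z * 𝟙 ⌊ z ≟ a ⌋) ≡ h a
  Σℕ-δ {suc n} h zero = trans (cong₂ _+_ (*-identityʳ (h zero)) (Σℕ-zero (λ z → *-zeroʳ (h (suc z))))) (+-identityʳ (h zero))
  Σℕ-δ {suc n} h (suc a) = trans (cong₂ _+_ (*-zeroʳ (h zero)) (Σℕ-cong (λ z → cong (h (suc z) *_) (shift z)))) (Σℕ-δ (h ∘ suc) a)
    where
    shift : ∀ z → 𝟙 ⌊ suc z ≟ suc a ⌋ ≡ 𝟙 ⌊ z ≟ a ⌋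
    shift z with z ≟ a
    ... | yes _ = refl
    ... | no _ = refl

  count-by-class : ∀ {n m} (p : Fin n → Bool) (c : Fin n → Fin m) →
    count p ≡ Σℕ (λ a → count (λ i → p i ∧ ⌊ c i ≟ a ⌋))
  count-by-class {n} {m} p c = sym (trans (Σℕ-comm (λ a i → 𝟙 (p i ∧ ⌊ c i ≟ a ⌋))) (Σℕ-cong lem))
    where
    δ : ∀ {m} (b : Fin m) → Σℕ (λ a → 𝟙 ⌊ b ≟ a ⌋) ≡ 1
    δ {suc m} zero = cong suc (Σℕ-zero {m} (λ a → refl))
    δ {suc m} (suc b) = trans (Σℕ-cong (λ a → step' a)) (δ b)
      where
      step' : ∀ a → 𝟙 ⌊ suc b ≟ suc a ⌋ ≡ 𝟙 ⌊ b ≟ a ⌋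
      step' a with b ≟ a
      ... | yes _ = refl
      ... | no _ = refl
    lem : ∀ i → Σℕ (λ a → 𝟙 (p i ∧ ⌊ c i ≟ a ⌋)) ≡ 𝟙 (p i)
    lem i with p i
    ... | true = δ (c i)
    ... | false = Σℕ-zero {m} (λ _ → refl)

count-inj≤ : ∀ {n m} (p : Fin n → Bool) (c : Fin n → Fin m) →
  (∀ i j → p i ≡ true → p j ≡ true → c i ≡ c j → i ≡ j) → count p ≤ m
count-inj≤ {n} {m} p c inj = begin
  count p ≡⟨ count-by-class p c ⟩
  Σℕ (λ a → count (λ i → p i ∧ ⌊ c i ≟ a ⌋)) ≤⟨ Σℕ-mono (λ a → count-unique≤1 _ (λ i j x y →
     inj i j (∧l x) (∧l y) (trans (∧r i a x) (sym (∧r j a y))))) ⟩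
  Σℕ {m} (λ _ → 1) ≡⟨ trans (Σℕ-const m 1) (*-identityʳ m) ⟩
  m ∎
  where
  open ≤-Reasoning
  ∧l : ∀ {a b} → a ∧ b ≡ true → a ≡ true
  ∧l {true} _ = refl
  ∧r : ∀ i a → p i ∧ ⌊ c i ≟ a ⌋ ≡ true → c i ≡ a
  ∧r i a e with p i | c i ≟ a
  ... | true | yes q = q

square-sum : ∀ x y → 2 * (x * y) ≤ x * x + y * y
square-sum x y = [ (λ le → h x y le) , (λ le → subst₂ _≤_ (cong (2 *_) (*-comm y x)) (+-comm (y * y) (x * x)) (h y x le)) ]′ (≤-total x y)
  where
  eq : ∀ x d → x * x + (x + d) * (x + d) ≡ 2 * (x * (x + d)) + d * d
  eq = solve-∀
  h : ∀ x y → x ≤ y → 2 * (x * y) ≤ x * x + y * y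
  h x y le = subst (λ y → 2 * (x * y) ≤ x * x + y * y) (m+[n∸m]≡n le)
    (≤-trans (m≤m+n _ _) (≤-reflexive (sym (eq x (y ∸ x)))))

square-cancel : ∀ {x y} → x * x ≤ y * y → x ≤ y
square-cancel {x} {y} le with x ≤? y
... | yes p = p
... | no ¬p = ⊥-elim (<⇒≱ (*-mono-< (≰⇒> ¬p) (≰⇒> ¬p)) le)

-- The form in which Cauchy–Schwarz iterates: square-rooted terms may themselves be bounded by products.
Σℕ-cauchy′ : ∀ {n} (s f g : Fin n → ℕ) → (∀ i → s i * s i ≤ f i * g i) → Σℕ s * Σℕ s ≤ Σℕ f * Σℕ g
Σℕ-cauchy′ {n} s f g le = *-cancelˡ-≤ 2 (begin
  2 * (Σℕ s * Σℕ s) ≡⟨ cong (2 *_) (Σℕ-*Σℕ s s) ⟩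
  2 * Σℕ (λ i → Σℕ (λ j → s i * s j)) ≡⟨ trans (sym (Σℕ-*ˡ 2 _)) (Σℕ-cong (λ i → sym (Σℕ-*ˡ 2 _))) ⟩
  Σℕ (λ i → Σℕ (λ j → 2 * (s i * s j))) ≤⟨ Σℕ-mono (λ i → Σℕ-mono (λ j → pt i j)) ⟩
  Σℕ (λ i → Σℕ (λ j → f i * g j + f j * g i)) ≡⟨ Σℕ-cong (λ i → Σℕ-+ (λ j → f i * g j) (λ j → f j * g i)) ⟩
  Σℕ (λ i → Σℕ (λ j → f i * g j) + Σℕ (λ j → f j * g i)) ≡⟨ Σℕ-+ _ _ ⟩
  Σℕ (λ i → Σℕ (λ j → f i * g j)) + Σℕ (λ i → Σℕ (λ j → f j * g i)) ≡⟨ cong (Σℕ (λ i → Σℕ (λ j → f i * g j)) +_) (Σℕ-comm (λ i j → f j * g i)) ⟩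
  Σℕ (λ i → Σℕ (λ j → f i * g j)) + Σℕ (λ i → Σℕ (λ j → f i * g j)) ≡⟨ cong₂ _+_ (sym (Σℕ-*Σℕ f g)) (sym (Σℕ-*Σℕ f g)) ⟩
  Σℕ f * Σℕ g + Σℕ f * Σℕ g ≡⟨ cong (Σℕ f * Σℕ g +_) (sym (+-identityʳ _)) ⟩
  2 * (Σℕ f * Σℕ g) ∎)
  where
  open ≤-Reasoning
  e1 : ∀ x y → (2 * (x * y)) * (2 * (x * y)) ≡ 4 * ((x * x) * (y * y))
  e1 = solve-∀
  e2 : ∀ a b c d → 4 * ((a * b) * (c * d)) ≡ (2 * ((a * d) * (c * b))) + (2 * ((a * d) * (c * b)))
  e2 = solve-∀
  e3 : ∀ x y → (x + y) * (x + y) ≡ (x * x + y * y) + 2 * (x * y)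
  e3 = solve-∀
  -- The cross terms `f i * g j` and `f j * g i` have a product of at least `(s i * s j)²`, so this
  -- is their arithmetic-geometric mean inequality, squared to avoid roots.
  pt : ∀ i j → 2 * (s i * s j) ≤ f i * g j + f j * g i
  pt i j = square-cancel (begin
    (2 * (s i * s j)) * (2 * (s i * s j)) ≡⟨ e1 (s i) (s j) ⟩
    4 * ((s i * s i) * (s j * s j)) ≤⟨ *-monoʳ-≤ 4 (*-mono-≤ (le i) (le j)) ⟩
    4 * ((f i * g i) * (f j * g j)) ≡⟨ e2 (f i) (g i) (f j) (g j) ⟩
    2 * ((f i * g j) * (f j * g i)) + 2 * ((f i * g j) * (f j * g i)) ≤⟨ +-monoˡ-≤ _ (square-sum (f i * g j) (f j * g i)) ⟩
    ((f i * g j) * (f i * g j) + (f j * g i) * (f j * g i)) + 2 * ((f i * g j) * (f j * g i)) ≡⟨ sym (e3 (f i * g j) (f j * g i)) ⟩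
    (f i * g j + f j * g i) * (f i * g j + f j * g i) ∎)

Σℕ-cauchy : ∀ {n} (f g : Fin n → ℕ) → Σℕ (λ i → f i * g i) * Σℕ (λ i → f i * g i) ≤ Σℕ (λ i → f i * f i) * Σℕ (λ i → g i * g i)
Σℕ-cauchy f g = Σℕ-cauchy′ _ _ _ (λ i → ≤-reflexive (eq (f i) (g i)))
  where
  eq : ∀ a b → (a * b) * (a * b) ≡ (a * a) * (b * b)
  eq = solve-∀

-- Integer sums and squares

module SumZ = Algebra.Properties.Semiring.Sum ℤₚ.+-*-semiring

opaque
  unfolding Σℕ

  Σℤ : ∀ {n} → (Fin n → ℤ) → ℤ
  Σℤ = SumZ.sum

  Σℤ-cong : ∀ {n} {f g : Fin n → ℤ} → (∀ i → f i ≡ g i) → Σℤ f ≡ Σℤ g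
  Σℤ-cong = SumZ.sum-cong-≗

  Σℤ-+ : ∀ {n} (f g : Fin n → ℤ) → Σℤ (λ i → f i ℤ.+ g i) ≡ Σℤ f ℤ.+ Σℤ g
  Σℤ-+ = SumZ.∑-distrib-+

  Σℤ-comm : ∀ {m n} (f : Fin m → Fin n → ℤ) → Σℤ (λ i → Σℤ (f i)) ≡ Σℤ (λ j → Σℤ (λ i → f i j))
  Σℤ-comm = SumZ.∑-comm

  Σℤ-*ˡ : ∀ {n} c (f : Fin n → ℤ) → Σℤ (λ i → c ℤ.* f i) ≡ c ℤ.* Σℤ f
  Σℤ-*ˡ c f = sym (SumZ.*-distribˡ-sum c f)

  Σℤ-*ʳ : ∀ {n} (f : Fin n → ℤ) c → Σℤ (λ i → f i ℤ.* c) ≡ Σℤ f ℤ.* c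
  Σℤ-*ʳ f c = sym (SumZ.*-distribʳ-sum c f)

  Σℤ-bij : ∀ {n} (f : Fin n → ℤ) (p q : Fin n → Fin n) → (∀ i → p (q i) ≡ i) → (∀ i → q (p i) ≡ i) →
    Σℤ (λ i → f (p i)) ≡ Σℤ f
  Σℤ-bij f p q pq qp = sym (SumZ.sum-permute f (permutation p q pq qp))

  Σℤ-const : ∀ n c → Σℤ {n} (λ _ → c) ≡ ⁺ n ℤ.* c
  Σℤ-const zero c = sym (ℤₚ.*-zeroˡ c)
  Σℤ-const (suc n) c = trans (cong (λ t → c ℤ.+ t) (Σℤ-const n c)) (sym (ℤₚ.suc-* (⁺ n) c))

  Σℤ-zero : ∀ {n} {f : Fin n → ℤ} → (∀ i → f i ≡ ⁺ 0) → Σℤ f ≡ ⁺ 0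
  Σℤ-zero {zero} e = refl
  Σℤ-zero {suc n} e = cong₂ ℤ._+_ (e zero) (Σℤ-zero (e ∘ suc))

  Σℤ-suc : ∀ {n} (f : Fin (suc n) → ℤ) → Σℤ f ≡ f zero ℤ.+ Σℤ (f ∘ suc)
  Σℤ-suc f = refl

  Σℤ-empty : ∀ (f : Fin 0 → ℤ) → Σℤ f ≡ ⁺ 0
  Σℤ-empty f = refl

  Σℤ-neg : ∀ {n} (f : Fin n → ℤ) → Σℤ (λ i → ℤ.- f i) ≡ ℤ.- Σℤ f
  Σℤ-neg {zero} f = refl
  Σℤ-neg {suc n} f = trans (cong (λ t → ℤ.- f zero ℤ.+ t) (Σℤ-neg (f ∘ suc))) (sym (ℤₚ.neg-distrib-+ (f zero) _))

  Σℤ-- : ∀ {n} (f g : Fin n → ℤ) → Σℤ (λ i → f i ℤ.- g i) ≡ Σℤ f ℤ.- Σℤ g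
  Σℤ-- f g = trans (Σℤ-+ f (λ i → ℤ.- g i)) (cong (λ t → Σℤ f ℤ.+ t) (Σℤ-neg g))

  +Σℕ : ∀ {n} (f : Fin n → ℕ) → ⁺ Σℕ f ≡ Σℤ (λ i → ⁺ f i)
  +Σℕ {zero} f = refl
  +Σℕ {suc n} f = trans (ℤₚ.pos-+ (f zero) (Σℕ (f ∘ suc))) (cong (ℤ._+_ (⁺ f zero)) (+Σℕ (f ∘ suc)))

  ∣Σℤ∣≤ : ∀ {n} (f : Fin n → ℤ) → ∣ Σℤ f ∣ ≤ Σℕ (λ i → ∣ f i ∣)
  ∣Σℤ∣≤ {zero} f = z≤n
  ∣Σℤ∣≤ {suc n} f = ≤-trans (ℤₚ.∣i+j∣≤∣i∣+∣j∣ (f zero) _) (+-monoʳ-≤ ∣ f zero ∣ (∣Σℤ∣≤ (f ∘ suc)))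

sq : ℤ → ℕ
sq z = ∣ z ∣ * ∣ z ∣

+sq : ∀ z → ⁺ sq z ≡ z ℤ.* z
+sq (⁺ n) = ℤₚ.pos-* n n
+sq -[1+ n ] = refl

∣Σℤ*∣²≤ : ∀ {n} (f g : Fin n → ℤ) → sq (Σℤ (λ i → f i ℤ.* g i)) ≤ Σℕ (λ i → sq (f i)) * Σℕ (λ i → sq (g i))
∣Σℤ*∣²≤ f g = ≤-trans (*-mono-≤ le le) (Σℕ-cauchy (λ i → ∣ f i ∣) (λ i → ∣ g i ∣))
  where
  le : ∣ Σℤ (λ i → f i ℤ.* g i) ∣ ≤ Σℕ (λ i → ∣ f i ∣ * ∣ g i ∣)
  le = ≤-trans (∣Σℤ∣≤ _) (≤-reflexive (Σℕ-cong (λ i → ℤₚ.abs-* (f i) (g i))))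

sq-+ : ∀ a b → sq (a ℤ.+ b) ≤ 2 * sq a + 2 * sq b
sq-+ a b = ≤-trans (*-mono-≤ (ℤₚ.∣i+j∣≤∣i∣+∣j∣ a b) (ℤₚ.∣i+j∣≤∣i∣+∣j∣ a b)) (h ∣ a ∣ ∣ b ∣)
  where
  e1 : ∀ x y → (x + y) * (x + y) ≡ 2 * (x * y) + (x * x + y * y)
  e1 = solve-∀
  e2 : ∀ x y → (x * x + y * y) + (x * x + y * y) ≡ 2 * (x * x) + 2 * (y * y)
  e2 = solve-∀
  h : ∀ x y → (x + y) * (x + y) ≤ 2 * (x * x) + 2 * (y * y)
  h x y = subst₂ _≤_ (sym (e1 x y)) (e2 x y) (+-monoˡ-≤ _ (square-sum x y))

sq-- : ∀ a b → sq (a ℤ.- b) ≤ 2 * sq a + 2 * sq b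
sq-- a b = subst (λ t → sq (a ℤ.- b) ≤ 2 * sq a + 2 * t) (cong₂ _*_ (ℤₚ.∣-i∣≡∣i∣ b) (ℤₚ.∣-i∣≡∣i∣ b)) (sq-+ a (ℤ.- b))

sq-neg : ∀ a → sq (ℤ.- a) ≡ sq a
sq-neg a = cong₂ _*_ (ℤₚ.∣-i∣≡∣i∣ a) (ℤₚ.∣-i∣≡∣i∣ a)

sq-swap : ∀ a b → sq (a ℤ.- b) ≡ sq (b ℤ.- a)
sq-swap a b = cong₂ _*_ (ℤₚ.∣i-j∣≡∣j-i∣ a b) (ℤₚ.∣i-j∣≡∣j-i∣ a b)

true⇒ : ∀ {P : Set} (d : Dec P) → ⌊ d ⌋ ≡ true → P
true⇒ (yes p) _ = p

⇒true : ∀ {P : Set} (d : Dec P) → P → ⌊ d ⌋ ≡ true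
⇒true (yes _) _ = refl
⇒true (no ¬p) p = ⊥-elim (¬p p)

𝟙-not-≤ : ∀ m n → 𝟙 (not ⌊ m ≤? n ⌋) * n ≤ m
𝟙-not-≤ m n with m ≤? n
... | yes _ = z≤n
... | no m≰n = ≤-trans (≤-reflexive (+-identityʳ n)) (<⇒≤ (≰⇒> m≰n))

-- Simple groups and Hilbert–Schmidt norms

record SimpleGroup (K : ℕ) : Set₁ where
  infixl 7 _∙_
  field
    _∙_ : Fin K → Fin K → Fin K
    e : Fin K
    inv : Fin K → Fin K
    assoc : ∀ x y z → (x ∙ y) ∙ z ≡ x ∙ (y ∙ z)
    idˡ : ∀ x → e ∙ x ≡ x
    idʳ : ∀ x → x ∙ e ≡ x
    invˡ : ∀ x → inv x ∙ x ≡ e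
    invʳ : ∀ x → x ∙ inv x ≡ e
    simple : (P : Fin K → Set) → P e → (∀ x y → P x → P y → P (x ∙ y)) → (∀ x → P x → P (inv x)) →
      (∀ g x → P x → P ((g ∙ x) ∙ inv g)) → (x : Fin K) → P x → x ≢ e → ∀ y → P y
    nonabelian : ¬ (∀ x y → x ∙ y ≡ y ∙ x)

  inv-cancelˡ : ∀ g x → inv g ∙ (g ∙ x) ≡ x
  inv-cancelˡ g x = trans (sym (assoc _ _ _)) (trans (cong (_∙ x) (invˡ g)) (idˡ x))

  cancelˡ-inv : ∀ g x → g ∙ (inv g ∙ x) ≡ x
  cancelˡ-inv g x = trans (sym (assoc _ _ _)) (trans (cong (_∙ x) (invʳ g)) (idˡ x))

  inv-cancelʳ : ∀ x g → (x ∙ g) ∙ inv g ≡ x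
  inv-cancelʳ x g = trans (assoc _ _ _) (trans (cong (x ∙_) (invʳ g)) (idʳ x))

  cancelʳ-inv : ∀ x g → (x ∙ inv g) ∙ g ≡ x
  cancelʳ-inv x g = trans (assoc _ _ _) (trans (cong (x ∙_) (invˡ g)) (idʳ x))

  inv-unique : ∀ x y → x ∙ y ≡ e → y ≡ inv x
  inv-unique x y p = trans (sym (inv-cancelˡ x y)) (trans (cong (inv x ∙_) p) (idʳ _))

  inv-∙ : ∀ x y → inv (x ∙ y) ≡ inv y ∙ inv x
  inv-∙ x y = sym (inv-unique (x ∙ y) _ (trans (assoc _ _ _) (trans (cong (x ∙_) (cancelˡ-inv y (inv x))) (invʳ x))))

  conj : Fin K → Fin K → Fin K
  conj k x = (k ∙ x) ∙ inv k

  comm : Fin K → Fin K → Fin K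
  comm g h = (g ∙ h) ∙ inv (h ∙ g)

  comm-trivial : ∀ g h → comm g h ≡ e → g ∙ h ≡ h ∙ g
  comm-trivial g h p = trans (sym (cancelʳ-inv (g ∙ h) (h ∙ g))) (trans (cong (_∙ (h ∙ g)) p) (idˡ _))

  conj-∙ : ∀ k x y → conj k (x ∙ y) ≡ conj k x ∙ conj k y
  conj-∙ k x y = sym (trans (assoc _ _ _) (trans (cong ((k ∙ x) ∙_) (trans (cong (inv k ∙_) (assoc _ _ _)) (inv-cancelˡ k (y ∙ inv k))))
    (trans (sym (assoc _ _ _)) (cong (_∙ inv k) (assoc _ _ _)))))

  conj-conj : ∀ k l x → conj k (conj l x) ≡ conj (k ∙ l) x
  conj-conj k l x = begin
    (k ∙ ((l ∙ x) ∙ inv l)) ∙ inv k ≡⟨ cong (_∙ inv k) (sym (assoc _ _ _)) ⟩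
    ((k ∙ (l ∙ x)) ∙ inv l) ∙ inv k ≡⟨ assoc _ _ _ ⟩
    (k ∙ (l ∙ x)) ∙ (inv l ∙ inv k) ≡⟨ cong₂ _∙_ (sym (assoc _ _ _)) (sym (inv-∙ k l)) ⟩
    ((k ∙ l) ∙ x) ∙ inv (k ∙ l) ∎
    where open ≡-Reasoning

  conj-by-e : ∀ x → conj e x ≡ x
  conj-by-e x = trans (cong₂ _∙_ (idˡ x) (trans (sym (idˡ _)) (invʳ e))) (idʳ x)

  Σℕ-left : ∀ g (f : Fin K → ℕ) → Σℕ (λ x → f (g ∙ x)) ≡ Σℕ f
  Σℕ-left g f = Σℕ-bij f (g ∙_) (inv g ∙_) (cancelˡ-inv g) (inv-cancelˡ g)

  Σℕ-right : ∀ g (f : Fin K → ℕ) → Σℕ (λ x → f (x ∙ g)) ≡ Σℕ f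
  Σℕ-right g f = Σℕ-bij f (_∙ g) (_∙ inv g) (λ x → cancelʳ-inv x g) (λ x → inv-cancelʳ x g)

  Σℤ-left : ∀ g (f : Fin K → ℤ) → Σℤ (λ x → f (g ∙ x)) ≡ Σℤ f
  Σℤ-left g f = Σℤ-bij f (g ∙_) (inv g ∙_) (cancelˡ-inv g) (inv-cancelˡ g)

  Σℤ-right : ∀ g (f : Fin K → ℤ) → Σℤ (λ x → f (x ∙ g)) ≡ Σℤ f
  Σℤ-right g f = Σℤ-bij f (_∙ g) (_∙ inv g) (λ x → cancelʳ-inv x g) (λ x → inv-cancelʳ x g)

  -- A non-trivial g commuting with a whole conjugacy class forces, by simplicity twice, a non-trivial centre.
  no-commuting-class : ∀ g h → g ≢ e → h ≢ e → (∀ k → g ∙ conj k h ≡ conj k h ∙ g) → ⊥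
  no-commuting-class g h g≢e h≢e cm = nonabelian central
    where
    open ≡-Reasoning
    Commutes : Fin K → Fin K → Set
    Commutes x y = x ∙ y ≡ y ∙ x
    C-e : ∀ y → Commutes e y
    C-e y = trans (idˡ y) (sym (idʳ y))
    C-∙ : ∀ x x′ y → Commutes x y → Commutes x′ y → Commutes (x ∙ x′) y
    C-∙ x x′ y p q = begin
      (x ∙ x′) ∙ y ≡⟨ assoc _ _ _ ⟩
      x ∙ (x′ ∙ y) ≡⟨ cong (x ∙_) q ⟩
      x ∙ (y ∙ x′) ≡⟨ sym (assoc _ _ _) ⟩
      (x ∙ y) ∙ x′ ≡⟨ cong (_∙ x′) p ⟩
      (y ∙ x) ∙ x′ ≡⟨ assoc _ _ _ ⟩
      y ∙ (x ∙ x′) ∎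
    C-inv : ∀ x y → Commutes x y → Commutes (inv x) y
    C-inv x y p = begin
      inv x ∙ y ≡⟨ cong (inv x ∙_) (sym (inv-cancelʳ y x)) ⟩
      inv x ∙ ((y ∙ x) ∙ inv x) ≡⟨ cong (λ t → inv x ∙ (t ∙ inv x)) (sym p) ⟩
      inv x ∙ ((x ∙ y) ∙ inv x) ≡⟨ cong (inv x ∙_) (assoc _ _ _) ⟩
      inv x ∙ (x ∙ (y ∙ inv x)) ≡⟨ inv-cancelˡ x _ ⟩
      y ∙ inv x ∎
    C-conj : ∀ k x y → Commutes x y → Commutes (conj k x) (conj k y)
    C-conj k x y p = trans (sym (conj-∙ k x y)) (trans (cong (conj k) p) (conj-∙ k y x))
    P : Fin K → Set
    P x = ∀ k → Commutes x (conj k h)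
    allP : ∀ x → P x
    allP = simple P (λ k → C-e _) (λ x y p q k → C-∙ x y _ (p k) (q k)) (λ x p k → C-inv x _ (p k))
      (λ l x p k → subst (Commutes (conj l x)) (trans (conj-conj l (inv l ∙ k) h) (cong (λ t → conj t h) (cancelˡ-inv l k)))
        (C-conj l x _ (p (inv l ∙ k)))) g cm g≢e
    central : ∀ x y → x ∙ y ≡ y ∙ x
    central x y = simple (λ y → ∀ x → Commutes x y) (λ x → sym (C-e x))
      (λ a b p q x → sym (C-∙ a b x (sym (p x)) (sym (q x)))) (λ a p x → sym (C-inv a x (sym (p x))))
      (λ l a p x → subst (Commutes x) (sym (trans (cong (_∙ inv l) (p l)) (inv-cancelʳ a l))) (p x)) h
      (λ x → subst (Commutes x) (conj-by-e h) (allP x e)) h≢e y x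

n<2^n : ∀ n → n < 2 ^ n
n<2^n zero = s≤s z≤n
n<2^n (suc n) = ≤-trans (+-mono-≤ (≤-trans (s≤s z≤n) (n<2^n n)) (n<2^n n)) (≤-reflexive (cong (2 ^ n +_) (sym (+-identityʳ _))))

Mat : ℕ → Set
Mat K = Fin K → Fin K → ℤ

infixl 7 _⊗_
_⊗_ : ∀ {K} → Mat K → Mat K → Mat K
(U ⊗ V) x y = Σℤ (λ z → U x z ℤ.* V z y)

-- Squared Hilbert–Schmidt norm.
hs : ∀ {K} → Mat K → ℕ
hs U = Σℕ (λ x → Σℕ (λ y → sq (U x y)))

hs-cong : ∀ {K} {U V : Mat K} → (∀ x y → U x y ≡ V x y) → hs U ≡ hs V
hs-cong eq = Σℕ-cong (λ x → Σℕ-cong (λ y → cong sq (eq x y)))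

hs-⊗ : ∀ {K} (U V : Mat K) → hs (U ⊗ V) ≤ hs U * hs V
hs-⊗ U V = begin
  hs (U ⊗ V) ≤⟨ Σℕ-mono (λ x → Σℕ-mono (λ y → ∣Σℤ*∣²≤ (U x) (λ z → V z y))) ⟩
  Σℕ (λ x → Σℕ (λ y → Σℕ (λ z → sq (U x z)) * Σℕ (λ z → sq (V z y)))) ≡⟨ sym (Σℕ-*Σℕ _ _) ⟩
  hs U * Σℕ (λ y → Σℕ (λ z → sq (V z y))) ≡⟨ cong (hs U *_) (Σℕ-comm (λ y z → sq (V z y))) ⟩
  hs U * hs V ∎
  where open ≤-Reasoning

hs-combine : ∀ {K} (U V : Mat K) → hs (λ x y → U x y ℤ.- V x y) ≤ 2 * hs U + 2 * hs V
hs-combine U V = begin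
  hs (λ x y → U x y ℤ.- V x y) ≤⟨ Σℕ-mono (λ x → Σℕ-mono (λ y → sq-- (U x y) (V x y))) ⟩
  Σℕ (λ x → Σℕ (λ y → 2 * sq (U x y) + 2 * sq (V x y))) ≡⟨ Σℕ-cong (λ x → trans (Σℕ-+ _ _) (cong₂ _+_ (Σℕ-*ˡ 2 _) (Σℕ-*ˡ 2 _))) ⟩
  Σℕ (λ x → 2 * Σℕ (λ y → sq (U x y)) + 2 * Σℕ (λ y → sq (V x y))) ≡⟨ trans (Σℕ-+ _ _) (cong₂ _+_ (Σℕ-*ˡ 2 _) (Σℕ-*ˡ 2 _)) ⟩
  2 * hs U + 2 * hs V ∎
  where open ≤-Reasoning

hs-cauchy : ∀ {K} (U V : Mat K) t → ⁺ t ≡ Σℤ (λ x → Σℤ (λ y → U x y ℤ.* V x y)) → t * t ≤ hs U * hs V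
hs-cauchy U V t eq = ≤-trans (*-mono-≤ t≤ t≤) (Σℕ-cauchy′ _ _ _ (λ x → ∣Σℤ*∣²≤ (U x) (V x)))
  where
  t≤ : t ≤ Σℕ (λ x → ∣ Σℤ (λ y → U x y ℤ.* V x y) ∣)
  t≤ = subst (_≤ Σℕ (λ x → ∣ Σℤ (λ y → U x y ℤ.* V x y) ∣)) (cong ∣_∣ (sym eq)) (∣Σℤ∣≤ _)

⊗-assoc : ∀ {K} (U V W : Mat K) x y → ((U ⊗ V) ⊗ W) x y ≡ (U ⊗ (V ⊗ W)) x y
⊗-assoc U V W x y = begin
  Σℤ (λ z → Σℤ (λ w → U x w ℤ.* V w z) ℤ.* W z y) ≡⟨ Σℤ-cong (λ z → sym (Σℤ-*ʳ _ (W z y))) ⟩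
  Σℤ (λ z → Σℤ (λ w → (U x w ℤ.* V w z) ℤ.* W z y)) ≡⟨ Σℤ-comm (λ z w → (U x w ℤ.* V w z) ℤ.* W z y) ⟩
  Σℤ (λ w → Σℤ (λ z → (U x w ℤ.* V w z) ℤ.* W z y)) ≡⟨ Σℤ-cong (λ w → trans (Σℤ-cong (λ z → ℤₚ.*-assoc (U x w) (V w z) (W z y))) (Σℤ-*ˡ (U x w) _)) ⟩
  Σℤ (λ w → U x w ℤ.* Σℤ (λ z → V w z ℤ.* W z y)) ∎
  where open ≡-Reasoning

-- The cross term vanishes with the mean. The two halves are used separately: `spread` bounds a
-- deviation from below, and `spread-mean` says that centring only lowers the second moment.
spread-≡ : ∀ {K} (t : Fin K → ℤ) c → Σℤ t ≡ ⁺ 0 → Σℕ (λ g → sq (t g ℤ.- c)) ≡ Σℕ (λ g → sq (t g)) + K * sq c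
spread-≡ {K} t c zero-sum = ℤₚ.+-injective (begin
  ⁺ Σℕ (λ g → sq (t g ℤ.- c)) ≡⟨ trans (+Σℕ _) (Σℤ-cong (λ g → trans (+sq (t g ℤ.- c)) (ring (t g) c))) ⟩
  Σℤ (λ g → (t g ℤ.* t g ℤ.+ c ℤ.* c) ℤ.- (c ℤ.+ c) ℤ.* t g) ≡⟨ Σℤ-- (λ g → t g ℤ.* t g ℤ.+ c ℤ.* c) (λ g → (c ℤ.+ c) ℤ.* t g) ⟩
  Σℤ (λ g → t g ℤ.* t g ℤ.+ c ℤ.* c) ℤ.- Σℤ (λ g → (c ℤ.+ c) ℤ.* t g) ≡⟨ cong₂ ℤ._-_ (trans (Σℤ-+ (λ g → t g ℤ.* t g) (λ _ → c ℤ.* c)) (cong₂ ℤ._+_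
     (trans (Σℤ-cong (λ g → sym (+sq (t g)))) (sym (+Σℕ _))) (trans (Σℤ-const K (c ℤ.* c)) (trans (cong (⁺ K ℤ.*_) (sym (+sq c))) (sym (ℤₚ.pos-* K (sq c)))))))
     (trans (Σℤ-*ˡ (c ℤ.+ c) t) (trans (cong ((c ℤ.+ c) ℤ.*_) zero-sum) (ℤₚ.*-zeroʳ (c ℤ.+ c)))) ⟩
  ⁺ (Σℕ (λ g → sq (t g)) + K * sq c) ℤ.- ⁺ 0 ≡⟨ ℤₚ.+-identityʳ _ ⟩
  ⁺ (Σℕ (λ g → sq (t g)) + K * sq c) ∎)
  where
  open ≡-Reasoning
  ring : ∀ p q → (p ℤ.- q) ℤ.* (p ℤ.- q) ≡ (p ℤ.* p ℤ.+ q ℤ.* q) ℤ.- (q ℤ.+ q) ℤ.* p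
  ring = ℤSolver.solve-∀

spread : ∀ {K} (t : Fin K → ℤ) c → Σℤ t ≡ ⁺ 0 → K * sq c ≤ Σℕ (λ g → sq (t g ℤ.- c))
spread t c zero-sum = ≤-trans (m≤n+m _ _) (≤-reflexive (sym (spread-≡ t c zero-sum)))

spread-mean : ∀ {K} (t : Fin K → ℤ) c → Σℤ t ≡ ⁺ 0 → Σℕ (λ g → sq (t g)) ≤ Σℕ (λ g → sq (t g ℤ.- c))
spread-mean t c zero-sum = ≤-trans (m≤m+n _ _) (≤-reflexive (sym (spread-≡ t c zero-sum)))

-- D n g measures how far g is from acting trivially on the rows of the (n + 1)-st power of b, a
-- substitute for the eigenspaces of b that needs only integers.
module Energy {K : ℕ} (𝔾 : SimpleGroup K) (b : Mat K)
  (b-sym : ∀ x y → b x y ≡ b y x)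
  (b-inv : ∀ g x y → b (SimpleGroup._∙_ 𝔾 g x) (SimpleGroup._∙_ 𝔾 g y) ≡ b x y)
  (b-zero : ∀ x → Σℤ (b x) ≡ ⁺ 0)
  where
  open SimpleGroup 𝔾

  -- pw n is the (n + 1)-st power of b.
  pw : ℕ → Mat K
  pw zero = b
  pw (suc n) = b ⊗ pw n

  pw-comm : ∀ n x y → (pw n ⊗ b) x y ≡ pw (suc n) x y
  pw-comm zero x y = refl
  pw-comm (suc n) x y = trans (⊗-assoc b (pw n) b x y) (Σℤ-cong (λ z → cong (b x z ℤ.*_) (pw-comm n z y)))

  pw-inv : ∀ n g x y → pw n (g ∙ x) (g ∙ y) ≡ pw n x y
  pw-inv zero = b-inv
  pw-inv (suc n) g x y = trans (sym (Σℤ-left g _)) (Σℤ-cong (λ z → cong₂ ℤ._*_ (b-inv g x z) (pw-inv n g z y)))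

  pw-zero : ∀ n y → Σℤ (λ z → pw n z y) ≡ ⁺ 0
  pw-zero zero y = trans (Σℤ-cong (λ z → b-sym z y)) (b-zero y)
  pw-zero (suc n) y = begin
    Σℤ (λ z → Σℤ (λ w → b z w ℤ.* pw n w y)) ≡⟨ Σℤ-comm (λ z w → b z w ℤ.* pw n w y) ⟩
    Σℤ (λ w → Σℤ (λ z → b z w ℤ.* pw n w y)) ≡⟨ Σℤ-cong (λ w → trans (Σℤ-*ʳ _ (pw n w y))
      (cong (ℤ._* pw n w y) (trans (Σℤ-cong (λ z → b-sym z w)) (b-zero w)))) ⟩
    Σℤ (λ w → ⁺ 0 ℤ.* pw n w y) ≡⟨ Σℤ-zero (λ w → ℤₚ.*-zeroˡ (pw n w y)) ⟩
    ⁺ 0 ∎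
    where open ≡-Reasoning

  ∂ : Fin K → Mat K → Mat K
  ∂ g U x y = U (g ∙ x) y ℤ.- U x y

  M : ℕ → ℕ
  M n = hs (pw n)

  D : ℕ → Fin K → ℕ
  D n g = hs (∂ g (pw n))

  -- Invariance of `U` moves the translation by `h` from the second factor to the left of the
  -- product, which thus becomes a mixed second difference of `U ⊗ V`.
  ∂⊗ : ∀ g h (U V : Mat K) → (∀ k x y → U (k ∙ x) (k ∙ y) ≡ U x y) → ∀ x y →
    (∂ g U ⊗ ∂ h V) x y ≡ ((U ⊗ V) (h ∙ (g ∙ x)) y ℤ.- (U ⊗ V) (g ∙ x) y) ℤ.- ((U ⊗ V) (h ∙ x) y ℤ.- (U ⊗ V) x y)
  ∂⊗ g h U V inv-U x y = begin
    Σℤ (λ z → (U gx z ℤ.- U x z) ℤ.* (V (h ∙ z) y ℤ.- V z y)) ≡⟨ Σℤ-cong (λ z → ring (U gx z) (U x z) (V (h ∙ z) y) (V z y)) ⟩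
    Σℤ (λ z → (U gx z ℤ.* V (h ∙ z) y ℤ.- U gx z ℤ.* V z y) ℤ.- (U x z ℤ.* V (h ∙ z) y ℤ.- U x z ℤ.* V z y))
      ≡⟨ trans (Σℤ-- (λ z → U gx z ℤ.* V (h ∙ z) y ℤ.- U gx z ℤ.* V z y) (λ z → U x z ℤ.* V (h ∙ z) y ℤ.- U x z ℤ.* V z y))
           (cong₂ ℤ._-_ (Σℤ-- (λ z → U gx z ℤ.* V (h ∙ z) y) (λ z → U gx z ℤ.* V z y))
             (Σℤ-- (λ z → U x z ℤ.* V (h ∙ z) y) (λ z → U x z ℤ.* V z y))) ⟩
    (Σℤ (λ z → U gx z ℤ.* V (h ∙ z) y) ℤ.- (U ⊗ V) gx y) ℤ.- (Σℤ (λ z → U x z ℤ.* V (h ∙ z) y) ℤ.- (U ⊗ V) x y)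
      ≡⟨ cong₂ (λ s t → (s ℤ.- (U ⊗ V) gx y) ℤ.- (t ℤ.- (U ⊗ V) x y)) (shift gx) (shift x) ⟩
    _ ∎
    where
    open ≡-Reasoning
    gx = g ∙ x
    ring : ∀ p q r s → (p ℤ.- q) ℤ.* (r ℤ.- s) ≡ (p ℤ.* r ℤ.- p ℤ.* s) ℤ.- (q ℤ.* r ℤ.- q ℤ.* s)
    ring = ℤSolver.solve-∀
    shift : ∀ x → Σℤ (λ z → U x z ℤ.* V (h ∙ z) y) ≡ (U ⊗ V) (h ∙ x) y
    shift x = trans (Σℤ-cong (λ z → cong (ℤ._* V (h ∙ z) y) (sym (inv-U h x z)))) (Σℤ-left h (λ z → U (h ∙ x) z ℤ.* V z y))

  -- This is `gh - hg = (g - 1)(h - 1) - (h - 1)(g - 1)`. The power splits into `b` and `pw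
  -- m`, in either order; `∂⊗` gives one difference to each factor, and the norm of a product is at
  -- most the product of the norms. Substituting `(h ∙ g) ∙ x` for `x` first turns the commutator
  -- into the two products.
  D-comm : ∀ m g h → D (suc m) (comm g h) ≤ 4 * (D m g * D 0 h)
  D-comm m g h = begin
    hs (∂ (comm g h) T) ≡⟨ sym (Σℕ-left (h ∙ g) (λ x → Σℕ (λ y → sq (∂ (comm g h) T x y)))) ⟩
    hs (λ x y → T (comm g h ∙ ((h ∙ g) ∙ x)) y ℤ.- T ((h ∙ g) ∙ x) y) ≡⟨ hs-cong (λ x y →
      trans (cong₂ (λ s t → T s y ℤ.- T t y) (trans (sym (assoc _ _ _)) (trans (cong (_∙ x) (cancelʳ-inv (g ∙ h) (h ∙ g))) (assoc g h x))) (assoc h g x))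
        (trans (ring (T (g ∙ (h ∙ x)) y) (T (h ∙ (g ∙ x)) y) (T (g ∙ x) y) (T (h ∙ x) y) (T x y))
          (sym (cong₂ ℤ._-_ (∂⊗ h g b (pw m) b-inv x y)
            (trans (∂⊗ g h (pw m) b (pw-inv m) x y) (cong₂ ℤ._-_ (cong₂ ℤ._-_ (pw-comm m (h ∙ (g ∙ x)) y) (pw-comm m (g ∙ x) y)) (cong₂ ℤ._-_ (pw-comm m (h ∙ x) y) (pw-comm m x y)))))))) ⟩
    hs (λ x y → (∂ h b ⊗ ∂ g (pw m)) x y ℤ.- (∂ g (pw m) ⊗ ∂ h b) x y) ≤⟨ hs-combine (∂ h b ⊗ ∂ g (pw m)) (∂ g (pw m) ⊗ ∂ h b) ⟩
    2 * hs (∂ h b ⊗ ∂ g (pw m)) + 2 * hs (∂ g (pw m) ⊗ ∂ h b) ≤⟨ +-mono-≤ (*-monoʳ-≤ 2 (hs-⊗ (∂ h b) (∂ g (pw m)))) (*-monoʳ-≤ 2 (hs-⊗ (∂ g (pw m)) (∂ h b))) ⟩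
    2 * (D 0 h * D m g) + 2 * (D m g * D 0 h) ≡⟨ ring′ (D 0 h) (D m g) ⟩
    4 * (D m g * D 0 h) ∎
    where
    open ≤-Reasoning
    T = pw (suc m)
    ring : ∀ p q r s t → p ℤ.- q ≡ ((p ℤ.- s) ℤ.- (r ℤ.- t)) ℤ.- ((q ℤ.- r) ℤ.- (s ℤ.- t))
    ring = ℤSolver.solve-∀
    ring′ : ∀ p q → 2 * (p * q) + 2 * (q * p) ≡ 4 * (q * p)
    ring′ = solve-∀

  D-∙ : ∀ n g h → D n (g ∙ h) ≤ 2 * D n g + 2 * D n h
  D-∙ n g h = begin
    D n (g ∙ h) ≡⟨ hs-cong (λ x y → trans (cong (λ s → pw n s y ℤ.- pw n x y) (assoc g h x)) (ring (pw n (g ∙ (h ∙ x)) y) (pw n (h ∙ x) y) (pw n x y))) ⟩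
    hs (λ x y → A x y ℤ.- B x y) ≤⟨ hs-combine A B ⟩
    2 * hs A + 2 * hs B ≡⟨ cong₂ (λ s t → 2 * s + 2 * t) (Σℕ-left h (λ x → Σℕ (λ y → sq (∂ g (pw n) x y)))) (hs-swap) ⟩
    2 * D n g + 2 * D n h ∎
    where
    open ≤-Reasoning
    A B : Mat K
    A x y = pw n (g ∙ (h ∙ x)) y ℤ.- pw n (h ∙ x) y
    B x y = pw n x y ℤ.- pw n (h ∙ x) y
    ring : ∀ p q r → p ℤ.- r ≡ (p ℤ.- q) ℤ.- (r ℤ.- q)
    ring = ℤSolver.solve-∀
    hs-swap : hs B ≡ D n h
    hs-swap = Σℕ-cong (λ x → Σℕ-cong (λ y → sq-swap (pw n x y) (pw n (h ∙ x) y)))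

  D-e : ∀ n → D n e ≡ 0
  D-e n = Σℕ-zero (λ x → Σℕ-zero (λ y → cong sq (trans (cong (λ s → pw n s y ℤ.- pw n x y) (idˡ x)) (ℤₚ.+-inverseʳ (pw n x y)))))

  D-inv : ∀ n g → D n (inv g) ≡ D n g
  D-inv n g = trans (sym (Σℕ-left g (λ x → Σℕ (λ y → sq (∂ (inv g) (pw n) x y))))) (Σℕ-cong (λ x → Σℕ-cong (λ y →
    trans (cong (λ s → sq (pw n s y ℤ.- pw n (g ∙ x) y)) (inv-cancelˡ g x)) (sq-swap (pw n x y) (pw n (g ∙ x) y)))))

  D-conj : ∀ n k g → D n (conj k g) ≡ D n g
  D-conj n k g = begin
    D n (conj k g) ≡⟨ sym (Σℕ-left k (λ x → Σℕ (λ y → sq (∂ (conj k g) (pw n) x y)))) ⟩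
    Σℕ (λ x → Σℕ (λ y → sq (pw n (conj k g ∙ (k ∙ x)) y ℤ.- pw n (k ∙ x) y))) ≡⟨ Σℕ-cong (λ x → sym (Σℕ-left k _)) ⟩
    Σℕ (λ x → Σℕ (λ y → sq (pw n (conj k g ∙ (k ∙ x)) (k ∙ y) ℤ.- pw n (k ∙ x) (k ∙ y)))) ≡⟨ Σℕ-cong (λ x → Σℕ-cong (λ y →
       cong sq (cong₂ ℤ._-_ (trans (cong (λ s → pw n s (k ∙ y)) (mv x)) (pw-inv n k (g ∙ x) y)) (pw-inv n k x y)))) ⟩
    D n g ∎
    where
    open ≡-Reasoning
    mv : ∀ x → conj k g ∙ (k ∙ x) ≡ k ∙ (g ∙ x)
    mv x = trans (sym (assoc _ _ _)) (trans (cong (_∙ x) (cancelʳ-inv (k ∙ g) k)) (assoc k g x))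

  -- Symmetry of `b` moves one factor across the inner product, so `M (suc n)` is the pairing of
  -- `pw n` with `pw (suc (suc n))`. In terms of eigenvalues, `M n` is the sum of the powers
  -- `λ ^ (2n + 2)`.
  log-convex : ∀ n → M (suc n) * M (suc n) ≤ M n * M (suc (suc n))
  log-convex n = hs-cauchy (pw n) (pw (suc (suc n))) (M (suc n)) (begin
    ⁺ M (suc n) ≡⟨ trans (+Σℕ _) (Σℤ-cong (λ x → trans (+Σℕ _) (Σℤ-cong (λ y → +sq (pw (suc n) x y))))) ⟩
    Σℤ (λ x → Σℤ (λ y → pw (suc n) x y ℤ.* pw (suc n) x y)) ≡⟨ Σℤ-cong (λ x → Σℤ-cong (λ y → sym (Σℤ-*ʳ _ (pw (suc n) x y)))) ⟩
    Σℤ (λ x → Σℤ (λ y → Σℤ (λ z → (b x z ℤ.* pw n z y) ℤ.* pw (suc n) x y))) ≡⟨ Σℤ-cong (λ x → Σℤ-comm (λ y z → (b x z ℤ.* pw n z y) ℤ.* pw (suc n) x y)) ⟩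
    Σℤ (λ x → Σℤ (λ z → Σℤ (λ y → (b x z ℤ.* pw n z y) ℤ.* pw (suc n) x y))) ≡⟨ Σℤ-comm (λ x z → Σℤ (λ y → (b x z ℤ.* pw n z y) ℤ.* pw (suc n) x y)) ⟩
    Σℤ (λ z → Σℤ (λ x → Σℤ (λ y → (b x z ℤ.* pw n z y) ℤ.* pw (suc n) x y))) ≡⟨ Σℤ-cong (λ z → Σℤ-comm (λ x y → (b x z ℤ.* pw n z y) ℤ.* pw (suc n) x y)) ⟩
    Σℤ (λ z → Σℤ (λ y → Σℤ (λ x → (b x z ℤ.* pw n z y) ℤ.* pw (suc n) x y))) ≡⟨ Σℤ-cong (λ z → Σℤ-cong (λ y → trans (Σℤ-cong (λ x →
       trans (cong (λ s → (s ℤ.* pw n z y) ℤ.* pw (suc n) x y) (b-sym x z)) (ring (b z x) (pw n z y) (pw (suc n) x y)))) (Σℤ-*ˡ (pw n z y) _))) ⟩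
    Σℤ (λ z → Σℤ (λ y → pw n z y ℤ.* pw (suc (suc n)) z y)) ∎)
    where
    open ≡-Reasoning
    ring : ∀ p q r → (p ℤ.* q) ℤ.* r ≡ q ℤ.* (p ℤ.* r)
    ring = ℤSolver.solve-∀

  -- As `g` varies, `g ∙ x` runs through a column of mean zero, so `spread` applies to every entry.
  total : ∀ n → K * M n ≤ Σℕ (λ g → D n g)
  total n = begin
    K * M n ≡⟨ trans (sym (Σℕ-*ˡ K _)) (Σℕ-cong (λ x → sym (Σℕ-*ˡ K _))) ⟩
    Σℕ (λ x → Σℕ (λ y → K * sq (pw n x y))) ≤⟨ Σℕ-mono (λ x → Σℕ-mono (λ y → spread (λ g → pw n (g ∙ x) y) (pw n x y)
      (trans (Σℤ-right x (λ z → pw n z y)) (pw-zero n y)))) ⟩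
    Σℕ (λ x → Σℕ (λ y → Σℕ (λ g → sq (pw n (g ∙ x) y ℤ.- pw n x y)))) ≡⟨ Σℕ-cong (λ x → Σℕ-comm (λ y g → sq (pw n (g ∙ x) y ℤ.- pw n x y))) ⟩
    Σℕ (λ x → Σℕ (λ g → Σℕ (λ y → sq (pw n (g ∙ x) y ℤ.- pw n x y)))) ≡⟨ Σℕ-comm (λ x g → Σℕ (λ y → sq (pw n (g ∙ x) y ℤ.- pw n x y))) ⟩
    Σℕ (λ g → D n g) ∎
    where open ≤-Reasoning

  -- By simplicity every group element is controlled by g, and on average D is at least M.
  faithful : ∀ g → g ≢ e → ∃ λ C → ∀ n → M n ≤ C * D n g
  faithful g g≢e = Σℕ (λ x → proj₁ (all x)) , λ n → ≤-trans (K≥1 (M n)) (≤-trans (total n)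
      (≤-trans (Σℕ-mono (λ x → proj₂ (all x) n)) (≤-reflexive (Σℕ-*ʳ _ (D n g)))))
    where
    P : Fin K → Set
    P x = ∃ λ C → ∀ n → D n x ≤ C * D n g
    ring : ∀ c d t → 2 * (c * t) + 2 * (d * t) ≡ (2 * c + 2 * d) * t
    ring = solve-∀
    all : ∀ x → P x
    all = simple P (0 , λ n → ≤-reflexive (D-e n))
      (λ { x y (c , p) (d , q) → 2 * c + 2 * d , λ n → ≤-trans (D-∙ n x y) (≤-trans (+-mono-≤ (*-monoʳ-≤ 2 (p n)) (*-monoʳ-≤ 2 (q n))) (≤-reflexive (ring c d (D n g)))) })
      (λ { x (c , p) → c , λ n → ≤-trans (≤-reflexive (D-inv n x)) (p n) })
      (λ { k x (c , p) → c , λ n → ≤-trans (≤-reflexive (D-conj n k x)) (p n) })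
      g (1 , λ n → ≤-reflexive (sym (*-identityˡ _))) g≢e
    K≥1 : ∀ m → m ≤ K * m
    K≥1 m = ≤-trans (≤-reflexive (sym (*-identityˡ m))) (*-monoˡ-≤ m (pos g))
      where
      pos : ∀ {K} → Fin K → 1 ≤ K
      pos {suc K} _ = s≤s z≤n

  -- `m₀` bounds the quotient of `(Σ λ²)²` by `Σ λ⁴`, an effective rank of `b`.
  module _ (m₀ : ℕ) (M₀² : M 0 * M 0 ≤ m₀ * M 1) (M-pos : 0 < M 0) where

    -- Log-convexity makes the quotients of successive values of `M` non-decreasing, so the bound on
    -- the first one holds for all.
    ratio : ∀ n → M 0 * M n ≤ m₀ * M (suc n)
    ratio zero = M₀²
    ratio (suc n) with M (suc n) in eq
    ... | zero = ≤-trans (≤-reflexive (*-zeroʳ (M 0))) z≤n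
    ... | suc t = *-cancelʳ-≤ (M 0 * suc t) (m₀ * M (suc (suc n))) (suc t) (begin
      (M 0 * suc t) * suc t ≡⟨ *-assoc (M 0) _ _ ⟩
      M 0 * (suc t * suc t) ≡⟨ cong (λ s → M 0 * (s * s)) (sym eq) ⟩
      M 0 * (M (suc n) * M (suc n)) ≤⟨ *-monoʳ-≤ (M 0) (log-convex n) ⟩
      M 0 * (M n * M (suc (suc n))) ≡⟨ sym (*-assoc (M 0) _ _) ⟩
      (M 0 * M n) * M (suc (suc n)) ≤⟨ *-monoˡ-≤ _ (ratio n) ⟩
      (m₀ * M (suc n)) * M (suc (suc n)) ≡⟨ cong (λ s → (m₀ * s) * M (suc (suc n))) eq ⟩
      (m₀ * suc t) * M (suc (suc n)) ≡⟨ ring m₀ (suc t) _ ⟩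
      (m₀ * M (suc (suc n))) * suc t ∎)
      where
      open ≤-Reasoning
      ring : ∀ p q r → (p * q) * r ≡ (p * r) * q
      ring = solve-∀

    m₀*M-pos : ∀ n → 0 < m₀ * M (suc n)
    M-pos′ : ∀ n → 0 < M n
    M-pos′ zero = M-pos
    M-pos′ (suc n) with M (suc n) | m₀*M-pos n
    ... | zero | p = ⊥-elim (<-irrefl (sym (*-zeroʳ m₀)) p)
    ... | suc t | _ = s≤s z≤n
    m₀*M-pos n = ≤-trans (*-mono-≤ M-pos (M-pos′ n)) (ratio n)

    m₀-pos : 0 < m₀
    m₀-pos = factor-pos m₀ (m₀*M-pos 0)
      where
      factor-pos : ∀ a {b} → 0 < a * b → 0 < a
      factor-pos (suc a) _ = s≤s z≤n

    -- Commutators with conjugates of h shrink by a factor of two at each step, contradicting faithfulness.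
    no-small-element : ∀ h → h ≢ e → 8 * (m₀ * D 0 h) ≤ M 0 → ⊥
    no-small-element h h≢e small = <⇒≱ (n<2^n (Cmax * C₀)) (bound (Cmax * C₀))
      where
      open ≤-Reasoning
      C₀ : ℕ
      C₀ = D 0 h
      Shrunk : ℕ → Set
      Shrunk n = ∃ λ g → g ≢ e × 2 ^ n * D n g ≤ C₀ * M n
      next : ∀ g → g ≢ e → ∃ λ k → comm g (conj k h) ≢ e
      next g g≢e = ¬∀⟶∃¬ K _ (λ k → comm g (conj k h) ≟ e)
        (λ all → no-commuting-class g h g≢e h≢e (λ k → comm-trivial g (conj k h) (all k)))
      r1 : ∀ m p d s → m * ((2 * p) * (4 * (d * s))) ≡ (p * d) * (8 * (m * s))
      r1 = solve-∀
      r2 : ∀ c p q → (c * p) * q ≡ c * (q * p)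
      r2 = solve-∀
      r3 : ∀ c p q → c * (p * q) ≡ p * (c * q)
      r3 = solve-∀
      shrink : ∀ n → Shrunk n
      shrink zero = h , h≢e , ≤-trans (≤-reflexive (+-identityʳ _)) (≤-trans (≤-reflexive (sym (*-identityʳ _))) (*-monoʳ-≤ C₀ M-pos))
      shrink (suc n) with shrink n
      ... | g , g≢e , le with next g g≢e
      ... | k , ne = comm g (conj k h) , ne , *-cancelˡ-≤ m₀ {{ℕ.>-nonZero m₀-pos}} (begin
        -- By `small`, passing to the commutator multiplies `D` by at most `M 0 / 2 m₀`, while by
        -- `ratio` the norm `M` keeps at least the fraction `M 0 / m₀`; hence `D / M` is halved.
        m₀ * ((2 * 2 ^ n) * D (suc n) (comm g (conj k h))) ≤⟨ *-monoʳ-≤ m₀ (*-monoʳ-≤ (2 * 2 ^ n) (D-comm n g (conj k h))) ⟩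
        m₀ * ((2 * 2 ^ n) * (4 * (D n g * D 0 (conj k h)))) ≡⟨ cong (λ s → m₀ * ((2 * 2 ^ n) * (4 * (D n g * s)))) (D-conj 0 k h) ⟩
        m₀ * ((2 * 2 ^ n) * (4 * (D n g * D 0 h))) ≡⟨ r1 m₀ (2 ^ n) (D n g) (D 0 h) ⟩
        (2 ^ n * D n g) * (8 * (m₀ * D 0 h)) ≤⟨ *-mono-≤ le small ⟩
        (C₀ * M n) * M 0 ≡⟨ r2 C₀ (M n) (M 0) ⟩
        C₀ * (M 0 * M n) ≤⟨ *-monoʳ-≤ C₀ (ratio n) ⟩
        C₀ * (m₀ * M (suc n)) ≡⟨ r3 C₀ m₀ _ ⟩
        m₀ * (C₀ * M (suc n)) ∎)
      C : Fin K → ℕ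
      C g with g ≟ e
      ... | yes _ = 0
      ... | no g≢e = proj₁ (faithful g g≢e)
      -- The element `g` changes with `n`, so one constant is needed for the whole group; the sum of
      -- the individual ones serves.
      Cmax : ℕ
      Cmax = Σℕ C
      C≥ : ∀ g → g ≢ e → ∀ n → M n ≤ C g * D n g
      C≥ g g≢e n with g ≟ e
      ... | yes p = ⊥-elim (g≢e p)
      ... | no q = proj₂ (faithful g q) n
      bound : ∀ n → 2 ^ n ≤ Cmax * C₀
      bound n with shrink n
      ... | g , g≢e , le = *-cancelʳ-≤ (2 ^ n) (Cmax * C₀) (M n) {{ℕ.>-nonZero (M-pos′ n)}} (begin
        2 ^ n * M n ≤⟨ *-monoʳ-≤ (2 ^ n) (≤-trans (C≥ g g≢e n) (*-monoˡ-≤ (D n g) (term≤Σℕ C g))) ⟩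
        2 ^ n * (Cmax * D n g) ≡⟨ r3 (2 ^ n) Cmax (D n g) ⟩
        Cmax * (2 ^ n * D n g) ≤⟨ *-monoʳ-≤ Cmax le ⟩
        Cmax * (C₀ * M n) ≡⟨ sym (*-assoc Cmax C₀ (M n)) ⟩
        (Cmax * C₀) * M n ∎)

-- Sets of slow growth

-- One greedy choice serves three times: as a net for `Close`, as the set of Voronoi centres, and as
-- representatives of an equivalence relation.
record SeparatedCover {A : Set} {n : ℕ} (R : A → A → Set) (x : Fin n → A) : Set where
  field
    size : ℕ
    points : Fin size → A
    separated : ∀ i j → R (points i) (points j) → i ≡ j
    covers : ∀ i → ∃ λ j → R (x i) (points j)

separated-cover : ∀ {A : Set} {R : A → A → Set} → (∀ x y → Dec (R x y)) → (∀ x → R x x) → (∀ {x y} → R x y → R y x) →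
  ∀ {n} (x : Fin n → A) → SeparatedCover R x
separated-cover R? R-refl R-sym {zero} x = record { size = 0 ; points = λ () ; separated = λ () ; covers = λ () }
separated-cover {A} {R} R? R-refl R-sym {suc n} x with separated-cover {R = R} R? R-refl R-sym (x ∘ suc)
... | c with any? (λ j → R? (x zero) (SeparatedCover.points c j))
... | yes near = record { size = size ; points = points ; separated = separated ; covers = λ { zero → near ; (suc i) → covers i } }
  where open SeparatedCover c
... | no far = record { size = suc size ; points = points′ ; separated = sep ; covers = cov }
  where
  open SeparatedCover c
  points′ : Fin (suc size) → A
  points′ zero = x zero
  points′ (suc j) = points j
  sep : ∀ i j → R (points′ i) (points′ j) → i ≡ j
  sep zero zero r = refl
  sep zero (suc j) r = ⊥-elim (far (j , r))
  sep (suc i) zero r = ⊥-elim (far (i , R-sym r))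
  sep (suc i) (suc j) r = cong suc (separated i j r)
  cov : ∀ i → ∃ λ j → R (x i) (points′ j)
  cov zero = zero , R-refl _
  cov (suc i) = let (j , r) = covers i in suc j , r

opaque
  -- This is `8 * M` times the `176 * M⁵` of `Close`: two rows with equal estimates satisfy
  -- `samples M * ρ ≤ 8 * V`, and `V ≤ M * f³`. The factor 2 in `packing-bound` pays for badly
  -- estimated rows, and `order-bound` counts the maps from a net to itself.
  samples : ℕ → ℕ
  samples M = 1408 * (M * M * M * M * M * M)

  packing-bound : ℕ → ℕ
  packing-bound M = 2 * 2 ^ samples M

  order-bound : ℕ → ℕ
  order-bound M = packing-bound M ^ packing-bound M

sq-of-neg : ∀ {c : ℤ} {x : ℕ} → c ≡ ℤ.- ⁺ x → sq c ≡ x * x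
sq-of-neg {x = x} refl = sq-neg (⁺ x)

square-pos : ∀ {x} → 0 < x * x → 0 < x
square-pos {suc x} _ = s≤s z≤n

ring-M₁ : ∀ K f → f * (K * (K * K) * ((f * (f * f)) * ((f * (f * f)) * (f * (f * f))))) ≡ K * ((K * (f * (f * f) * (f * f))) * (K * (f * (f * f) * (f * f))))
ring-M₁ = solve-∀

-- Q is the Cayley graph relation of a large symmetric set that needs more than five steps to fill the group.
module SlowGrowth {K : ℕ} (𝔾 : SimpleGroup K) (Q : Fin K → Fin K → Bool)
  (Q-sym : ∀ x y → Q x y ≡ Q y x)
  (Q-inv : ∀ g x y → Q (SimpleGroup._∙_ 𝔾 g x) (SimpleGroup._∙_ 𝔾 g y) ≡ Q x y)
  (M : ℕ) (dense : K ≤ M * count (Q (SimpleGroup.e 𝔾)))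
  (o w : Fin K) (slow : ∀ z₁ z₂ z₃ z₄ → Q o z₁ ≡ true → Q z₁ z₂ ≡ true → Q z₂ z₃ ≡ true → Q z₃ z₄ ≡ true → Q z₄ w ≡ true → ⊥)
  where
  open SimpleGroup 𝔾

  f : ℕ
  f = count (Q e)

  ι : Fin K → Fin K → ℕ
  ι x y = 𝟙 (Q x y)

  row : ∀ x → Σℕ (ι x) ≡ f
  row x = trans (sym (Σℕ-left x (ι x))) (Σℕ-cong (λ y → cong 𝟙 (trans (cong (λ s → Q s (x ∙ y)) (sym (idʳ x))) (Q-inv x e y))))

  -- Two-step walks: an entry of `P` can be estimated by sampling the midpoint, and one step
  -- followed by two factors `P` makes the five steps of `slow`.
  P : Fin K → Fin K → ℕ
  P x y = Σℕ (λ z → ι x z * ι z y)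

  P-inv : ∀ g x y → P (g ∙ x) (g ∙ y) ≡ P x y
  P-inv g x y = trans (sym (Σℕ-left g _)) (Σℕ-cong (λ z → cong₂ _*_ (cong 𝟙 (Q-inv g x z)) (cong 𝟙 (Q-inv g z y))))

  P-sym : ∀ x y → P x y ≡ P y x
  P-sym x y = Σℕ-cong (λ z → trans (*-comm (ι x z) (ι z y)) (cong₂ _*_ (cong 𝟙 (Q-sym z y)) (cong 𝟙 (Q-sym x z))))

  P-row : ∀ x → Σℕ (P x) ≡ f * f
  P-row x = begin
    Σℕ (λ y → Σℕ (λ z → ι x z * ι z y)) ≡⟨ Σℕ-comm (λ y z → ι x z * ι z y) ⟩
    Σℕ (λ z → Σℕ (λ y → ι x z * ι z y)) ≡⟨ Σℕ-cong (λ z → trans (Σℕ-*ˡ (ι x z) (ι z)) (cong (ι x z *_) (row z))) ⟩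
    Σℕ (λ z → ι x z * f) ≡⟨ trans (Σℕ-*ʳ (ι x) f) (cong (_* f) (row x)) ⟩
    f * f ∎
    where open ≡-Reasoning

  P≤f : ∀ x y → P x y ≤ f
  P≤f x y = ≤-trans (Σℕ-mono (λ z → ≤-trans (*-monoʳ-≤ (ι x z) (𝟙≤1 (Q z y))) (≤-reflexive (*-identityʳ _)))) (≤-reflexive (row x))

  -- `K` times the deviation of `P` from its mean `f² / K`: the part of `P` on functions of mean
  -- zero, scaled to stay integral.
  b : Mat K
  b x y = ⁺ (K * P x y) ℤ.- ⁺ (f * f)

  b-zero : ∀ x → Σℤ (b x) ≡ ⁺ 0
  b-zero x = begin
    Σℤ (b x) ≡⟨ Σℤ-- (λ y → ⁺ (K * P x y)) (λ _ → ⁺ (f * f)) ⟩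
    Σℤ (λ y → ⁺ (K * P x y)) ℤ.- Σℤ {K} (λ _ → ⁺ (f * f)) ≡⟨ cong₂ ℤ._-_ (trans (sym (+Σℕ _)) (cong ⁺_ (trans (Σℕ-*ˡ K (P x)) (cong (K *_) (P-row x)))))
        (trans (Σℤ-const K _) (sym (ℤₚ.pos-* K (f * f)))) ⟩
    ⁺ (K * (f * f)) ℤ.- ⁺ (K * (f * f)) ≡⟨ ℤₚ.+-inverseʳ (⁺ (K * (f * f))) ⟩
    ⁺ 0 ∎
    where open ≡-Reasoning

  module E = Energy 𝔾 b (λ x y → cong (λ t → ⁺ (K * t) ℤ.- ⁺ (f * f)) (P-sym x y))
    (λ g x y → cong (λ t → ⁺ (K * t) ℤ.- ⁺ (f * f)) (P-inv g x y)) b-zero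

  M₀-upper : E.M 0 ≤ K * (K * K * (f * (f * f)))
  M₀-upper = ≤-trans (Σℕ-mono per-row) (≤-reflexive (Σℕ-const K _))
    where
    open ≤-Reasoning
    add : ∀ p q → (p ℤ.- q) ℤ.- (ℤ.- q) ≡ p
    add = ℤSolver.solve-∀
    r : ∀ k p → (k * p) * (k * p) ≡ (k * k) * (p * p)
    r = solve-∀
    per-row : ∀ x → Σℕ (λ y → sq (b x y)) ≤ K * K * (f * (f * f))
    per-row x = begin
      Σℕ (λ y → sq (b x y)) ≤⟨ spread-mean (b x) (ℤ.- ⁺ (f * f)) (b-zero x) ⟩
      Σℕ (λ y → sq (b x y ℤ.- (ℤ.- ⁺ (f * f)))) ≡⟨ Σℕ-cong (λ y → trans (cong sq (add (⁺ (K * P x y)) (⁺ (f * f)))) (r K (P x y))) ⟩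
      Σℕ (λ y → K * K * (P x y * P x y)) ≡⟨ Σℕ-*ˡ (K * K) _ ⟩
      K * K * Σℕ (λ y → P x y * P x y) ≤⟨ *-monoʳ-≤ (K * K) (Σℕ-mono (λ y → *-monoˡ-≤ (P x y) (P≤f x y))) ⟩
      K * K * Σℕ (λ y → f * P x y) ≡⟨ cong (K * K *_) (trans (Σℕ-*ˡ f (P x)) (cong (f *_) (P-row x))) ⟩
      K * K * (f * (f * f)) ∎

  ιz Pz : Mat K
  ιz x y = ⁺ ι x y
  Pz x y = ⁺ P x y

  -- A non-zero product would supply the midpoints of both double steps, and with them a five-step
  -- walk from `o` to `w`.
  slow-zero : ∀ z u → ι o z * (P z u * P u w) ≡ 0
  slow-zero z u with Q o z in q₁
  ... | false = refl
  ... | true with P z u in p₁ | P u w in p₂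
  ... | zero | _ = refl
  ... | suc a | zero = trans (+-identityʳ _) (*-zeroʳ a)
  ... | suc a | suc c with Σℕ-pos _ (subst (0 <_) (sym p₁) (s≤s z≤n)) | Σℕ-pos _ (subst (0 <_) (sym p₂) (s≤s z≤n))
  ... | v , l | v′ , l′ = ⊥-elim (slow z v u v′ q₁ (fst {Q z v} l) (snd {Q z v} l) (fst {Q u v′} l′) (snd {Q u v′} l′))
    where
    fst : ∀ {a b} → 0 < 𝟙 a * 𝟙 b → a ≡ true
    fst {true} _ = refl
    snd : ∀ {a b} → 0 < 𝟙 a * 𝟙 b → b ≡ true
    snd {true} {true} _ = refl

  b⊗Pz : ∀ x y → (b ⊗ b) x y ≡ ⁺ K ℤ.* (b ⊗ Pz) x y
  b⊗Pz x y = begin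
    Σℤ (λ z → b x z ℤ.* (⁺ (K * P z y) ℤ.- ⁺ (f * f))) ≡⟨ Σℤ-cong (λ z → trans (cong (λ t → b x z ℤ.* (t ℤ.- ⁺ (f * f))) (ℤₚ.pos-* K (P z y))) (ring (b x z) (⁺ K) (Pz z y) (⁺ (f * f)))) ⟩
    Σℤ (λ z → ⁺ K ℤ.* (b x z ℤ.* Pz z y) ℤ.- b x z ℤ.* ⁺ (f * f)) ≡⟨ Σℤ-- (λ z → ⁺ K ℤ.* (b x z ℤ.* Pz z y)) (λ z → b x z ℤ.* ⁺ (f * f)) ⟩
    Σℤ (λ z → ⁺ K ℤ.* (b x z ℤ.* Pz z y)) ℤ.- Σℤ (λ z → b x z ℤ.* ⁺ (f * f)) ≡⟨ cong₂ ℤ._-_ (Σℤ-*ˡ (⁺ K) _)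
         (trans (Σℤ-*ʳ (b x) _) (trans (cong (ℤ._* ⁺ (f * f)) (b-zero x)) (ℤₚ.*-zeroˡ (⁺ (f * f))))) ⟩
    ⁺ K ℤ.* (b ⊗ Pz) x y ℤ.- ⁺ 0 ≡⟨ ℤₚ.+-identityʳ _ ⟩
    ⁺ K ℤ.* (b ⊗ Pz) x y ∎
    where
    open ≡-Reasoning
    ring : ∀ p k q c → p ℤ.* (k ℤ.* q ℤ.- c) ≡ k ℤ.* (p ℤ.* q) ℤ.- p ℤ.* c
    ring = ℤSolver.solve-∀

  ιz⊗b : ∀ x y → (ιz ⊗ b) x y ≡ ⁺ K ℤ.* (ιz ⊗ Pz) x y ℤ.- ⁺ (f * (f * f))
  ιz⊗b x y = begin
    Σℤ (λ z → ιz x z ℤ.* (⁺ (K * P z y) ℤ.- ⁺ (f * f))) ≡⟨ Σℤ-cong (λ z → trans (cong (λ t → ιz x z ℤ.* (t ℤ.- ⁺ (f * f))) (ℤₚ.pos-* K (P z y))) (ring (ιz x z) (⁺ K) (Pz z y) (⁺ (f * f)))) ⟩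
    Σℤ (λ z → ⁺ K ℤ.* (ιz x z ℤ.* Pz z y) ℤ.- ιz x z ℤ.* ⁺ (f * f)) ≡⟨ Σℤ-- (λ z → ⁺ K ℤ.* (ιz x z ℤ.* Pz z y)) (λ z → ιz x z ℤ.* ⁺ (f * f)) ⟩
    Σℤ (λ z → ⁺ K ℤ.* (ιz x z ℤ.* Pz z y)) ℤ.- Σℤ (λ z → ιz x z ℤ.* ⁺ (f * f)) ≡⟨ cong₂ ℤ._-_ (Σℤ-*ˡ (⁺ K) _)
         (trans (Σℤ-*ʳ (ιz x) _) (trans (cong (ℤ._* ⁺ (f * f)) (trans (sym (+Σℕ (ι x))) (cong ⁺_ (row x)))) (sym (ℤₚ.pos-* f (f * f))))) ⟩
    ⁺ K ℤ.* (ιz ⊗ Pz) x y ℤ.- ⁺ (f * (f * f)) ∎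
    where
    open ≡-Reasoning
    ring : ∀ p k q c → p ℤ.* (k ℤ.* q ℤ.- c) ≡ k ℤ.* (p ℤ.* q) ℤ.- p ℤ.* c
    ring = ℤSolver.solve-∀

  -- Five steps of Q do not lead from o to w; on functions of mean zero this entry is therefore -K f⁵.
  corner : (ιz ⊗ (b ⊗ b)) o w ≡ ℤ.- ⁺ (K * (f * (f * f) * (f * f)))
  corner = begin
    Σℤ (λ z → ιz o z ℤ.* (b ⊗ b) z w) ≡⟨ Σℤ-cong (λ z → trans (cong (ιz o z ℤ.*_) (b⊗Pz z w)) (swap (ιz o z) (⁺ K) _)) ⟩
    Σℤ (λ z → ⁺ K ℤ.* (ιz o z ℤ.* (b ⊗ Pz) z w)) ≡⟨ Σℤ-*ˡ (⁺ K) _ ⟩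
    ⁺ K ℤ.* (ιz ⊗ (b ⊗ Pz)) o w ≡⟨ cong (⁺ K ℤ.*_) (sym (⊗-assoc ιz b Pz o w)) ⟩
    ⁺ K ℤ.* Σℤ (λ u → (ιz ⊗ b) o u ℤ.* Pz u w) ≡⟨ cong (⁺ K ℤ.*_) (Σℤ-cong (λ u → trans (cong (ℤ._* Pz u w) (ιz⊗b o u)) (ring (⁺ K) ((ιz ⊗ Pz) o u) (⁺ (f * (f * f))) (Pz u w)))) ⟩
    ⁺ K ℤ.* Σℤ (λ u → ⁺ K ℤ.* ((ιz ⊗ Pz) o u ℤ.* Pz u w) ℤ.- ⁺ (f * (f * f)) ℤ.* Pz u w) ≡⟨ cong (⁺ K ℤ.*_) (trans (Σℤ-- (λ u → ⁺ K ℤ.* ((ιz ⊗ Pz) o u ℤ.* Pz u w)) (λ u → ⁺ (f * (f * f)) ℤ.* Pz u w))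
        (cong₂ ℤ._-_ (Σℤ-zero zero-term) (trans (Σℤ-*ˡ (⁺ (f * (f * f))) _) (trans (cong (⁺ (f * (f * f)) ℤ.*_) (trans (sym (+Σℕ _)) (cong ⁺_ (trans (Σℕ-cong (λ u → P-sym u w)) (P-row w))))) (sym (ℤₚ.pos-* (f * (f * f)) (f * f))))))) ⟩
    ⁺ K ℤ.* (⁺ 0 ℤ.- ⁺ (f * (f * f) * (f * f))) ≡⟨ neg (⁺ K) (⁺ (f * (f * f) * (f * f))) ⟩
    ℤ.- (⁺ K ℤ.* ⁺ (f * (f * f) * (f * f))) ≡⟨ cong ℤ.-_ (sym (ℤₚ.pos-* K _)) ⟩
    ℤ.- ⁺ (K * (f * (f * f) * (f * f))) ∎
    where
    open ≡-Reasoning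
    swap : ∀ p k q → p ℤ.* (k ℤ.* q) ≡ k ℤ.* (p ℤ.* q)
    swap = ℤSolver.solve-∀
    ring : ∀ k p c q → (k ℤ.* p ℤ.- c) ℤ.* q ≡ k ℤ.* (p ℤ.* q) ℤ.- c ℤ.* q
    ring = ℤSolver.solve-∀
    neg : ∀ k t → k ℤ.* (⁺ 0 ℤ.- t) ≡ ℤ.- (k ℤ.* t)
    neg = ℤSolver.solve-∀
    zero-term : ∀ u → ⁺ K ℤ.* ((ιz ⊗ Pz) o u ℤ.* Pz u w) ≡ ⁺ 0
    zero-term u = trans (cong (⁺ K ℤ.*_) (trans (sym (Σℤ-*ʳ _ (Pz u w))) (Σℤ-zero (λ z → trans (ℤₚ.*-assoc (ιz o z) (Pz z u) (Pz u w))
      (trans (cong (ιz o z ℤ.*_) (sym (ℤₚ.pos-* (P z u) (P u w)))) (trans (sym (ℤₚ.pos-* (ι o z) _)) (cong ⁺_ (slow-zero z u)))))))) (ℤₚ.*-zeroʳ (⁺ K))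

  K-pos : 0 < K
  K-pos = pos e
    where
    pos : ∀ {K} → Fin K → 0 < K
    pos {suc K} _ = s≤s z≤n

  f-pos : 0 < f
  f-pos = right-pos M (≤-trans K-pos dense)
    where
    right-pos : ∀ a {b} → 0 < a * b → 0 < b
    right-pos a {zero} p = ⊥-elim (<-irrefl (sym (*-zeroʳ a)) p)
    right-pos a {suc b} p = s≤s z≤n

  M-pos : 0 < M
  M-pos = left-pos M (≤-trans K-pos dense)
    where
    left-pos : ∀ a {b} → 0 < a * b → 0 < a
    left-pos (suc a) p = s≤s z≤n

  f³ : ℕ
  f³ = f * (f * f)

  -- Cauchy-Schwarz for `corner`: the row of `ιz` has `f` ones, so the column at `w` of `b ⊗ b` has
  -- squared norm at least `K² f⁹`. By invariance all `K` columns have the same norm.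
  M₁-lower : K * (K * K) * (f³ * (f³ * f³)) ≤ E.M 1
  M₁-lower = *-cancelˡ-≤ f {{ℕ.>-nonZero f-pos}} (begin
    f * (K * (K * K) * (f³ * (f³ * f³))) ≡⟨ ring K f ⟩
    K * ((K * (f * (f * f) * (f * f))) * (K * (f * (f * f) * (f * f)))) ≡⟨ cong (K *_) (sym (sq-of-neg corner)) ⟩
    K * sq ((ιz ⊗ (b ⊗ b)) o w) ≤⟨ *-monoʳ-≤ K (∣Σℤ*∣²≤ (ιz o) (λ z → (b ⊗ b) z w)) ⟩
    K * (Σℕ (λ z → sq (ιz o z)) * Σℕ (λ z → sq ((b ⊗ b) z w))) ≡⟨ cong (λ t → K * (t * column w)) (trans (Σℕ-cong (λ z → idem (Q o z))) (row o)) ⟩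
    K * (f * column w) ≡⟨ swap K f (column w) ⟩
    f * (K * column w) ≡⟨ cong (f *_) (sym (trans (Σℕ-comm (λ x y → sq ((b ⊗ b) x y))) (trans (Σℕ-cong (λ y → columns y)) (Σℕ-const K (column w))))) ⟩
    f * E.M 1 ∎)
    where
    open ≤-Reasoning
    column : Fin K → ℕ
    column y = Σℕ (λ z → sq ((b ⊗ b) z y))
    columns : ∀ y → column y ≡ column w
    columns y = trans (sym (Σℕ-left (y ∙ inv w) (λ z → sq ((b ⊗ b) z y)))) (Σℕ-cong (λ z →
      trans (cong (λ s → sq ((b ⊗ b) ((y ∙ inv w) ∙ z) s)) (sym (cancelʳ-inv y w))) (cong sq (E.pw-inv 1 (y ∙ inv w) z w))))
    idem : ∀ q → sq (⁺ 𝟙 q) ≡ 𝟙 q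
    idem true = refl
    idem false = refl
    ring : ∀ K f → f * (K * (K * K) * ((f * (f * f)) * ((f * (f * f)) * (f * (f * f))))) ≡ K * ((K * (f * (f * f) * (f * f))) * (K * (f * (f * f) * (f * f))))
    ring = ring-M₁
    swap : ∀ a b c → a * (b * c) ≡ b * (a * c)
    swap = solve-∀

  K³≤ : K * (K * K) ≤ (M * M * M) * f³
  K³≤ = ≤-trans (*-mono-≤ dense (*-mono-≤ dense dense)) (≤-reflexive (ring M f))
    where
    ring : ∀ M f → (M * f) * ((M * f) * (M * f)) ≡ (M * M * M) * (f * (f * f))
    ring = solve-∀

  -- The effective rank is at most `M³`: the upper bound `K⁶ f⁶` exceeds the lower bound `K³ f⁹` by
  -- `(K / f)³`, which density controls.
  M₀² : E.M 0 * E.M 0 ≤ (M * M * M) * E.M 1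
  M₀² = begin
    E.M 0 * E.M 0 ≤⟨ *-mono-≤ M₀-upper M₀-upper ⟩
    (K * (K * K * f³)) * (K * (K * K * f³)) ≡⟨ r1 K f³ ⟩
    (K * (K * K)) * ((K * (K * K)) * (f³ * f³)) ≤⟨ *-monoˡ-≤ ((K * (K * K)) * (f³ * f³)) K³≤ ⟩
    ((M * M * M) * f³) * ((K * (K * K)) * (f³ * f³)) ≡⟨ r2 (M * M * M) f³ (K * (K * K)) ⟩
    (M * M * M) * (K * (K * K) * (f³ * (f³ * f³))) ≤⟨ *-monoʳ-≤ (M * M * M) M₁-lower ⟩
    (M * M * M) * E.M 1 ∎
    where
    open ≤-Reasoning
    r1 : ∀ K c → (K * (K * K * c)) * (K * (K * K * c)) ≡ (K * (K * K)) * ((K * (K * K)) * (c * c))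
    r1 = solve-∀
    r2 : ∀ m c k → (m * c) * (k * (c * c)) ≡ m * (k * (c * (c * c)))
    r2 = solve-∀

  M₀²-lower : K * (K * K) * (f³ * (f³ * f³)) ≤ E.M 0 * E.M 0
  M₀²-lower = ≤-trans M₁-lower (hs-⊗ b b)

  M₀-pos : 0 < E.M 0
  M₀-pos = square-pos (≤-trans (*-mono-≤ (*-mono-≤ K-pos (*-mono-≤ K-pos K-pos)) (*-mono-≤ f³-pos (*-mono-≤ f³-pos f³-pos))) M₀²-lower)
    where
    f³-pos : 0 < f³
    f³-pos = *-mono-≤ f-pos (*-mono-≤ f-pos f-pos)

  -- A squared distance between rows of `P`, hence the factors 2 in `ρ-triangle`.
  ρ : Fin K → Fin K → ℕ
  ρ x y = Σℕ (λ z → sq (⁺ P x z ℤ.- ⁺ P y z))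

  M⁵ : ℕ
  M⁵ = M * M * M * M * M

  -- Since `D 0 h` is `K²` times the sum of `ρ (h ∙ x) x`, the hypothesis makes it at most
  -- `K³ f³ / 8 M⁵`. The lower bound available is one for the square of `M 0`, so squares are
  -- compared. Of the five factors `M`, three pay for `m₀`; the other two, once squared, pay for
  -- `K³ ≤ M³ f³`.
  no-almost-trivial : ∀ h → h ≢ e → ¬ (∀ x → 8 * (M⁵ * ρ (h ∙ x) x) ≤ f³)
  no-almost-trivial h h≢e small = E.no-small-element (M * M * M) M₀² M₀-pos h h≢e (square-cancel (*-cancelˡ-≤ (c * c) {{ℕ.>-nonZero (*-mono-≤ c-pos c-pos)}} (begin
    (c * c) * ((8 * (m₀ * D₀)) * (8 * (m₀ * D₀))) ≡⟨ r1 c m₀ D₀ ⟩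
    (64 * (m₀ * m₀)) * ((c * D₀) * (c * D₀)) ≤⟨ *-monoʳ-≤ (64 * (m₀ * m₀)) (*-mono-≤ cD₀ cD₀) ⟩
    (64 * (m₀ * m₀)) * ((K * (K * K * f³)) * (K * (K * K * f³))) ≡⟨ r2 m₀ K f³ ⟩
    (64 * (m₀ * m₀)) * ((K * (K * K)) * ((K * (K * K)) * (f³ * f³))) ≤⟨ *-monoʳ-≤ (64 * (m₀ * m₀)) (*-monoˡ-≤ ((K * (K * K)) * (f³ * f³)) K³≤) ⟩
    (64 * (m₀ * m₀)) * ((m₀ * f³) * ((K * (K * K)) * (f³ * f³))) ≡⟨ r3 m₀ (K * (K * K)) f³ ⟩
    (64 * (m₀ * m₀ * m₀)) * (K * (K * K) * (f³ * (f³ * f³))) ≤⟨ *-mono-≤ c²-big M₀²-lower ⟩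
    (c * c) * (E.M 0 * E.M 0) ∎)))
    where
    open ≤-Reasoning
    c m₀ D₀ : ℕ
    c = 8 * M⁵
    m₀ = M * M * M
    D₀ = E.D 0 h
    c-pos : 0 < c
    c-pos = *-mono-≤ {1} {8} (s≤s z≤n) (*-mono-≤ (*-mono-≤ (*-mono-≤ (*-mono-≤ M-pos M-pos) M-pos) M-pos) M-pos)
    r1 : ∀ c m d → (c * c) * ((8 * (m * d)) * (8 * (m * d))) ≡ (64 * (m * m)) * ((c * d) * (c * d))
    r1 = solve-∀
    r2 : ∀ m K c → (64 * (m * m)) * ((K * (K * K * c)) * (K * (K * K * c))) ≡ (64 * (m * m)) * ((K * (K * K)) * ((K * (K * K)) * (c * c)))
    r2 = solve-∀
    r3 : ∀ m k c → (64 * (m * m)) * ((m * c) * (k * (c * c))) ≡ (64 * (m * m * m)) * (k * (c * (c * c)))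
    r3 = solve-∀
    r4 : ∀ M → 64 * ((M * M * M) * (M * M * M) * (M * M * M)) * M ≡ (8 * (M * M * M * M * M)) * (8 * (M * M * M * M * M))
    r4 = solve-∀
    c²-big : 64 * (m₀ * m₀ * m₀) ≤ c * c
    c²-big = ≤-trans (≤-trans (≤-reflexive (sym (*-identityʳ _))) (*-monoʳ-≤ (64 * (m₀ * m₀ * m₀)) M-pos)) (≤-reflexive (r4 M))
    diff : ∀ p q r → (p ℤ.- r) ℤ.- (q ℤ.- r) ≡ p ℤ.- q
    diff = ℤSolver.solve-∀
    scale : ∀ x y → sq (E.∂ h b x y) ≡ K * K * sq (⁺ P (h ∙ x) y ℤ.- ⁺ P x y)
    scale x y = trans (cong sq (trans (diff (⁺ (K * P (h ∙ x) y)) (⁺ (K * P x y)) (⁺ (f * f)))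
      (trans (cong₂ ℤ._-_ (ℤₚ.pos-* K (P (h ∙ x) y)) (ℤₚ.pos-* K (P x y))) (factor (⁺ K) (⁺ P (h ∙ x) y) (⁺ P x y)))))
      (trans (cong₂ _*_ (ℤₚ.abs-* (⁺ K) _) (ℤₚ.abs-* (⁺ K) _)) (r5 K _))
      where
      factor : ∀ k p q → k ℤ.* p ℤ.- k ℤ.* q ≡ k ℤ.* (p ℤ.- q)
      factor = ℤSolver.solve-∀
      r5 : ∀ k p → (k * p) * (k * p) ≡ (k * k) * (p * p)
      r5 = solve-∀
    cD₀ : c * D₀ ≤ K * (K * K * f³)
    cD₀ = begin
      c * D₀ ≡⟨ cong (c *_) (Σℕ-cong (λ x → trans (Σℕ-cong (scale x)) (Σℕ-*ˡ (K * K) _))) ⟩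
      c * Σℕ (λ x → K * K * ρ (h ∙ x) x) ≡⟨ sym (Σℕ-*ˡ c _) ⟩
      Σℕ (λ x → c * (K * K * ρ (h ∙ x) x)) ≤⟨ Σℕ-mono (λ x → ≤-trans (≤-reflexive (r6 M⁵ (K * K) (ρ (h ∙ x) x))) (*-monoʳ-≤ (K * K) (small x))) ⟩
      Σℕ {K} (λ x → K * K * f³) ≡⟨ Σℕ-const K _ ⟩
      K * (K * K * f³) ∎
      where
      r6 : ∀ m k r → (8 * m) * (k * r) ≡ k * (8 * (m * r))
      r6 = solve-∀

  -- `176 = 8 * 22`, where 8 comes from `no-almost-trivial`. In `order-bounded` a net point moves by
  -- at most 4 times this tolerance, and an arbitrary row by `6 + 4 * 4 = 22` times.
  Close : Fin K → Fin K → Set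
  Close x y = 176 * (M⁵ * ρ x y) ≤ f³

  ρ-sym : ∀ x y → ρ x y ≡ ρ y x
  ρ-sym x y = Σℕ-cong (λ z → sq-swap (⁺ P x z) (⁺ P y z))

  ρ-refl : ∀ x → ρ x x ≡ 0
  ρ-refl x = Σℕ-zero (λ z → cong sq (ℤₚ.+-inverseʳ (⁺ P x z)))

  ρ-inv : ∀ g x y → ρ (g ∙ x) (g ∙ y) ≡ ρ x y
  ρ-inv g x y = trans (sym (Σℕ-left g _)) (Σℕ-cong (λ z → cong₂ (λ s t → sq (⁺ s ℤ.- ⁺ t)) (P-inv g x z) (P-inv g y z)))

  ρ-triangle : ∀ x y z → ρ x z ≤ 2 * ρ x y + 2 * ρ y z
  ρ-triangle x y z = begin
    ρ x z ≤⟨ Σℕ-mono (λ w → ≤-trans (≤-reflexive (cong sq (ring (⁺ P x w) (⁺ P y w) (⁺ P z w)))) (sq-+ (⁺ P x w ℤ.- ⁺ P y w) (⁺ P y w ℤ.- ⁺ P z w))) ⟩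
    Σℕ (λ w → 2 * sq (⁺ P x w ℤ.- ⁺ P y w) + 2 * sq (⁺ P y w ℤ.- ⁺ P z w)) ≡⟨ trans (Σℕ-+ _ _) (cong₂ _+_ (Σℕ-*ˡ 2 _) (Σℕ-*ˡ 2 _)) ⟩
    2 * ρ x y + 2 * ρ y z ∎
    where
    open ≤-Reasoning
    ring : ∀ p q r → p ℤ.- r ≡ (p ℤ.- q) ℤ.+ (q ℤ.- r)
    ring = ℤSolver.solve-∀

  -- Estimating rows by samples

  hit : Fin K → Fin K → Fin K → ℕ
  hit y w z = ι y z * ι z w

  -- K times the sum of hit y w over i random points estimates i P(y,w).
  err : ∀ {i} → (Fin i → Fin K) → Fin K → Fin K → ℤ
  err {i} zs y w = ⁺ i ℤ.* ⁺ P y w ℤ.- ⁺ K ℤ.* Σℤ (λ l → ⁺ hit y w (zs l))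

  Err : ∀ {i} → (Fin i → Fin K) → Fin K → ℕ
  Err zs y = Σℕ (λ w → sq (err zs y w))

  cons : ∀ {i} → Fin K → (Fin i → Fin K) → Fin (suc i) → Fin K
  cons z zs zero = z
  cons z zs (suc l) = zs l

  err-cons : ∀ {i} z (zs : Fin i → Fin K) y w → err (cons z zs) y w ≡ (⁺ P y w ℤ.- ⁺ K ℤ.* ⁺ hit y w z) ℤ.- (ℤ.- err zs y w)
  err-cons {i} z zs y w = trans (cong₂ (λ s t → s ℤ.- ⁺ K ℤ.* t) (ℤₚ.suc-* (⁺ i) (⁺ P y w)) (Σℤ-suc (λ l → ⁺ hit y w (cons z zs l))))
    (ring (⁺ P y w) (⁺ i ℤ.* ⁺ P y w) (⁺ K) (⁺ hit y w z) (Σℤ (λ l → ⁺ hit y w (zs l))))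
    where
    ring : ∀ p a k h s → (p ℤ.+ a) ℤ.- k ℤ.* (h ℤ.+ s) ≡ (p ℤ.- k ℤ.* h) ℤ.- (ℤ.- (a ℤ.- k ℤ.* s))
    ring = ℤSolver.solve-∀

  deviation-zero : ∀ y w → Σℤ (λ z → ⁺ P y w ℤ.- ⁺ K ℤ.* ⁺ hit y w z) ≡ ⁺ 0
  deviation-zero y w = trans (Σℤ-- (λ _ → ⁺ P y w) (λ z → ⁺ K ℤ.* ⁺ hit y w z))
    (trans (cong₂ ℤ._-_ (Σℤ-const K (⁺ P y w)) (trans (Σℤ-*ˡ (⁺ K) _) (cong (⁺ K ℤ.*_) (sym (+Σℕ (hit y w))))))
      (ℤₚ.+-inverseʳ (⁺ K ℤ.* ⁺ P y w)))

  deviation-variance : ∀ y w → Σℕ (λ z → sq (⁺ P y w ℤ.- ⁺ K ℤ.* ⁺ hit y w z)) ≤ K * K * P y w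
  deviation-variance y w = begin
    Σℕ (λ z → sq (⁺ P y w ℤ.- ⁺ K ℤ.* ⁺ hit y w z)) ≤⟨ spread-mean _ (⁺ P y w) (deviation-zero y w) ⟩
    Σℕ (λ z → sq ((⁺ P y w ℤ.- ⁺ K ℤ.* ⁺ hit y w z) ℤ.- ⁺ P y w)) ≡⟨ Σℕ-cong (λ z → trans (cong sq (ring (⁺ P y w) (⁺ K ℤ.* ⁺ hit y w z)))
       (trans (sq-neg (⁺ K ℤ.* ⁺ hit y w z)) (trans (cong₂ _*_ (ℤₚ.abs-* (⁺ K) (⁺ hit y w z)) (ℤₚ.abs-* (⁺ K) (⁺ hit y w z))) (idem (Q y z) (Q z w))))) ⟩
    Σℕ (λ z → K * K * hit y w z) ≡⟨ Σℕ-*ˡ (K * K) (hit y w) ⟩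
    K * K * P y w ∎
    where
    open ≤-Reasoning
    ring : ∀ p c → (p ℤ.- c) ℤ.- p ≡ ℤ.- c
    ring = ℤSolver.solve-∀
    r1 : ∀ k → (k * 1) * (k * 1) ≡ k * k * 1
    r1 = solve-∀
    r0 : ∀ k → (k * 0) * (k * 0) ≡ k * k * 0
    r0 = solve-∀
    idem : ∀ p q → (K * (𝟙 p * 𝟙 q)) * (K * (𝟙 p * 𝟙 q)) ≡ K * K * (𝟙 p * 𝟙 q)
    idem true true = r1 K
    idem true false = r0 K
    idem false q = r0 K

  V : ℕ
  V = K * (f * f)

  -- The deviation of a fresh sample has mean zero, so the squared errors add up on average; `V`
  -- bounds the variance of one sample, summed over the row.
  average-step : ∀ {i} (zs : Fin i → Fin K) y → Σℕ (λ z → Err (cons z zs) y) ≤ K * (Err zs y + V)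
  average-step zs y = begin
    Σℕ (λ z → Σℕ (λ w → sq (err (cons z zs) y w))) ≡⟨ Σℕ-comm (λ z w → sq (err (cons z zs) y w)) ⟩
    Σℕ (λ w → Σℕ (λ z → sq (err (cons z zs) y w))) ≡⟨ Σℕ-cong (λ w → trans (Σℕ-cong (λ z → cong sq (err-cons z zs y w)))
        (trans (spread-≡ _ (ℤ.- err zs y w) (deviation-zero y w)) (cong (λ t → Σℕ (λ z → sq (⁺ P y w ℤ.- ⁺ K ℤ.* ⁺ hit y w z)) + K * t) (sq-neg (err zs y w))))) ⟩
    Σℕ (λ w → Σℕ (λ z → sq (⁺ P y w ℤ.- ⁺ K ℤ.* ⁺ hit y w z)) + K * sq (err zs y w)) ≤⟨ Σℕ-mono (λ w → +-monoˡ-≤ _ (deviation-variance y w)) ⟩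
    Σℕ (λ w → K * K * P y w + K * sq (err zs y w)) ≡⟨ trans (Σℕ-+ _ _) (cong₂ _+_ (trans (Σℕ-*ˡ (K * K) (P y)) (cong (K * K *_) (P-row y))) (Σℕ-*ˡ K _)) ⟩
    K * K * (f * f) + K * Err zs y ≡⟨ ring K (f * f) (Err zs y) ⟩
    K * (Err zs y + V) ∎
    where
    open ≤-Reasoning
    ring : ∀ k c t → k * k * c + k * t ≡ k * (t + k * c)
    ring = solve-∀

  -- The samples are fixed one at a time, each no worse than the average over the group for the
  -- total error of all `ys`.
  sampled : ∀ {N} (ys : Fin N → Fin K) i → ∃ λ (zs : Fin i → Fin K) → Σℕ (λ j → Err zs (ys j)) ≤ i * (N * V)
  sampled ys zero = (λ ()) , ≤-reflexive (Σℕ-zero (λ j → Σℕ-zero (λ w → cong sq (trans (cong₂ (λ s t → s ℤ.- ⁺ K ℤ.* t) (ℤₚ.*-zeroˡ (⁺ P (ys j) w)) (Σℤ-empty _)) (ring (⁺ K))))))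
    where
    ring : ∀ k → ⁺ 0 ℤ.- k ℤ.* ⁺ 0 ≡ ⁺ 0
    ring = ℤSolver.solve-∀
  sampled {N} ys (suc i) = let (zs , le) = sampled ys i ; (z , le′) = better zs in
      cons z zs , ≤-trans le′ (≤-trans (+-monoˡ-≤ (N * V) le) (≤-reflexive (+-comm (i * (N * V)) (N * V))))
    where
    open ≤-Reasoning
    better : ∀ {i} (zs : Fin i → Fin K) → ∃ λ z → Σℕ (λ j → Err (cons z zs) (ys j)) ≤ Σℕ (λ j → Err zs (ys j)) + N * V
    better zs = Σℕ-∃≤′ e (λ z → Σℕ (λ j → Err (cons z zs) (ys j))) (λ _ → Σℕ (λ j → Err zs (ys j)) + N * V) (begin
      Σℕ (λ z → Σℕ (λ j → Err (cons z zs) (ys j))) ≡⟨ Σℕ-comm (λ z j → Err (cons z zs) (ys j)) ⟩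
      Σℕ (λ j → Σℕ (λ z → Err (cons z zs) (ys j))) ≤⟨ Σℕ-mono (λ j → average-step zs (ys j)) ⟩
      Σℕ (λ j → K * (Err zs (ys j) + V)) ≡⟨ trans (Σℕ-*ˡ K _) (cong (K *_) (trans (Σℕ-+ _ _) (cong (Σℕ (λ j → Err zs (ys j)) +_) (Σℕ-const N V)))) ⟩
      K * (Σℕ (λ j → Err zs (ys j)) + N * V) ≡⟨ sym (Σℕ-const K _) ⟩
      Σℕ {K} (λ _ → Σℕ (λ j → Err zs (ys j)) + N * V) ∎)

  bit : Bool → Fin 2
  bit true = zero
  bit false = suc zero

  bit-injective : ∀ {x y} → bit x ≡ bit y → x ≡ y
  bit-injective {true} {true} _ = refl
  bit-injective {false} {false} _ = refl

  V-pos : 0 < V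
  V-pos = *-mono-≤ K-pos (*-mono-≤ f-pos f-pos)

  -- `hit y w z` sees `y` only through `Q y z`. Two points with the same pattern on the samples thus
  -- share the estimate of their whole rows, and their distance is bounded by the two errors.
  same-estimate : ∀ q → 0 < q → q ≡ 1408 * (M * M * M * M * M * M) → (zs : Fin q → Fin K) → ∀ x y → Err zs x ≤ 2 * (q * V) → Err zs y ≤ 2 * (q * V) →
    (∀ l → Q x (zs l) ≡ Q y (zs l)) → Close x y
  same-estimate q q-pos q≡ zs x y ex ey same = *-cancelˡ-≤ (8 * M) {{ℕ.>-nonZero (*-mono-≤ {1} {8} (s≤s z≤n) M-pos)}} (begin
    8 * M * (176 * (M⁵ * ρ x y)) ≡⟨ ring₁ M (ρ x y) ⟩
    1408 * (M * M * M * M * M * M) * ρ x y ≡⟨ cong (_* ρ x y) (sym q≡) ⟩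
    q * ρ x y ≤⟨ *-cancelˡ-≤ q {{ℕ.>-nonZero q-pos}} qqρ ⟩
    8 * V ≤⟨ *-monoʳ-≤ 8 (≤-trans (*-monoˡ-≤ (f * f) dense) (≤-reflexive (*-assoc M f (f * f)))) ⟩
    8 * (M * f³) ≡⟨ sym (*-assoc 8 M f³) ⟩
    8 * M * f³ ∎)
    where
    open ≤-Reasoning
    ring₁ : ∀ M r → 8 * M * (176 * (M * M * M * M * M * r)) ≡ 1408 * (M * M * M * M * M * M) * r
    ring₁ = solve-∀
    ring₂ : ∀ q v → 2 * (2 * (q * v)) + 2 * (2 * (q * v)) ≡ q * (8 * v)
    ring₂ = solve-∀
    diff : ∀ q p p′ s → q ℤ.* p ℤ.- q ℤ.* p′ ≡ (q ℤ.* p ℤ.- s) ℤ.- (q ℤ.* p′ ℤ.- s)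
    diff = ℤSolver.solve-∀
    factor : ∀ q p p′ → q ℤ.* (p ℤ.- p′) ≡ q ℤ.* p ℤ.- q ℤ.* p′
    factor = ℤSolver.solve-∀
    ring₃ : ∀ q r → q * (q * (r * r)) ≡ (q * r) * (q * r)
    ring₃ = solve-∀
    pointwise : ∀ w → q * (q * sq (⁺ P x w ℤ.- ⁺ P y w)) ≡ sq (err zs x w ℤ.- err zs y w)
    pointwise w = trans (ring₃ q ∣ ⁺ P x w ℤ.- ⁺ P y w ∣) (trans (sym (cong₂ _*_ (ℤₚ.abs-* (⁺ q) (⁺ P x w ℤ.- ⁺ P y w)) (ℤₚ.abs-* (⁺ q) (⁺ P x w ℤ.- ⁺ P y w))))
      (cong sq (trans (factor (⁺ q) (⁺ P x w) (⁺ P y w)) (trans (diff (⁺ q) (⁺ P x w) (⁺ P y w) (⁺ K ℤ.* Σℤ (λ l → ⁺ hit x w (zs l))))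
        (cong (λ t → err zs x w ℤ.- (⁺ q ℤ.* ⁺ P y w ℤ.- ⁺ K ℤ.* t)) (Σℤ-cong (λ l → cong (λ s → ⁺ (𝟙 s * ι (zs l) w)) (same l))))))))
    qqρ : q * (q * ρ x y) ≤ q * (8 * V)
    qqρ = begin
      q * (q * ρ x y) ≡⟨ trans (cong (q *_) (sym (Σℕ-*ˡ q _))) (sym (Σℕ-*ˡ q _)) ⟩
      Σℕ (λ w → q * (q * sq (⁺ P x w ℤ.- ⁺ P y w))) ≤⟨ Σℕ-mono (λ w → ≤-trans (≤-reflexive (pointwise w)) (sq-- (err zs x w) (err zs y w))) ⟩
      Σℕ (λ w → 2 * sq (err zs x w) + 2 * sq (err zs y w)) ≡⟨ trans (Σℕ-+ _ _) (cong₂ _+_ (Σℕ-*ˡ 2 _) (Σℕ-*ˡ 2 _)) ⟩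
      2 * Err zs x + 2 * Err zs y ≤⟨ +-mono-≤ (*-monoʳ-≤ 2 ex) (*-monoʳ-≤ 2 ey) ⟩
      2 * (2 * (q * V)) + 2 * (2 * (q * V)) ≡⟨ ring₂ q V ⟩
      q * (8 * V) ∎

  -- By Markov's inequality at least half of the points have at most twice the average error. On
  -- these the pattern of `Q` on the samples is injective, because points with equal patterns are
  -- `Close`.
  packing : ∀ {N} (ys : Fin N → Fin K) → (∀ i j → Close (ys i) (ys j) → i ≡ j) → ∀ q → 0 < q → q ≡ 1408 * (M * M * M * M * M * M) → N ≤ 2 * 2 ^ q
  packing {N} ys sep q q-pos q≡ = +-cancelʳ-≤ N N (2 * 2 ^ q) (begin
    N + N ≡⟨ ring N ⟩
    2 * N ≡⟨ cong (2 *_) (sym split) ⟩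
    2 * (count good + count bad) ≡⟨ *-distribˡ-+ 2 (count good) (count bad) ⟩
    2 * count good + 2 * count bad ≤⟨ +-mono-≤ (*-monoʳ-≤ 2 (count-inj≤ good code inj)) few-bad ⟩
    2 * 2 ^ q + N ∎)
    where
    open ≤-Reasoning
    ring : ∀ n → n + n ≡ 2 * n
    ring = solve-∀
    zs : Fin q → Fin K
    zs = proj₁ (sampled ys q)
    good bad : Fin N → Bool
    good j = ⌊ Err zs (ys j) ≤? 2 * (q * V) ⌋
    bad j = not (good j)
    code : Fin N → Fin (2 ^ q)
    code j = funToFin (λ l → bit (Q (ys j) (zs l)))
    good-≤ : ∀ j → good j ≡ true → Err zs (ys j) ≤ 2 * (q * V)
    good-≤ j = true⇒ (Err zs (ys j) ≤? 2 * (q * V))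
    bad-> : ∀ j → 𝟙 (bad j) * (2 * (q * V)) ≤ Err zs (ys j)
    bad-> j = 𝟙-not-≤ (Err zs (ys j)) (2 * (q * V))
    split : count good + count bad ≡ N
    split = trans (sym (Σℕ-+ (λ j → 𝟙 (good j)) (λ j → 𝟙 (bad j)))) (trans (Σℕ-cong (λ j → one (good j))) (trans (Σℕ-const N 1) (*-identityʳ N)))
      where
      one : ∀ t → 𝟙 t + 𝟙 (not t) ≡ 1
      one true = refl
      one false = refl
    inj : ∀ i j → good i ≡ true → good j ≡ true → code i ≡ code j → i ≡ j
    inj i j gi gj eq = sep i j (same-estimate q q-pos q≡ zs (ys i) (ys j) (good-≤ i gi) (good-≤ j gj)
      (λ l → bit-injective (trans (sym (finToFun-funToFin (λ l → bit (Q (ys i) (zs l))) l)) (trans (cong (λ c → finToFun c l) eq) (finToFun-funToFin (λ l → bit (Q (ys j) (zs l))) l)))))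
    few-bad : 2 * count bad ≤ N
    few-bad = *-cancelʳ-≤ (2 * count bad) N (q * V) {{ℕ.>-nonZero (*-mono-≤ q-pos V-pos)}} (begin
      2 * count bad * (q * V) ≡⟨ trans (cong (_* (q * V)) (*-comm 2 (count bad))) (*-assoc (count bad) 2 (q * V)) ⟩
      count bad * (2 * (q * V)) ≡⟨ sym (Σℕ-*ʳ _ _) ⟩
      Σℕ (λ j → 𝟙 (bad j) * (2 * (q * V))) ≤⟨ Σℕ-mono bad-> ⟩
      Σℕ (λ j → Err zs (ys j)) ≤⟨ proj₂ (sampled ys q) ⟩
      q * (N * V) ≡⟨ trans (sym (*-assoc q N V)) (trans (cong (_* V) (*-comm q N)) (*-assoc N q V)) ⟩
      N * (q * V) ∎)

  Close? : ∀ x y → Dec (Close x y)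
  Close? x y = 176 * (M⁵ * ρ x y) ≤? f³

  Close-refl : ∀ x → Close x x
  Close-refl x = subst (λ t → 176 * (M⁵ * t) ≤ f³) (sym (ρ-refl x)) (≤-trans (≤-reflexive (cong (176 *_) (*-zeroʳ M⁵))) z≤n)

  Close-sym : ∀ {x y} → Close x y → Close y x
  Close-sym {x} {y} = subst (λ t → 176 * (M⁵ * t) ≤ f³) (ρ-sym x y)

  opaque
    unfolding samples packing-bound order-bound

    net-size : ∀ {N} (ys : Fin N → Fin K) → (∀ i j → Close (ys i) (ys j) → i ≡ j) → N ≤ packing-bound M
    net-size ys sep = packing ys sep (samples M) (*-mono-≤ {1} {1408} (s≤s z≤n) (*-mono-≤ (*-mono-≤ (*-mono-≤ (*-mono-≤ (*-mono-≤ M-pos M-pos) M-pos) M-pos) M-pos) M-pos)) refl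

    packing-pos : 0 < packing-bound M
    packing-pos = *-mono-≤ {1} {2} (s≤s z≤n) (≤-trans (s≤s z≤n) (n<2^n (samples M)))

    order-bound-≡ : order-bound M ≡ packing-bound M ^ packing-bound M
    order-bound-≡ = refl

  -- Record, for each group element, a net point close to each translated net point. In a larger
  -- group two elements share their record, so `h = inv σ ∙ τ` barely moves the rows of the net, and
  -- by the triangle inequality barely moves any row, against `no-almost-trivial`.
  order-bounded : K ≤ order-bound M
  order-bounded = ≮⇒≥ contra
    where
    net : SeparatedCover Close id
    net = separated-cover {R = Close} Close? Close-refl Close-sym id
    open SeparatedCover net
    size≤ : size ≤ packing-bound M
    size≤ = net-size points separated
    code : Fin K → Fin (size ^ size)
    code σ = funToFin (λ j → proj₁ (covers (σ ∙ points j)))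
    quasi : ∀ {x y r} → Close x r → Close y r → 8 * (M⁵ * (22 * ρ x y)) ≤ 4 * f³
    quasi {x} {y} {r} cx cy = begin
      8 * (M⁵ * (22 * ρ x y)) ≤⟨ *-monoʳ-≤ 8 (*-monoʳ-≤ M⁵ (*-monoʳ-≤ 22 (ρ-triangle x r y))) ⟩
      8 * (M⁵ * (22 * (2 * ρ x r + 2 * ρ r y))) ≡⟨ cong (λ t → 8 * (M⁵ * (22 * (2 * ρ x r + 2 * t)))) (ρ-sym r y) ⟩
      8 * (M⁵ * (22 * (2 * ρ x r + 2 * ρ y r))) ≡⟨ ring M⁵ (ρ x r) (ρ y r) ⟩
      2 * (176 * (M⁵ * ρ x r)) + 2 * (176 * (M⁵ * ρ y r)) ≤⟨ +-mono-≤ (*-monoʳ-≤ 2 cx) (*-monoʳ-≤ 2 cy) ⟩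
      2 * f³ + 2 * f³ ≡⟨ ring′ f³ ⟩
      4 * f³ ∎
      where
      open ≤-Reasoning
      ring : ∀ m a b → 8 * (m * (22 * (2 * a + 2 * b))) ≡ 2 * (176 * (m * a)) + 2 * (176 * (m * b))
      ring = solve-∀
      ring′ : ∀ c → 2 * c + 2 * c ≡ 4 * c
      ring′ = solve-∀
    no-coincidence : ∀ σ τ → σ Fin.< τ → code σ ≡ code τ → ⊥
    no-coincidence σ τ σ<τ eq = no-almost-trivial h h≢e small
      where
      h : Fin K
      h = inv σ ∙ τ
      h≢e : h ≢ e
      h≢e p = <⇒≢ σ<τ (cong toℕ (trans (sym (idʳ σ)) (trans (cong (σ ∙_) (sym p)) (cancelˡ-inv σ τ))))
      index : ∀ j → proj₁ (covers (σ ∙ points j)) ≡ proj₁ (covers (τ ∙ points j))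
      index j = trans (sym (finToFun-funToFin (λ j → proj₁ (covers (σ ∙ points j))) j)) (trans (cong (λ c → finToFun c j) eq) (finToFun-funToFin (λ j → proj₁ (covers (τ ∙ points j))) j))
      moved : ∀ j → 8 * (M⁵ * (22 * ρ (h ∙ points j) (points j))) ≤ 4 * f³
      moved j = subst (λ t → 8 * (M⁵ * (22 * t)) ≤ 4 * f³)
        (trans (ρ-sym _ _) (trans (cong₂ ρ (trans (sym (cancelˡ-inv σ _)) (cong (σ ∙_) (sym (assoc (inv σ) τ (points j))))) refl) (ρ-inv σ (h ∙ points j) (points j))))
        (quasi (proj₂ (covers (σ ∙ points j))) (subst (λ i → Close (τ ∙ points j) (points i)) (sym (index j)) (proj₂ (covers (τ ∙ points j)))))
      small : ∀ x → 8 * (M⁵ * ρ (h ∙ x) x) ≤ f³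
      small x = *-cancelˡ-≤ 22 (begin
        22 * (8 * (M⁵ * ρ (h ∙ x) x)) ≤⟨ *-monoʳ-≤ 22 (*-monoʳ-≤ 8 (*-monoʳ-≤ M⁵ far)) ⟩
        22 * (8 * (M⁵ * (6 * ρ x y + 4 * ρ (h ∙ y) y))) ≡⟨ ring M⁵ (ρ x y) (ρ (h ∙ y) y) ⟩
        6 * (176 * (M⁵ * ρ x y)) + 4 * (8 * (M⁵ * (22 * ρ (h ∙ y) y))) ≤⟨ +-mono-≤ (*-monoʳ-≤ 6 (proj₂ (covers x))) (*-monoʳ-≤ 4 (moved (proj₁ (covers x)))) ⟩
        6 * f³ + 4 * (4 * f³) ≡⟨ ring′ f³ ⟩
        22 * f³ ∎)
        where
        open ≤-Reasoning
        y : Fin K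
        y = points (proj₁ (covers x))
        ring : ∀ m a b → 22 * (8 * (m * (6 * a + 4 * b))) ≡ 6 * (176 * (m * a)) + 4 * (8 * (m * (22 * b)))
        ring = solve-∀
        ring′ : ∀ c → 6 * c + 4 * (4 * c) ≡ 22 * c
        ring′ = solve-∀
        ring″ : ∀ a b → 2 * a + 2 * (2 * b + 2 * a) ≡ 6 * a + 4 * b
        ring″ = solve-∀
        far : ρ (h ∙ x) x ≤ 6 * ρ x y + 4 * ρ (h ∙ y) y
        far = begin
          ρ (h ∙ x) x ≤⟨ ρ-triangle (h ∙ x) (h ∙ y) x ⟩
          2 * ρ (h ∙ x) (h ∙ y) + 2 * ρ (h ∙ y) x ≤⟨ +-mono-≤ (≤-reflexive (cong (2 *_) (ρ-inv h x y))) (*-monoʳ-≤ 2 (ρ-triangle (h ∙ y) y x)) ⟩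
          2 * ρ x y + 2 * (2 * ρ (h ∙ y) y + 2 * ρ y x) ≡⟨ cong (λ t → 2 * ρ x y + 2 * (2 * ρ (h ∙ y) y + 2 * t)) (ρ-sym y x) ⟩
          2 * ρ x y + 2 * (2 * ρ (h ∙ y) y + 2 * ρ x y) ≡⟨ ring″ (ρ x y) (ρ (h ∙ y) y) ⟩
          6 * ρ x y + 4 * ρ (h ∙ y) y ∎
    contra : ¬ (order-bound M < K)
    contra large =
      let (σ , τ , σ<τ , eq) = pigeonhole (≤-<-trans (≤-trans (^-monoˡ-≤ size size≤) (^-monoʳ-≤ (packing-bound M) {{ℕ.>-nonZero packing-pos}} size≤))
                                 (subst (_< K) order-bound-≡ large)) code
      in no-coincidence σ τ σ<τ eq

-- Clique minors in expanding graphs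

∧-true : ∀ {a b} → a ∧ b ≡ true → a ≡ true × b ≡ true
∧-true {true} {true} _ = refl , refl

true-∧ : ∀ {a b} → a ≡ true → b ≡ true → a ∧ b ≡ true
true-∧ refl refl = refl

∨-true : ∀ {a b} → a ∨ b ≡ true → a ≡ true ⊎ b ≡ true
∨-true {true} _ = inj₁ refl
∨-true {false} p = inj₂ p

true-∨ˡ : ∀ {a b} → a ≡ true → a ∨ b ≡ true
true-∨ˡ refl = refl

true-∨ʳ : ∀ {a b} → b ≡ true → a ∨ b ≡ true
true-∨ʳ {true} _ = refl
true-∨ʳ {false} p = p

not-true : ∀ {a} → not a ≡ true → a ≡ false
not-true {false} _ = refl

true-not : ∀ {a} → a ≡ false → not a ≡ true
true-not refl = refl

true≢false : ∀ {a} → a ≡ true → a ≡ false → ⊥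
true≢false refl ()

¬true⇒false : ∀ {a} → ¬ (a ≡ true) → a ≡ false
¬true⇒false {true} f = ⊥-elim (f refl)
¬true⇒false {false} _ = refl

true? : ∀ (b : Bool) → Dec (b ≡ true)
true? true = yes refl
true? false = no λ ()

¬⇒false : ∀ {P : Set} (d : Dec P) → ¬ P → ⌊ d ⌋ ≡ false
¬⇒false (yes p) ¬p = ⊥-elim (¬p p)
¬⇒false (no _) _ = refl

Star-reverse : ∀ {A : Set} {R : A → A → Set} {P : A → Set} → (∀ {x y} → R x y → R y x) →
  ∀ {x y} → P x → Star (λ u v → R u v × P v) x y → Star (λ u v → R u v × P v) y x
Star-reverse {R = R} {P} R-sym p path = go p path ε
  where
  go : ∀ {x y z} → P x → Star (λ u v → R u v × P v) x y → Star (λ u v → R u v × P v) x z → Star (λ u v → R u v × P v) y z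
  go p ε acc = acc
  go p ((r , q) ◅ path) acc = go q path ((R-sym r , p) ◅ acc)

Star-weaken : ∀ {A : Set} {R R′ : A → A → Set} → (∀ {x y} → R x y → R′ x y) → ∀ {x y} → Star R x y → Star R′ x y
Star-weaken f ε = ε
Star-weaken f (r ◅ p) = f r ◅ Star-weaken f p

-- Branch sets are given by a partial labelling, which makes pulling back along a contraction a mere
-- composition; the covering partition is built only at the end.
record CliqueModel {N : ℕ} (R : Fin N → Fin N → Set) (k : ℕ) : Set where
  field
    label : Fin N → Maybe (Fin k)
    root : Fin k → Fin N
    root-label : ∀ i → label (root i) ≡ just i
    branch-connected : ∀ i x → label x ≡ just i → Star (λ u v → R u v × label v ≡ just i) (root i) x
    touching : ∀ i j → i ≢ j → ∃₂ λ u v → label u ≡ just i × label v ≡ just j × R u v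

pull-back : ∀ {N N′ k} {R : Fin N → Fin N → Set} {R′ : Fin N′ → Fin N′ → Set} (π : Fin N → Fin N′) →
  (∀ u v → π u ≡ π v → Star (λ x y → R x y × π y ≡ π u) u v) →
  (∀ {a b} → R′ a b → ∃₂ λ u v → π u ≡ a × π v ≡ b × R u v) →
  (m : CliqueModel R′ k) → (∀ i → ∃ λ u → π u ≡ CliqueModel.root m i) → CliqueModel R k
pull-back {R = R} {R′} π fibre over m hit = record
  { label = label ∘ π
  ; root = λ i → proj₁ (hit i)
  ; root-label = λ i → trans (cong label (proj₂ (hit i))) (root-label i)
  ; branch-connected = λ i x lx → lift-path i (branch-connected i (π x) lx) (proj₁ (hit i)) x (proj₂ (hit i)) refl (root-label i)
  ; touching = λ i j i≢j → let (a , b , la , lb , r) = touching i j i≢j ; (u , v , πu , πv , r′) = over r in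
      u , v , trans (cong label πu) la , trans (cong label πv) lb , r′ }
  where
  open CliqueModel m
  in-fibre : ∀ i u v → label (π u) ≡ just i → π u ≡ π v → Star (λ x y → R x y × label (π y) ≡ just i) u v
  in-fibre i u v lu eq = Star-weaken (λ { (r , p) → r , trans (cong label p) lu }) (fibre u v eq)
  lift-path : ∀ i {a c} → Star (λ x y → R′ x y × label y ≡ just i) a c → ∀ u v → π u ≡ a → π v ≡ c → label a ≡ just i →
    Star (λ x y → R x y × label (π y) ≡ just i) u v
  lift-path i ε u v pu pv la = in-fibre i u v (trans (cong label pu) la) (trans pu (sym pv))
  lift-path i ((r , lb) ◅ path) u v pu pv la =
    let (u₁ , v₁ , pu₁ , pv₁ , r₁) = over r in
    in-fibre i u u₁ (trans (cong label pu) la) (trans pu (sym pu₁)) ◅◅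
    ((r₁ , trans (cong label pv₁) lb) ◅ lift-path i path v₁ v pv₁ pv lb)

All-lookup : ∀ {A : Set} {P : A → Set} {xs : List A} → All P xs → ∀ i → P (lookup xs i)
All-lookup (p ∷ ps) zero = p
All-lookup (p ∷ ps) (suc i) = All-lookup ps i

mem : ∀ {N} → List (Fin N) → Fin N → Bool
mem [] v = false
mem (x ∷ l) v = ⌊ x ≟ v ⌋ ∨ mem l v

mem-head : ∀ {N} (x : Fin N) l → mem (x ∷ l) x ≡ true
mem-head x l = true-∨ˡ (⇒true (x ≟ x) refl)

mem-++ˡ : ∀ {N} (l l′ : List (Fin N)) {v} → mem l v ≡ true → mem (l ++ l′) v ≡ true
mem-++ˡ (x ∷ l) l′ {v} p with x ≟ v
... | yes _ = refl
... | no _ = mem-++ˡ l l′ p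

mem-++ʳ : ∀ {N} (l l′ : List (Fin N)) {v} → mem l′ v ≡ true → mem (l ++ l′) v ≡ true
mem-++ʳ [] l′ p = p
mem-++ʳ (x ∷ l) l′ {v} p = true-∨ʳ {⌊ x ≟ v ⌋} (mem-++ʳ l l′ p)

mem-++⁻ : ∀ {N} (l l′ : List (Fin N)) {v} → mem (l ++ l′) v ≡ true → mem l v ≡ true ⊎ mem l′ v ≡ true
mem-++⁻ [] l′ p = inj₂ p
mem-++⁻ (x ∷ l) l′ {v} p with x ≟ v
... | yes _ = inj₁ refl
... | no _ = mem-++⁻ l l′ p

-- A graph H with a measure wt (W sample points) in which small separators only cut off small sets
-- contains a clique minor. Branch sets are trees of bounded measure; parts that have become
-- hard to reach are discarded, the discarded set staying small by the isoperimetric inequality.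
module ExpanderMinor {N W : ℕ} (pts : Fin W → Fin N) (H : Fin N → Fin N → Set) (H? : ∀ u v → Dec (H u v))
  (H-sym : ∀ {u v} → H u v → H v u)
  (k Λ ℓ w₁ wmax : ℕ) (4≤Λ : 4 ≤ Λ) (W-pos : 0 < W)
  (vertex-weight : ∀ v → count (λ i → ⌊ v ≟ pts i ⌋) ≤ wmax)
  (real : ∀ {u v} → H u v → ∃ λ i → u ≡ pts i)
  (edge-weight : ∀ {u v} → H u v → w₁ ≤ count (λ i → ⌊ u ≟ pts i ⌋ ∨ ⌊ v ≟ pts i ⌋))
  (ℓ-large : W < 2 * (2 ^ ℓ * w₁))
  (isoperimetry : ∀ (C D : Fin N → Bool) → (∀ v → C v ≡ true → D v ≡ false) →
    (∀ u v → C u ≡ true → D v ≡ true → ¬ H u v) → W ≤ 4 * count (C ∘ pts) →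
    count (D ∘ pts) ≤ Λ * count (λ i → not (C (pts i)) ∧ not (D (pts i))))
  (room : 8 * ((2 * Λ + 2) * (k * ((k * (2 * (2 + 2 * (Λ * ℓ))) + 1) * wmax))) ≤ W)
  where

  Set′ : Set
  Set′ = Fin N → Bool

  _∋_ : Set′ → Fin N → Set
  p ∋ v = p v ≡ true

  wt : Set′ → ℕ
  wt p = count (p ∘ pts)

  wt-mono : ∀ {p p′ : Set′} → (∀ v → p ∋ v → p′ ∋ v) → wt p ≤ wt p′
  wt-mono h = count-mono (λ i → h (pts i))

  wt-split : ∀ (p r s : Set′) → (∀ v → 𝟙 (p v) ≤ 𝟙 (r v) + 𝟙 (s v)) → wt p ≤ wt r + wt s
  wt-split p r s h = ≤-trans (Σℕ-mono (λ i → h (pts i))) (≤-reflexive (Σℕ-+ _ _))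

  wt-join : ∀ (p r s : Set′) → (∀ v → 𝟙 (r v) + 𝟙 (s v) ≤ 𝟙 (p v)) → wt r + wt s ≤ wt p
  wt-join p r s h = ≤-trans (≤-reflexive (sym (Σℕ-+ _ _))) (Σℕ-mono (λ i → h (pts i)))

  -- The radius `q` allows one step to catch an edge and then `ℓ` doublings of `2 * Λ` steps each.
  -- The weight `τ` allows for `k` paths of `2 * suc q` vertices and their common origin.
  q τ : ℕ
  q = suc (2 * (Λ * ℓ))
  τ = (k * (2 * suc q) + 1) * wmax

  inT : List Set′ → Set′
  inT [] v = false
  inT (t ∷ ts) v = t v ∨ inT ts v

  -- The root is a sample point because a vertex of `H` may name an empty cell, and roots must have
  -- preimages in `pull-back`.
  Connected : Set′ → Set
  Connected t = ∃ λ r → t ∋ r × (∃ λ i → r ≡ pts i) × (∀ x → t ∋ x → Star (λ u v → H u v × t ∋ v) r x)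

  Good : Set′ → Set
  Good t = wt t ≤ τ × Connected t

  Touch : Set′ → Set′ → Set
  Touch t s = ∃₂ λ u v → t ∋ u × s ∋ v × H u v

  Touch? : ∀ t s → Dec (Touch t s)
  Touch? t s = any? (λ u → any? (λ v → true? (t u) ×-dec true? (s v) ×-dec H? u v))

  Compatible : Set′ → Set′ → Set
  Compatible t s = (∀ v → t ∋ v → s v ≡ false) × Touch t s

  rest : Set′ → Set′ → List Set′ → Set′
  rest C X ts v = not (C v ∨ (X v ∨ inT ts v))

  record State : Set where
    field
      C X : Set′
      ts : List Set′
      C-X : ∀ v → C ∋ v → X v ≡ false
      C-T : ∀ v → C ∋ v → inT ts v ≡ false
      separated : ∀ u v → C ∋ u → rest C X ts ∋ v → ¬ H u v
      -- The 2 makes the argument of `settle` close up: the contribution of `X` to the isoperimetric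
      -- bound is at most half of the discarded weight itself.
      charge : 2 * Λ * wt X ≤ wt (rest C X ts)
      good : All Good ts
      compatible : AllPairs Compatible ts
      few : length ts ≤ k
      large : 7 * W ≤ 8 * wt C

  wt-inT : ∀ ts → All Good ts → wt (inT ts) ≤ length ts * τ
  wt-inT [] [] = ≤-reflexive (Σℕ-zero (λ _ → refl))
  wt-inT (t ∷ ts) ((le , _) ∷ g) = ≤-trans (wt-split (inT (t ∷ ts)) t (inT ts) (λ v → 𝟙-∨ (t v) (inT ts v))) (+-mono-≤ le (wt-inT ts g))

  -- The discarded set and the separators are charged to the trees, so C is almost everything.
  settle : ∀ (C X : Set′) ts → (∀ u v → C ∋ u → rest C X ts ∋ v → ¬ H u v) → 2 * Λ * wt X ≤ wt (rest C X ts) →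
    All Good ts → length ts ≤ k → W ≤ 4 * wt C → 7 * W ≤ 8 * wt C
  settle C X ts sep ch good few quarter = +-cancelˡ-≤ W (7 * W) (8 * wt C) (begin
    W + 7 * W ≡⟨ refl ⟩
    8 * W ≤⟨ *-monoʳ-≤ 8 total ⟩
    8 * (wt C + (2 * Λ + 2) * (k * τ)) ≡⟨ *-distribˡ-+ 8 (wt C) _ ⟩
    8 * wt C + 8 * ((2 * Λ + 2) * (k * τ)) ≤⟨ +-monoʳ-≤ (8 * wt C) room ⟩
    8 * wt C + W ≡⟨ +-comm (8 * wt C) W ⟩
    W + 8 * wt C ∎)
    where
    open ≤-Reasoning
    D : Set′
    D = rest C X ts
    T≤ : wt (inT ts) ≤ k * τ
    T≤ = ≤-trans (wt-inT ts good) (*-monoˡ-≤ τ few)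
    cover₁ : ∀ c x t → 𝟙 (not c ∧ not (not (c ∨ (x ∨ t)))) ≤ 𝟙 x + 𝟙 t
    cover₁ true x t = z≤n
    cover₁ false true t = s≤s z≤n
    cover₁ false false true = ≤-refl
    cover₁ false false false = z≤n
    disjoint : ∀ v → C ∋ v → D v ≡ false
    disjoint v p rewrite p = refl
    iso : wt D ≤ Λ * (wt X + k * τ)
    iso = ≤-trans (isoperimetry C D disjoint sep quarter)
      (*-monoʳ-≤ Λ (≤-trans (wt-split _ X (inT ts) (λ v → cover₁ (C v) (X v) (inT ts v))) (+-monoʳ-≤ (wt X) T≤)))
    r1 : ∀ l x t → l * (x + t) + l * (x + t) ≡ 2 * l * x + 2 * l * t
    r1 = solve-∀
    D≤ : wt D ≤ 2 * Λ * (k * τ)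
    D≤ = +-cancelˡ-≤ (wt D) (wt D) _ (≤-trans (+-mono-≤ iso iso) (≤-trans (≤-reflexive (r1 Λ (wt X) (k * τ))) (+-monoˡ-≤ _ ch)))
    X≤ : wt X ≤ k * τ
    X≤ = *-cancelˡ-≤ (2 * Λ) {{ℕ.>-nonZero (*-mono-≤ {1} {2} (s≤s z≤n) (≤-trans (s≤s z≤n) 4≤Λ))}} (≤-trans ch D≤)
    cover₂ : ∀ c x t → 1 ≤ (𝟙 c + 𝟙 (not (c ∨ (x ∨ t)))) + (𝟙 x + 𝟙 t)
    cover₂ true x t = s≤s z≤n
    cover₂ false true t = s≤s z≤n
    cover₂ false false true = s≤s z≤n
    cover₂ false false false = s≤s z≤n
    r2 : ∀ c l t → (c + 2 * l * t) + (t + t) ≡ c + (2 * l + 2) * t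
    r2 = solve-∀
    total : W ≤ wt C + (2 * Λ + 2) * (k * τ)
    total = begin
      W ≡⟨ sym (trans (Σℕ-const W 1) (*-identityʳ W)) ⟩
      Σℕ {W} (λ _ → 1) ≤⟨ Σℕ-mono (λ i → cover₂ (C (pts i)) (X (pts i)) (inT ts (pts i))) ⟩
      Σℕ (λ i → (𝟙 (C (pts i)) + 𝟙 (D (pts i))) + (𝟙 (X (pts i)) + 𝟙 (inT ts (pts i)))) ≡⟨ trans (Σℕ-+ _ _) (cong₂ _+_ (Σℕ-+ _ _) (Σℕ-+ _ _)) ⟩
      (wt C + wt D) + (wt X + wt (inT ts)) ≤⟨ +-mono-≤ (+-monoʳ-≤ (wt C) D≤) (+-mono-≤ X≤ T≤) ⟩
      (wt C + 2 * Λ * (k * τ)) + (k * τ + k * τ) ≡⟨ r2 (wt C) Λ (k * τ) ⟩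
      wt C + (2 * Λ + 2) * (k * τ) ∎

  initial : State
  initial = record
    { C = λ _ → true ; X = λ _ → false ; ts = []
    ; C-X = λ _ _ → refl ; C-T = λ _ _ → refl
    ; separated = λ { u v _ () }
    ; charge = ≤-trans (≤-reflexive (trans (cong (2 * Λ *_) (Σℕ-zero (λ _ → refl))) (*-zeroʳ (2 * Λ)))) z≤n
    ; good = [] ; compatible = [] ; few = z≤n
    ; large = ≤-trans (*-monoˡ-≤ W (s≤s (s≤s (s≤s (s≤s (s≤s (s≤s (s≤s (z≤n {1}))))))))) (≤-reflexive (cong (8 *_) (sym (count-all (λ _ → refl))))) }

  module Balls (s : State) where
    open State s

    ball : Set′ → ℕ → Set′
    ball S zero = S
    ball S (suc j) v = ball S j v ∨ (C v ∧ ⌊ any? (λ u → true? (ball S j u) ×-dec H? u v) ⌋)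

    ball-mono : ∀ S j v → ball S j ∋ v → ball S (suc j) ∋ v
    ball-mono S j v p = true-∨ˡ p

    ball-step : ∀ S j {u v} → ball S j ∋ u → C ∋ v → H u v → ball S (suc j) ∋ v
    ball-step S j {u} {v} p c h = true-∨ʳ {ball S j v} (true-∧ c (⇒true (any? (λ u → true? (ball S j u) ×-dec H? u v)) (u , p , h)))

    ball-new : ∀ S j v → ball S (suc j) ∋ v → ball S j ∋ v ⊎ (C ∋ v × ∃ λ u → ball S j ∋ u × H u v)
    ball-new S j v p with ∨-true {ball S j v} p
    ... | inj₁ x = inj₁ x
    ... | inj₂ x = let (c , y) = ∧-true {C v} x in inj₂ (c , true⇒ (any? (λ u → true? (ball S j u) ×-dec H? u v)) y)

    ball⊆C : ∀ S → (∀ v → S ∋ v → C ∋ v) → ∀ j v → ball S j ∋ v → C ∋ v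
    ball⊆C S S⊆C zero v p = S⊆C v p
    ball⊆C S S⊆C (suc j) v p with ball-new S j v p
    ... | inj₁ x = ball⊆C S S⊆C j v x
    ... | inj₂ (c , _) = c

    ball-mono-+ : ∀ S i j v → ball S j ∋ v → ball S (i + j) ∋ v
    ball-mono-+ S zero j v p = p
    ball-mono-+ S (suc i) j v p = ball-mono S (i + j) v (ball-mono-+ S i j v p)

    ball-mono-≤ : ∀ S {i j} → i ≤ j → ∀ v → ball S i ∋ v → ball S j ∋ v
    ball-mono-≤ S {i} {j} le v p = subst (λ n → ball S n ∋ v) (m∸n+n≡m le) (ball-mono-+ S (j ∸ i) i v p)

    -- The next layer weighs at most `1 / 2Λ` of the ball, as `charge` asks; a ball of at most half
    -- the measure leaves enough of `C` for the isoperimetric inequality.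
    Thin : Set′ → ℕ → Set
    Thin S j = 2 * wt (ball S j) ≤ W × 2 * Λ * wt (ball S (suc j)) ≤ (2 * Λ + 1) * wt (ball S j)

    Thin? : ∀ S j → Dec (Thin S j)
    Thin? S j = (_ ≤? _) ×-dec (_ ≤? _)

    thin-below? : ∀ S n → (∃ λ j → Thin S j) ⊎ (∀ j → j < n → ¬ Thin S j)
    thin-below? S zero = inj₂ (λ _ ())
    thin-below? S (suc n) with thin-below? S n | Thin? S n
    ... | inj₁ t | _ = inj₁ t
    ... | inj₂ _ | yes t = inj₁ (n , t)
    ... | inj₂ f | no ¬t = inj₂ λ j lt → case m<1+n⇒m<n∨m≡n lt of λ { (inj₁ l) → f j l ; (inj₂ refl) → ¬t }

    Fat : Set′ → Set
    Fat S = W < 2 * wt (ball S q)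

    Λ-pos : 0 < Λ
    Λ-pos = ≤-trans (s≤s z≤n) 4≤Λ

    -- Were the last ball at most half, every layer would be thick. The first one then contains a
    -- new vertex, hence both ends of an edge and weight `w₁`; afterwards each layer adds at least
    -- `1 / 2Λ` of any earlier ball, so `2 * Λ` layers double it, and `ℓ-large` is contradicted.
    growth : ∀ S → (∀ j → j < q → ¬ Thin S j) → Fat S
    growth S no-thin = ≰⇒> λ small →
      let
        fast : ∀ j → j < q → (2 * Λ + 1) * wt (ball S j) < 2 * Λ * wt (ball S (suc j))
        fast j lt = ≰⇒> (λ slow → no-thin j lt (≤-trans (*-monoʳ-≤ 2 (wt-mono (ball-mono-≤ S (<⇒≤ lt)))) small , slow))
      in <⇒≱ ℓ-large (≤-trans (*-monoʳ-≤ 2 (doubling fast ℓ ≤-refl)) small)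
      where
      open ≤-Reasoning
      Fast : Set
      Fast = ∀ j → j < q → (2 * Λ + 1) * wt (ball S j) < 2 * Λ * wt (ball S (suc j))
      first : Fast → w₁ ≤ wt (ball S 1)
      first fast with all? (λ v → true? (not (ball S 1 v) ∨ ball S 0 v))
      ... | yes all = ⊥-elim (<⇒≱ (fast 0 (s≤s z≤n)) (≤-trans (*-monoʳ-≤ (2 * Λ) (wt-mono {ball S 1} {ball S 0} (λ v p → [ (λ n → ⊥-elim (true≢false p (not-true n))) , id ]′ (∨-true {not (ball S 1 v)} (all v)))))
                        (*-monoˡ-≤ (wt (ball S 0)) (m≤m+n (2 * Λ) 1))))
      ... | no ¬all with ¬∀⟶∃¬ N _ (λ v → true? (not (ball S 1 v) ∨ ball S 0 v)) ¬all
      ... | v , ¬v with ball S 1 v in eq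
      ... | false = ⊥-elim (¬v refl)
      ... | true with ball-new S 0 v eq
      ... | inj₁ p = ⊥-elim (¬v p)
      ... | inj₂ (c , u , p , h) = ≤-trans (edge-weight h) (count-mono (λ i t → [ (λ e → subst (λ x → ball S 1 ∋ x) (true⇒ (u ≟ pts i) e) (ball-mono S 0 u p))
                    , (λ e → subst (λ x → ball S 1 ∋ x) (true⇒ (v ≟ pts i) e) eq) ]′ (∨-true {⌊ u ≟ pts i ⌋} t)))
      linear : Fast → ∀ j s → s + j ≤ q → (2 * Λ + s) * wt (ball S j) ≤ 2 * Λ * wt (ball S (s + j))
      linear fast j zero le = ≤-reflexive (cong (_* wt (ball S j)) (+-identityʳ (2 * Λ)))
      linear fast j (suc s) le = begin
        (2 * Λ + suc s) * wt (ball S j) ≡⟨ r1 (2 * Λ) s (wt (ball S j)) ⟩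
        (2 * Λ + s) * wt (ball S j) + wt (ball S j) ≤⟨ +-mono-≤ (linear fast j s (<⇒≤ le)) (wt-mono (ball-mono-+ S s j)) ⟩
        2 * Λ * wt (ball S (s + j)) + wt (ball S (s + j)) ≡⟨ r2 (2 * Λ) (wt (ball S (s + j))) ⟩
        (2 * Λ + 1) * wt (ball S (s + j)) ≤⟨ <⇒≤ (fast (s + j) le) ⟩
        2 * Λ * wt (ball S (suc s + j)) ∎
        where
        r1 : ∀ l s w → (l + suc s) * w ≡ (l + s) * w + w
        r1 = solve-∀
        r2 : ∀ l w → l * w + w ≡ (l + 1) * w
        r2 = solve-∀
      doubling : Fast → ∀ i → i ≤ ℓ → 2 ^ i * w₁ ≤ wt (ball S (suc (2 * (Λ * i))))
      doubling fast zero le = ≤-trans (≤-reflexive (*-identityˡ w₁)) (≤-trans (first fast) (≤-reflexive (cong (λ n → wt (ball S (suc (2 * n)))) (sym (*-zeroʳ Λ)))))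
      doubling fast (suc i) le = *-cancelˡ-≤ (2 * Λ) {{ℕ.>-nonZero (*-mono-≤ {1} {2} (s≤s z≤n) Λ-pos)}} (begin
        2 * Λ * (2 * 2 ^ i * w₁) ≡⟨ r3 (2 * Λ) (2 ^ i) w₁ ⟩
        (2 * Λ + 2 * Λ) * (2 ^ i * w₁) ≤⟨ *-monoʳ-≤ (2 * Λ + 2 * Λ) (doubling fast i (<⇒≤ le)) ⟩
        (2 * Λ + 2 * Λ) * wt (ball S j) ≤⟨ linear fast j (2 * Λ) (subst (_≤ q) (r4 Λ i) (s≤s (*-monoʳ-≤ 2 (*-monoʳ-≤ Λ le)))) ⟩
        2 * Λ * wt (ball S (2 * Λ + j)) ≡⟨ cong (λ n → 2 * Λ * wt (ball S n)) (sym (r4 Λ i)) ⟩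
        2 * Λ * wt (ball S (suc (2 * (Λ * suc i)))) ∎)
        where
        j = suc (2 * (Λ * i))
        r3 : ∀ l p w → l * (2 * p * w) ≡ (l + l) * (p * w)
        r3 = solve-∀
        r4 : ∀ l i → suc (2 * (l * suc i)) ≡ 2 * l + suc (2 * (l * i))
        r4 = solve-∀

    meet : ∀ S S′ → Fat S → Fat S′ → ∃ λ x → ball S q ∋ x × ball S′ q ∋ x
    meet S S′ fat fat′ with any? (λ x → true? (ball S q x) ×-dec true? (ball S′ q x))
    ... | yes p = p
    ... | no ¬p = ⊥-elim (<⇒≱ (+-mono-< fat fat′) (begin
      2 * wt (ball S q) + 2 * wt (ball S′ q) ≡⟨ sym (*-distribˡ-+ 2 (wt (ball S q)) _) ⟩
      2 * (wt (ball S q) + wt (ball S′ q)) ≤⟨ *-monoʳ-≤ 2 (wt-join (λ _ → true) (ball S q) (ball S′ q) (λ v → disj (ball S q v) (ball S′ q v) (λ a b → ¬p (v , a , b)))) ⟩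
      2 * wt (λ _ → true) ≤⟨ *-monoʳ-≤ 2 (count-≤n _) ⟩
      2 * W ≡⟨ cong (W +_) (+-identityʳ W) ⟩
      W + W ∎))
      where
      open ≤-Reasoning
      disj : ∀ a b → (a ≡ true → b ≡ true → ⊥) → 𝟙 a + 𝟙 b ≤ 1
      disj true true f = ⊥-elim (f refl refl)
      disj true false f = ≤-refl
      disj false b f = 𝟙≤1 b

    Within : List (Fin N) → Fin N → Fin N → Set
    Within l = Star (λ u v → H u v × mem l v ≡ true)

    -- A path kept as a list, since its length bounds its weight; repeated vertices do no harm.
    record Hook (v : Fin N) (S : Set′) (size : ℕ) : Set where
      field
        l : List (Fin N)
        in-C : ∀ u → mem l u ≡ true → C ∋ u
        origin : mem l v ≡ true
        short : length l ≤ size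
        spans : ∀ u → mem l u ≡ true → Within l v u
        end : Fin N
        end-in : mem l end ≡ true
        end-S : S ∋ end

    hook : ∀ S → (∀ v → S ∋ v → C ∋ v) → ∀ j v → ball S j ∋ v → Hook v S (suc j)
    hook S S⊆C zero v p = record
      { l = v ∷ [] ; in-C = λ u m → subst (C ∋_) (only m) (S⊆C v p) ; origin = mem-head v [] ; short = s≤s z≤n
      ; spans = λ u m → subst (Within (v ∷ []) v) (only m) ε ; end = v ; end-in = mem-head v [] ; end-S = p }
      where
      only : ∀ {u} → mem (v ∷ []) u ≡ true → v ≡ u
      only {u} m with v ≟ u
      ... | yes e = e
    hook S S⊆C (suc j) v p with ball-new S j v p
    ... | inj₁ x = let h = hook S S⊆C j v x in record { Hook h ; short = m≤n⇒m≤1+n (Hook.short h) }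
    ... | inj₂ (c , u , pu , h) = record
      { l = v ∷ l ; in-C = in-C′ ; origin = mem-head v l ; short = s≤s short ; spans = spans′ ; end = end
      ; end-in = tail end-in ; end-S = end-S }
      where
      open Hook (hook S S⊆C j u pu)
      tail : ∀ {w} → mem l w ≡ true → mem (v ∷ l) w ≡ true
      tail {w} m = true-∨ʳ {⌊ v ≟ w ⌋} m
      in-C′ : ∀ w → mem (v ∷ l) w ≡ true → C ∋ w
      in-C′ w m with v ≟ w
      ... | yes refl = c
      ... | no _ = in-C w m
      spans′ : ∀ w → mem (v ∷ l) w ≡ true → Within (v ∷ l) v w
      spans′ w m with v ≟ w
      ... | yes refl = ε
      ... | no _ = (H-sym h , tail origin) ◅ Star-weaken (λ { (r , q) → r , tail q }) (spans w m)

    -- Both hooks start at the meeting point `v`. The first can only end in `x`, so reversing it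
    -- moves the origin to `x`.
    link : ∀ {v S S′ a b} → Hook v S a → Hook v S′ b → ∀ x → S ∋ x → (∀ y → S ∋ y → y ≡ x) → Hook x S′ (a + b)
    link {v} {S} {S′} h h′ x Sx only = record
      { l = L.l ++ R.l
      ; in-C = λ u m → [ L.in-C u , R.in-C u ]′ (mem-++⁻ L.l R.l m)
      ; origin = left x∈L
      ; short = ≤-trans (≤-reflexive (Listₚ.length-++ L.l)) (+-mono-≤ L.short R.short)
      ; spans = λ u m → x⇝v ◅◅ [ (λ m₁ → Star-weaken (λ { (r , p) → r , left p }) (L.spans u m₁)) , (λ m₂ → Star-weaken (λ { (r , p) → r , right p }) (R.spans u m₂)) ]′ (mem-++⁻ L.l R.l m)
      ; end = R.end ; end-in = right R.end-in ; end-S = R.end-S }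
      where
      module L = Hook h
      module R = Hook h′
      left : ∀ {u} → mem L.l u ≡ true → mem (L.l ++ R.l) u ≡ true
      left = mem-++ˡ L.l R.l
      right : ∀ {u} → mem R.l u ≡ true → mem (L.l ++ R.l) u ≡ true
      right = mem-++ʳ L.l R.l
      x∈L : mem L.l x ≡ true
      x∈L = subst (λ y → mem L.l y ≡ true) (only L.end L.end-S) L.end-in
      x⇝v : Within (L.l ++ R.l) x v
      x⇝v = Star-weaken (λ { (r , p) → r , left p }) (Star-reverse H-sym L.origin (L.spans x x∈L))

    record Tree (v : Fin N) (Ss : List Set′) : Set where
      field
        l : List (Fin N)
        in-C : ∀ u → mem l u ≡ true → C ∋ u
        origin : mem l v ≡ true
        short : length l ≤ length Ss * (2 * suc q) + 1
        spans : ∀ u → mem l u ≡ true → Within l v u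
        meets : All (λ S → ∃ λ u → mem l u ≡ true × S ∋ u) Ss

    tree : ∀ v → C ∋ v → ∀ Ss → All (λ S → Hook v S (2 * suc q)) Ss → Tree v Ss
    tree v c [] [] = record
      { l = v ∷ [] ; in-C = λ u m → subst (C ∋_) (only m) c ; origin = mem-head v [] ; short = ≤-refl
      ; spans = λ u m → subst (Within (v ∷ []) v) (only m) ε ; meets = [] }
      where
      only : ∀ {u} → mem (v ∷ []) u ≡ true → v ≡ u
      only {u} m with v ≟ u
      ... | yes e = e
    tree v c (S ∷ Ss) (h ∷ hs) = record
      { l = L.l ++ R.l
      ; in-C = λ u m → [ L.in-C u , R.in-C u ]′ (mem-++⁻ L.l R.l m)
      ; origin = left L.origin
      ; short = ≤-trans (≤-reflexive (Listₚ.length-++ L.l)) (≤-trans (+-mono-≤ L.short R.short) (≤-reflexive (sym (+-assoc (2 * suc q) (length Ss * (2 * suc q)) 1))))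
      ; spans = λ u m → [ (λ m₁ → Star-weaken (λ { (r , p) → r , left p }) (L.spans u m₁)) , (λ m₂ → Star-weaken (λ { (r , p) → r , right p }) (R.spans u m₂)) ]′ (mem-++⁻ L.l R.l m)
      ; meets = (L.end , left L.end-in , L.end-S) ∷ All-map (λ { (u , m , s) → u , right m , s }) R.meets }
      where
      module L = Hook h
      module R = Tree (tree v c Ss hs)
      open import Data.List.Relation.Unary.All using () renaming (map to All-map)
      left : ∀ {u} → mem L.l u ≡ true → mem (L.l ++ R.l) u ≡ true
      left = mem-++ˡ L.l R.l
      right : ∀ {u} → mem R.l u ≡ true → mem (L.l ++ R.l) u ≡ true
      right = mem-++ʳ L.l R.l

  wt-mem : ∀ l → wt (mem l) ≤ length l * wmax
  wt-mem [] = ≤-reflexive (Σℕ-zero (λ _ → refl))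
  wt-mem (x ∷ l) = ≤-trans (wt-split (mem (x ∷ l)) (λ v → ⌊ x ≟ v ⌋) (mem l) (λ v → 𝟙-∨ ⌊ x ≟ v ⌋ (mem l v))) (+-mono-≤ (vertex-weight x) (wt-mem l))

  card : Set′ → ℕ
  card p = count p

  card-< : ∀ (p r : Set′) v → (∀ u → p ∋ u → r ∋ u) → r ∋ v → p v ≡ false → card p < card r
  card-< p r v sub rv pv = ≤-trans (≤-trans (≤-reflexive (+-comm 1 (card p))) (+-monoʳ-≤ (card p) one)) (≤-trans (≤-reflexive (sym (Σℕ-+ _ _))) (Σℕ-mono le))
    where
    one : 1 ≤ count (λ u → ⌊ v ≟ u ⌋)
    one = ≤-trans (≤-reflexive (sym (𝟙-true (⇒true (v ≟ v) refl)))) (term≤Σℕ (λ u → 𝟙 ⌊ v ≟ u ⌋) v)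
    le : ∀ u → 𝟙 (p u) + 𝟙 ⌊ v ≟ u ⌋ ≤ 𝟙 (r u)
    le u with v ≟ u
    ... | yes refl rewrite pv | rv = ≤-refl
    ... | no _ = ≤-trans (≤-reflexive (+-identityʳ _)) (𝟙-mono (sub u))

  -- Cut C along a thin layer: the inside is discarded, the layer joins X.
  drop : (s : State) (S : Set′) → (∀ v → S ∋ v → State.C s ∋ v) → ∀ v → S ∋ v → ∀ j → Balls.Thin s S j →
    ∃ λ s′ → card (State.C s′) < card (State.C s)
  drop s S S⊆C v₀ Sv₀ j (half , thin) = record
    { C = C′ ; X = X′ ; ts = ts
    ; C-X = λ v c → cx v (∧-true {C v} c)
    ; C-T = λ v c → C-T v (proj₁ (∧-true {C v} c))
    ; separated = sep
    ; charge = charge′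
    ; good = good ; compatible = compatible ; few = few
    ; large = settle C′ X′ ts sep charge′ good few quarter
    } , card-< C′ C v₀ (λ u p → proj₁ (∧-true {C u} p)) (S⊆C v₀ Sv₀) C′v₀
    where
    open State s
    open Balls s
    open ≤-Reasoning
    B B⁺ layer C′ X′ : Set′
    B = ball S j
    B⁺ = ball S (suc j)
    layer v = B⁺ v ∧ not (B v)
    C′ v = C v ∧ not (B⁺ v)
    X′ v = X v ∨ layer v
    C′v₀ : C′ v₀ ≡ false
    C′v₀ = ∧-false (C v₀) (cong not (ball-mono-≤ S (z≤n {suc j}) v₀ Sv₀))
      where
      ∧-false : ∀ a {b} → b ≡ false → a ∧ b ≡ false
      ∧-false true p = p
      ∧-false false p = refl
    cx : ∀ v → C ∋ v × not (B⁺ v) ≡ true → X′ v ≡ false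
    cx v (c , nb) = cong₂ (λ x b → x ∨ (b ∧ not (B v))) (C-X v c) (not-true nb)
    B-false : ∀ v → C v ≡ false → B⁺ v ≡ false
    B-false v c = ¬true⇒false (λ b → true≢false (ball⊆C S S⊆C (suc j) v b) c)
    rest⁻ : ∀ c x t b b⁺ → not ((c ∧ not b⁺) ∨ ((x ∨ (b⁺ ∧ not b)) ∨ t)) ≡ true → not (c ∨ (x ∨ t)) ≡ true ⊎ b ≡ true
    rest⁻ c x t true b⁺ r = inj₂ refl
    rest⁻ false false false false b⁺ r = inj₁ refl
    rest⁻ false true t false b⁺ ()
    rest⁻ false false true false true ()
    rest⁻ false false true false false ()
    rest⁻ true false t false true ()
    sep : ∀ u v → C′ ∋ u → rest C′ X′ ts ∋ v → ¬ H u v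
    sep u v cu rv h with rest⁻ (C v) (X v) (inT ts v) (B v) (B⁺ v) rv
    ... | inj₁ r = separated u v (proj₁ (∧-true {C u} cu)) r h
    ... | inj₂ b = true≢false (ball-step S j b (proj₁ (∧-true {C u} cu)) (H-sym h)) (not-true (proj₂ (∧-true {C u} cu)))
    layer-thin : 2 * Λ * wt layer ≤ wt B
    layer-thin = +-cancelˡ-≤ (2 * Λ * wt B) (2 * Λ * wt layer) (wt B) (begin
      2 * Λ * wt B + 2 * Λ * wt layer ≡⟨ sym (*-distribˡ-+ (2 * Λ) (wt B) (wt layer)) ⟩
      2 * Λ * (wt B + wt layer) ≤⟨ *-monoʳ-≤ (2 * Λ) (wt-join B⁺ B layer (λ v → add (B v) (B⁺ v) (ball-mono S j v))) ⟩
      2 * Λ * wt B⁺ ≤⟨ thin ⟩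
      (2 * Λ + 1) * wt B ≡⟨ r1 (2 * Λ) (wt B) ⟩
      2 * Λ * wt B + wt B ∎)
      where
      r1 : ∀ l w → (l + 1) * w ≡ l * w + w
      r1 = solve-∀
      add : ∀ b b⁺ → (b ≡ true → b⁺ ≡ true) → 𝟙 b + 𝟙 (b⁺ ∧ not b) ≤ 𝟙 b⁺
      add true true f = ≤-refl
      add true false f = ⊥-elim (true≢false (f refl) refl)
      add false true f = ≤-refl
      add false false f = ≤-refl
    charge′ : 2 * Λ * wt X′ ≤ wt (rest C′ X′ ts)
    charge′ = begin
      2 * Λ * wt X′ ≤⟨ *-monoʳ-≤ (2 * Λ) (wt-split X′ X layer (λ v → 𝟙-∨ (X v) (layer v))) ⟩
      2 * Λ * (wt X + wt layer) ≡⟨ *-distribˡ-+ (2 * Λ) (wt X) (wt layer) ⟩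
      2 * Λ * wt X + 2 * Λ * wt layer ≤⟨ +-mono-≤ charge layer-thin ⟩
      wt (rest C X ts) + wt B ≤⟨ wt-join (rest C′ X′ ts) (rest C X ts) B joined ⟩
      wt (rest C′ X′ ts) ∎
      where
      joined′ : ∀ c x t b b⁺ → (b ≡ true → c ≡ true × x ≡ false × t ≡ false × b⁺ ≡ true) → (c ≡ false → b⁺ ≡ false) →
        𝟙 (not (c ∨ (x ∨ t))) + 𝟙 b ≤ 𝟙 (not ((c ∧ not b⁺) ∨ ((x ∨ (b⁺ ∧ not b)) ∨ t)))
      joined′ c x t true b⁺ f g with f refl
      ... | refl , refl , refl , refl = ≤-refl
      joined′ true x t false b⁺ f g = z≤n
      joined′ false x t false b⁺ f g with g refl
      joined′ false true t false false f g | refl = z≤n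
      joined′ false false true false false f g | refl = z≤n
      joined′ false false false false false f g | refl = ≤-refl
      joined : ∀ v → 𝟙 (rest C X ts v) + 𝟙 (B v) ≤ 𝟙 (rest C′ X′ ts v)
      joined v = joined′ (C v) (X v) (inT ts v) (B v) (B⁺ v)
        (λ b → let c = ball⊆C S S⊆C j v b in c , C-X v c , C-T v c , ball-mono S j v b) (B-false v)
    -- `7/8 - 1/2 - 1/8 = 1/4`: the ball has at most half of the measure, and the layer at most an
    -- eighth because `8 ≤ 2 * Λ`. Then `settle` restores `7/8`.
    quarter : W ≤ 4 * wt C′
    quarter = *-cancelˡ-≤ 2 (+-cancelˡ-≤ (6 * W) _ _ (begin
      6 * W + 2 * W ≡⟨ r1 W ⟩
      7 * W + W ≤⟨ +-monoˡ-≤ W large ⟩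
      8 * wt C + W ≤⟨ +-monoˡ-≤ W (*-monoʳ-≤ 8 (wt-split C C′ B⁺ (λ v → parts (C v) (B⁺ v)))) ⟩
      8 * (wt C′ + wt B⁺) + W ≤⟨ +-monoˡ-≤ W (*-monoʳ-≤ 8 (+-monoʳ-≤ (wt C′) (wt-split B⁺ B layer (λ v → parts′ (B⁺ v) (B v))))) ⟩
      8 * (wt C′ + (wt B + wt layer)) + W ≡⟨ r2 (wt C′) (wt B) (wt layer) W ⟩
      2 * (4 * wt C′) + 4 * (2 * wt B) + (8 * wt layer + W) ≤⟨ +-mono-≤ (+-monoʳ-≤ (2 * (4 * wt C′)) (*-monoʳ-≤ 4 half)) (+-monoˡ-≤ W layer-small) ⟩
      2 * (4 * wt C′) + 4 * W + (W + W) ≡⟨ r3 (2 * (4 * wt C′)) W ⟩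
      6 * W + 2 * (4 * wt C′) ∎))
      where
      r1 : ∀ w → 6 * w + 2 * w ≡ 7 * w + w
      r1 = solve-∀
      r2 : ∀ c b l w → 8 * (c + (b + l)) + w ≡ 2 * (4 * c) + 4 * (2 * b) + (8 * l + w)
      r2 = solve-∀
      r3 : ∀ c w → c + 4 * w + (w + w) ≡ 6 * w + c
      r3 = solve-∀
      parts : ∀ c b → 𝟙 c ≤ 𝟙 (c ∧ not b) + 𝟙 b
      parts true true = ≤-refl
      parts true false = ≤-refl
      parts false b = z≤n
      parts′ : ∀ c b → 𝟙 c ≤ 𝟙 b + 𝟙 (c ∧ not b)
      parts′ true true = ≤-refl
      parts′ true false = ≤-refl
      parts′ false b = z≤n
      layer-small : 8 * wt layer ≤ W
      layer-small = ≤-trans (*-monoˡ-≤ (wt layer) (*-monoʳ-≤ 2 4≤Λ)) (≤-trans layer-thin (count-≤n _))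

  -- A tree with no neighbour left in `C` can join the discarded set without breaking separation.
  -- This only enlarges the side of `charge` that pays.
  prune : (s : State) → ∃ λ s′ → State.C s′ ≡ State.C s × length (State.ts s′) ≤ length (State.ts s) × All (λ t → Touch t (State.C s)) (State.ts s′)
  prune s = record
    { C = C ; X = X ; ts = ts′ ; C-X = C-X
    ; C-T = λ v c → ¬true⇒false (λ t → true≢false (sub ts v t) (C-T v c))
    ; separated = sep
    ; charge = ≤-trans charge (wt-mono {rest C X ts} {rest C X ts′} (λ v r → grow (C v) (X v) (sub ts v) r))
    ; good = Allₚ.filter⁺ near? good ; compatible = AllPairsₚ.filter⁺ near? compatible
    ; few = ≤-trans (Listₚ.length-filter near? ts) few ; large = large
    } , refl , Listₚ.length-filter near? ts , Allₚ.all-filter near? ts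
    where
    open State s
    near? : ∀ t → Dec (Touch t C)
    near? t = Touch? t C
    ts′ : List Set′
    ts′ = List.filter near? ts
    sub : ∀ ts v → inT (List.filter near? ts) v ≡ true → inT ts v ≡ true
    sub (t ∷ ts) v p with near? t
    ... | no _ = true-∨ʳ {t v} (sub ts v p)
    ... | yes _ with ∨-true {t v} p
    ... | inj₁ x = true-∨ˡ x
    ... | inj₂ y = true-∨ʳ {t v} (sub ts v y)
    grow : ∀ c x {t t′} → (t′ ≡ true → t ≡ true) → not (c ∨ (x ∨ t)) ≡ true → not (c ∨ (x ∨ t′)) ≡ true
    grow false false {false} {false} f r = refl
    grow false false {false} {true} f r = f refl
    lost : ∀ ts v → inT ts v ≡ true → inT (List.filter near? ts) v ≡ false → ∃ λ t → t ∋ v × ¬ Touch t C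
    lost (t ∷ ts) v p r with near? t
    lost (t ∷ ts) v p r | no far with t v in tv
    ... | true = t , tv , far
    ... | false = lost ts v p r
    lost (t ∷ ts) v p r | yes _ with t v
    ... | false = lost ts v p r
    sep : ∀ u v → C ∋ u → rest C X ts′ ∋ v → ¬ H u v
    sep u v cu r h with inT ts v in eq
    ... | false = separated u v cu (keep (C v) (X v) eq r) h
      where
      keep : ∀ c x {t t′} → t ≡ false → not (c ∨ (x ∨ t′)) ≡ true → not (c ∨ (x ∨ t)) ≡ true
      keep false false refl r = refl
    ... | true with lost ts v eq (none (C v) (X v) r)
      where
      none : ∀ c x {t} → not (c ∨ (x ∨ t)) ≡ true → t ≡ false
      none false false {false} r = refl
    ... | t , tv , far = far (v , u , tv , cu , H-sym h)

  -- The new tree lies in `C` and meets the neighbourhood of every earlier tree, so it is disjoint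
  -- from and adjacent to each of them. Moving it out of `C` leaves the discarded set unchanged.
  add : (s : State) → length (State.ts s) < k → ∀ i → State.C s ∋ pts i → Balls.Tree s (pts i) (List.map (λ t v → State.C s v ∧ ⌊ any? (λ u → true? (t u) ×-dec H? u v) ⌋) (State.ts s)) →
    ∃ λ s′ → card (State.C s′) < card (State.C s)
  add s lt i Ci tr = record
    { C = C′ ; X = X ; ts = T ∷ ts
    ; C-X = λ v c → C-X v (proj₁ (∧-true {C v} c))
    ; C-T = λ v c → ct v (∧-true {C v} c)
    ; separated = sep
    ; charge = charge′
    ; good = good′ ; compatible = pairs ts meets C-T ∷ compatible ; few = lt
    ; large = settle C′ X (T ∷ ts) sep charge′ good′ lt quarter
    } , card-< C′ C (pts i) (λ u p → proj₁ (∧-true {C u} p)) Ci (gone (C (pts i)) origin)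
    where
    open State s
    open Balls s
    open Tree tr
    open ≤-Reasoning
    T C′ : Set′
    T = mem l
    C′ v = C v ∧ not (T v)
    gone : ∀ c {t} → t ≡ true → c ∧ not t ≡ false
    gone true refl = refl
    gone false refl = refl
    ct : ∀ v → C ∋ v × not (T v) ≡ true → T v ∨ inT ts v ≡ false
    ct v (c , t) = cong₂ _∨_ (not-true t) (C-T v c)
    same : ∀ v → rest C′ X (T ∷ ts) ∋ v → rest C X ts ∋ v
    same v r with C v | T v | X v | inT ts v
    ... | false | false | false | false = refl
    ... | true | true | false | _ = ⊥-elim (true≢false {true} refl (sym r))
    same⁻ : ∀ v → rest C X ts ∋ v → rest C′ X (T ∷ ts) ∋ v
    same⁻ v r with C v in c | T v in t | X v | inT ts v
    ... | false | false | false | false = refl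
    ... | false | true | _ | _ = ⊥-elim (true≢false (in-C v t) c)
    sep : ∀ u v → C′ ∋ u → rest C′ X (T ∷ ts) ∋ v → ¬ H u v
    sep u v cu r = separated u v (proj₁ (∧-true {C u} cu)) (same v r)
    charge′ : 2 * Λ * wt X ≤ wt (rest C′ X (T ∷ ts))
    charge′ = ≤-trans charge (wt-mono same⁻)
    T≤τ : wt T ≤ τ
    T≤τ = ≤-trans (wt-mem l) (*-monoˡ-≤ wmax (≤-trans short (+-monoˡ-≤ 1 (*-monoˡ-≤ (2 * suc q) (≤-trans (≤-reflexive (Listₚ.length-map _ ts)) few)))))
    good′ : All Good (T ∷ ts)
    good′ = (T≤τ , pts i , origin , (i , refl) , spans) ∷ good
    pairs : ∀ ts → All (λ S → ∃ λ u → mem l u ≡ true × S ∋ u) (List.map (λ t v → C v ∧ ⌊ any? (λ u → true? (t u) ×-dec H? u v) ⌋) ts) →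
      (∀ v → C ∋ v → inT ts v ≡ false) → All (Compatible T) ts
    pairs [] _ _ = []
    pairs (t ∷ ts) ((v , mv , Sv) ∷ ms) out =
      ((λ x Tx → ∨-falseˡ (out x (in-C x Tx))) ,
        (let (u , tu , h) = true⇒ (any? (λ u → true? (t u) ×-dec H? u v)) (proj₂ (∧-true {C v} Sv)) in v , u , mv , tu , H-sym h))
      ∷ pairs ts ms (λ x Cx → ∨-falseʳ {t x} (out x Cx))
      where
      ∨-falseˡ : ∀ {a b} → a ∨ b ≡ false → a ≡ false
      ∨-falseˡ {false} _ = refl
      ∨-falseʳ : ∀ {a b} → a ∨ b ≡ false → b ≡ false
      ∨-falseʳ {false} p = p
    quarter : W ≤ 4 * wt C′
    quarter = *-cancelˡ-≤ 2 (+-cancelˡ-≤ (6 * W) _ _ (begin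
      6 * W + 2 * W ≡⟨ r1 W ⟩
      7 * W + W ≤⟨ +-monoˡ-≤ W large ⟩
      8 * wt C + W ≤⟨ +-monoˡ-≤ W (*-monoʳ-≤ 8 (wt-split C C′ T (λ v → parts (C v) (T v)))) ⟩
      8 * (wt C′ + wt T) + W ≤⟨ +-monoˡ-≤ W (≤-reflexive (*-distribˡ-+ 8 (wt C′) (wt T))) ⟩
      8 * wt C′ + 8 * wt T + W ≤⟨ +-monoˡ-≤ W (+-monoʳ-≤ (8 * wt C′) (≤-trans (*-monoʳ-≤ 8 (≤-trans T≤τ τ≤)) room)) ⟩
      8 * wt C′ + W + W ≤⟨ m≤m+n _ (4 * W) ⟩
      8 * wt C′ + W + W + 4 * W ≡⟨ r2 (wt C′) W ⟩
      6 * W + 2 * (4 * wt C′) ∎))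
      where
      r1 : ∀ w → 6 * w + 2 * w ≡ 7 * w + w
      r1 = solve-∀
      r2 : ∀ c w → 8 * c + w + w + 4 * w ≡ 6 * w + 2 * (4 * c)
      r2 = solve-∀
      parts : ∀ c b → 𝟙 c ≤ 𝟙 (c ∧ not b) + 𝟙 b
      parts true true = ≤-refl
      parts true false = ≤-refl
      parts false b = z≤n
      τ≤ : τ ≤ (2 * Λ + 2) * (k * τ)
      τ≤ = ≤-trans (m≤n*m τ k {{ℕ.>-nonZero (≤-trans (s≤s z≤n) lt)}}) (m≤n*m (k * τ) (2 * Λ + 2) {{ℕ.>-nonZero (≤-trans (s≤s z≤n) (m≤n+m 2 (2 * Λ)))}})

  Result : ℕ → Set
  Result k = Σ (CliqueModel H k) λ m → ∀ i → ∃ λ j → CliqueModel.root m i ≡ pts j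

  module Model (ts : List Set′) (good : All Good ts) (compatible : AllPairs Compatible ts) where

    branch : Fin (length ts) → Set′
    branch = lookup ts

    compatible-at : ∀ {ts} → AllPairs Compatible ts → ∀ i j → i ≢ j → Compatible (lookup ts i) (lookup ts j) ⊎ Compatible (lookup ts j) (lookup ts i)
    compatible-at (p ∷ ps) zero zero ne = ⊥-elim (ne refl)
    compatible-at (p ∷ ps) zero (suc j) ne = inj₁ (All-lookup p j)
    compatible-at (p ∷ ps) (suc i) zero ne = inj₂ (All-lookup p i)
    compatible-at (p ∷ ps) (suc i) (suc j) ne = compatible-at ps i j (ne ∘ cong suc)

    disjoint : ∀ i j v → branch i ∋ v → branch j ∋ v → i ≡ j
    disjoint i j v p r with i ≟ j
    ... | yes e = e
    ... | no ne with compatible-at compatible i j ne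
    ... | inj₁ (d , _) = ⊥-elim (true≢false r (d v p))
    ... | inj₂ (d , _) = ⊥-elim (true≢false p (d v r))

    label : Fin N → Maybe (Fin (length ts))
    label v with any? (λ i → true? (branch i v))
    ... | yes (i , _) = just i
    ... | no _ = nothing

    label⇐ : ∀ i v → branch i ∋ v → label v ≡ just i
    label⇐ i v p with any? (λ i → true? (branch i v))
    ... | yes (j , r) = cong just (disjoint j i v r p)
    ... | no none = ⊥-elim (none (i , p))

    label⇒ : ∀ i v → label v ≡ just i → branch i ∋ v
    label⇒ i v e with any? (λ i → true? (branch i v))
    label⇒ i v refl | yes (.i , r) = r

    tree-connected : ∀ i → Connected (branch i)
    tree-connected i = proj₂ (All-lookup good i)

    model : CliqueModel H (length ts)
    model = record
      { label = label
      ; root = λ i → proj₁ (tree-connected i)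
      ; root-label = λ i → label⇐ i _ (proj₁ (proj₂ (tree-connected i)))
      ; branch-connected = λ i x lx → Star-weaken (λ { (h , p) → h , label⇐ i _ p }) (proj₂ (proj₂ (proj₂ (tree-connected i))) x (label⇒ i x lx))
      ; touching = λ i j i≢j → case compatible-at compatible i j i≢j of λ
          { (inj₁ (_ , u , v , p , r , h)) → u , v , label⇐ i u p , label⇐ j v r , h
          ; (inj₂ (_ , u , v , p , r , h)) → v , u , label⇐ i v r , label⇐ j u p , H-sym h } }

    real-roots : ∀ i → ∃ λ j → CliqueModel.root model i ≡ pts j
    real-roots i = proj₁ (proj₂ (proj₂ (tree-connected i)))

  finish : (s : State) → length (State.ts s) ≡ k → Result k
  finish s eq = subst Result eq (Model.model ts good compatible , Model.real-roots ts good compatible)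
    where open State s

  module Advance (s : State) (lt : length (State.ts s) < k) (touch : All (λ t → Touch t (State.C s)) (State.ts s)) where
    open State s
    open Balls s

    -- Take balls around a sample point of `C` and around the neighbours in `C` of each tree. If one
    -- of them has a thin layer, cut there. Otherwise each has more than half of the measure, so the
    -- first meets all others, and the resulting paths from the sample point form a new tree.
    next : Σ State λ s′ → card (State.C s′) < card C
    next = from-point (any? (λ i → true? (C (pts i))))
      where
      neighbours : Set′ → Set′
      neighbours t v = C v ∧ ⌊ any? (λ u → true? (t u) ×-dec H? u v) ⌋
      from-point : Dec (∃ λ i → C ∋ pts i) → Σ State λ s′ → card (State.C s′) < card C
      from-point (no none) = ⊥-elim (<⇒≱ (≤-trans (*-mono-≤ {1} {7} (s≤s z≤n) W-pos) large)
        (≤-reflexive (trans (cong (8 *_) (Σℕ-zero (λ i → cong 𝟙 (¬true⇒false (λ c → none (i , c)))))) refl)))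
      from-point (yes (i , Ci)) = from-ball (thin-below? S₀ q)
        where
        S₀ : Set′
        S₀ v = ⌊ pts i ≟ v ⌋
        S₀⊆C : ∀ v → S₀ ∋ v → C ∋ v
        S₀⊆C v p = subst (C ∋_) (true⇒ (pts i ≟ v) p) Ci
        S₀∋ : S₀ ∋ pts i
        S₀∋ = ⇒true (pts i ≟ pts i) refl
        Cut : Set
        Cut = ∃ λ S → ∃₂ λ v j → (∀ v → S ∋ v → C ∋ v) × S ∋ v × Thin S j
        search : Fat S₀ → ∀ ts → All (λ t → Touch t C) ts → Cut ⊎ All (λ S → Hook (pts i) S (2 * suc q)) (List.map neighbours ts)
        search fat [] [] = inj₂ []
        search fat (t ∷ ts) ((u , v , tu , Cv , h) ∷ touch) with thin-below? (neighbours t) q | search fat ts touch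
        ... | inj₁ (j , thin) | _ = inj₁ (neighbours t , v , j , (λ x p → proj₁ (∧-true {C x} p)) , true-∧ Cv (⇒true (any? (λ u → true? (t u) ×-dec H? u v)) (u , tu , h)) , thin)
        ... | inj₂ _ | inj₁ cut = inj₁ cut
        ... | inj₂ no-thin | inj₂ hooks = inj₂ (connect (meet S₀ (neighbours t) fat (growth (neighbours t) no-thin)) ∷ hooks)
          where
          connect : (∃ λ x → ball S₀ q ∋ x × ball (neighbours t) q ∋ x) → Hook (pts i) (neighbours t) (2 * suc q)
          connect (x , a , b) = subst (Hook (pts i) (neighbours t)) (cong (suc q +_) (sym (+-identityʳ (suc q))))
            (link (hook S₀ S₀⊆C q x a) (hook (neighbours t) (λ x p → proj₁ (∧-true {C x} p)) q x b) (pts i) S₀∋ (λ y p → sym (true⇒ (pts i ≟ y) p)))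
        from-ball : (∃ λ j → Thin S₀ j) ⊎ (∀ j → j < q → ¬ Thin S₀ j) → Σ State λ s′ → card (State.C s′) < card C
        from-ball (inj₁ (j , thin)) = drop s S₀ S₀⊆C (pts i) S₀∋ j thin
        from-ball (inj₂ no-thin) = from-search (search (growth S₀ no-thin) ts touch)
          where
          from-search : Cut ⊎ All (λ S → Hook (pts i) S (2 * suc q)) (List.map neighbours ts) → Σ State λ s′ → card (State.C s′) < card C
          from-search (inj₁ (S , v , j , S⊆C , Sv , thin)) = drop s S S⊆C v Sv j thin
          from-search (inj₂ hooks) = add s lt i Ci (tree (pts i) Ci (List.map neighbours ts) hooks)

  -- Each round takes a vertex out of `C`, while `large` keeps `C` from becoming empty; so the
  -- rounds end with `k` trees.
  run : ∀ fuel (s : State) → card (State.C s) < fuel → Result k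
  run (suc fuel) s (s≤s le) =
    let (s₁ , C≡ , _ , touch) = prune s in
    go s₁ (≤-trans (≤-reflexive (cong card C≡)) le) (subst (λ C → All (λ t → Touch t C) (State.ts s₁)) (sym C≡) touch) (length (State.ts s₁) <? k)
    where
    go : (s₁ : State) → card (State.C s₁) ≤ fuel → All (λ t → Touch t (State.C s₁)) (State.ts s₁) → Dec (length (State.ts s₁) < k) → Result k
    go s₁ le touch (no ¬lt) = finish s₁ (≤-antisym (State.few s₁) (≮⇒≥ ¬lt))
    go s₁ le touch (yes lt) = let (s₂ , smaller) = Advance.next s₁ lt touch in run fuel s₂ (≤-trans smaller le)

  clique-model : Result k
  clique-model = run (suc N) initial (s≤s (count-≤n _))

-- Walks and Voronoi cells

data Reach {V : Set} (E : V → V → Set) : ℕ → V → V → Set where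
  stay : ∀ {n x} → Reach E n x x
  hop : ∀ {n x y z} → E x y → Reach E n y z → Reach E (suc n) x z

module _ {V : Set} {E : V → V → Set} where

  reach-mono : ∀ {m n x y} → m ≤ n → Reach E m x y → Reach E n x y
  reach-mono le stay = stay
  reach-mono (s≤s le) (hop e p) = hop e (reach-mono le p)

  reach-trans : ∀ {m n x y z} → Reach E m x y → Reach E n y z → Reach E (m + n) x z
  reach-trans {m} {n} stay q = reach-mono (m≤n+m n m) q
  reach-trans (hop e p) q = hop e (reach-trans p q)

  reach-sym : (∀ {x y} → E x y → E y x) → ∀ {m x y} → Reach E m x y → Reach E m y x
  reach-sym E-sym stay = stay
  reach-sym E-sym {suc m} {x} {z} (hop e p) = subst (λ k → Reach E k z x) (+-comm m 1) (reach-trans (reach-sym E-sym p) (hop {n = 0} (E-sym e) stay))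

  reach-split : ∀ m {n x z} → Reach E (m + n) x z → ∃ λ y → Reach E m x y × Reach E n y z
  reach-split zero p = _ , stay , p
  reach-split (suc m) stay = _ , stay , stay
  reach-split (suc m) (hop e p) = let (y , q , r) = reach-split m p in y , hop e q , r

  reach-blocks : ∀ {ρ} L {x y} → Reach E (L * ρ) x y → Reach (Reach E ρ) L x y
  reach-blocks zero stay = stay
  reach-blocks {ρ} (suc L) p = let (_ , q , r) = reach-split ρ p in hop q (reach-blocks L r)

  reach-map : (f : V → V) → (∀ {x y} → E x y → E (f x) (f y)) → ∀ {m x y} → Reach E m x y → Reach E m (f x) (f y)
  reach-map f f-E stay = stay
  reach-map f f-E (hop e p) = hop (f-E e) (reach-map f f-E p)

  reach-closed : (P : V → Set) → (∀ {x y} → E x y → P x → P y) → ∀ {m x y} → Reach E m x y → P x → P y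
  reach-closed P step′ stay p = p
  reach-closed P step′ (hop e q) p = reach-closed P step′ q (step′ e p)

  Star⇒reach : ∀ {x y} → Star E x y → ∃ λ m → Reach E m x y
  Star⇒reach ε = 0 , stay
  Star⇒reach (e ◅ p) = let (m , q) = Star⇒reach p in suc m , hop e q

reach? : ∀ {N} {E : Fin N → Fin N → Set} → (∀ x y → Dec (E x y)) → ∀ n x y → Dec (Reach E n x y)
reach? E? zero x y with x ≟ y
... | yes refl = yes stay
... | no ne = no λ { stay → ne refl }
reach? E? (suc n) x y with x ≟ y
... | yes refl = yes stay
... | no ne with any? (λ z → E? x z ×-dec reach? E? n z y)
... | yes (z , e , p) = yes (hop e p)
... | no none = no λ { stay → ne refl ; (hop e p) → none (_ , e , p) }

-- Voronoi cells of a maximal set of centres with pairwise distance more than 2r.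
record Cells {N : ℕ} (E : Fin N → Fin N → Set) (r : ℕ) : Set where
  field
    c : Fin N → Fin N
    c-near : ∀ v → Reach E (2 * r) v (c v)
    c-fibre : ∀ u v → c u ≡ c v → Star (λ x y → E x y × c y ≡ c u) u v
    c-local : ∀ u v → Reach E r u (c v) → c u ≡ c v

module Voronoi {N : ℕ} {E : Fin N → Fin N → Set} (E? : ∀ x y → Dec (E x y)) (E-sym : ∀ {x y} → E x y → E y x) (r : ℕ) where

  open SeparatedCover (separated-cover {R = Reach E (2 * r)} (reach? E? (2 * r)) (λ _ → stay) (reach-sym E-sym) id)

  Centre : Fin N → Set
  Centre z = ∃ λ i → z ≡ points i

  centre? : ∀ z → Dec (Centre z)
  centre? z = any? (λ i → z ≟ points i)

  assigned? : ∀ (m : Maybe (Fin N)) → Dec (∃ λ z → m ≡ just z)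
  assigned? (just z) = yes (z , refl)
  assigned? nothing = no λ ()

  -- Breadth-first growth: an assigned vertex keeps its centre, and an unassigned one copies a
  -- neighbour, which keeps cells connected whatever the ties. Decisions are arguments of `grow` and
  -- `adopt` so that proofs can split on them.
  cell : ℕ → Fin N → Maybe (Fin N)
  grow : ∀ k v → Dec (∃ λ z → cell k v ≡ just z) → Maybe (Fin N)
  adopt : ∀ k v → Dec (∃ λ u → E v u × ∃ λ z → cell k u ≡ just z) → Maybe (Fin N)
  cell zero v = if ⌊ centre? v ⌋ then just v else nothing
  cell (suc k) v = grow k v (assigned? (cell k v))
  grow k v (yes (z , _)) = just z
  grow k v (no _) = adopt k v (any? (λ u → E? v u ×-dec assigned? (cell k u)))
  adopt k v (yes (u , _ , z , _)) = just z
  adopt k v (no _) = nothing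

  cell-mono : ∀ k v z → cell k v ≡ just z → cell (suc k) v ≡ just z
  cell-mono k v z eq = lem (assigned? (cell k v))
    where
    lem : ∀ d → grow k v d ≡ just z
    lem (yes (z′ , eq′)) = trans (sym eq′) eq
    lem (no none) = ⊥-elim (none (z , eq))

  cell-mono-+ : ∀ n k v z → cell k v ≡ just z → cell (n + k) v ≡ just z
  cell-mono-+ zero k v z eq = eq
  cell-mono-+ (suc n) k v z eq = cell-mono (n + k) v z (cell-mono-+ n k v z eq)

  record Assigned (k : ℕ) (v z : Fin N) : Set where
    field
      centre : Centre z
      near : Reach E k v z
      path : Star (λ x y → E x y × cell k y ≡ just z) v z

  assigned : ∀ k v z → cell k v ≡ just z → Assigned k v z
  assigned zero v z eq with centre? v
  assigned zero v .v refl | yes q = record { centre = q ; near = stay ; path = ε }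
  assigned (suc k) v z eq = lem (assigned? (cell k v)) eq
    where
    weaken : ∀ {v} → Assigned k v z → Star (λ x y → E x y × cell (suc k) y ≡ just z) v z
    weaken a = Star-weaken (λ { (e , p) → e , cell-mono k _ z p }) (Assigned.path a)
    lem₂ : ∀ d → adopt k v d ≡ just z → Assigned (suc k) v z
    lem₂ (yes (u , e , _ , eq′)) refl =
      let a = assigned k u z eq′ in
      record { centre = Assigned.centre a ; near = hop e (Assigned.near a) ; path = (e , cell-mono k u z eq′) ◅ weaken a }
    lem : ∀ d → grow k v d ≡ just z → Assigned (suc k) v z
    lem (yes (_ , eq′)) refl = let a = assigned k v z eq′ in record { centre = Assigned.centre a ; near = reach-mono (n≤1+n k) (Assigned.near a) ; path = weaken a }
    lem (no _) eq = lem₂ (any? (λ u → E? v u ×-dec assigned? (cell k u))) eq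

  covered : ∀ k v z → Centre z → Reach E k v z → ∃ λ z′ → cell k v ≡ just z′
  covered k v .v q stay = v , subst (λ n → cell n v ≡ just v) (+-identityʳ k) (cell-mono-+ k 0 v v (zero-case (centre? v)))
    where
    zero-case : ∀ (d : Dec (Centre v)) → (if ⌊ d ⌋ then just v else nothing) ≡ just v
    zero-case (yes _) = refl
    zero-case (no none) = ⊥-elim (none q)
  covered (suc k) v z q (hop {y = u} e p) = lem (assigned? (cell k v))
    where
    lem₂ : ∀ d → ∃ λ z′ → adopt k v d ≡ just z′
    lem₂ (yes (_ , _ , z′ , _)) = z′ , refl
    lem₂ (no none) = ⊥-elim (none (u , e , covered k u z q p))
    lem : ∀ d → ∃ λ z′ → grow k v d ≡ just z′
    lem (yes (z′ , _)) = z′ , refl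
    lem (no _) = lem₂ (any? (λ u → E? v u ×-dec assigned? (cell k u)))

  total : ∀ v → ∃ λ z → cell (2 * r) v ≡ just z
  total v = let (j , p) = covers v in covered (2 * r) v (points j) (j , refl) p

  centre : Fin N → Fin N
  centre v = proj₁ (total v)

  ok : ∀ v → Assigned (2 * r) v (centre v)
  ok v = assigned (2 * r) v (centre v) (proj₂ (total v))

  just-injective : ∀ {x y : Fin N} → just x ≡ just y → x ≡ y
  just-injective refl = refl

  unique : ∀ v z → cell (2 * r) v ≡ just z → centre v ≡ z
  unique v z eq = just-injective (trans (sym (proj₂ (total v))) eq)

  to-centre : ∀ v → Star (λ x y → E x y × centre y ≡ centre v) v (centre v)
  to-centre v = Star-weaken (λ { (e , p) → e , unique _ _ p }) (Assigned.path (ok v))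

  -- A vertex within `r` of the centre `z` is assigned by round `r`, to a centre within `r` of it.
  -- Two centres at distance at most `2 * r` coincide, and later rounds change nothing.
  local : ∀ u z → Centre z → Reach E r u z → centre u ≡ z
  local u z (j , z≡) p = trans (unique u z′ (subst (λ n → cell n u ≡ just z′) (cong (r +_) (sym (+-identityʳ r))) (cell-mono-+ r r u z′ (proj₂ first)))) z′≡z
    where
    first : ∃ λ z′ → cell r u ≡ just z′
    first = covered r u z (j , z≡) p
    z′ = proj₁ first
    a : Assigned r u z′
    a = assigned r u z′ (proj₂ first)
    z′≡z : z′ ≡ z
    z′≡z = let (i , z′≡) = Assigned.centre a in
      trans z′≡ (trans (cong points (separated i j (subst₂ (Reach E (2 * r)) z′≡ z≡
        (subst (λ n → Reach E n z′ z) (cong (r +_) (sym (+-identityʳ r))) (reach-trans (reach-sym E-sym (Assigned.near a)) p))))) (sym z≡))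

  cells : Cells E r
  cells = record
    { c = centre
    ; c-near = λ v → Assigned.near (ok v)
    ; c-fibre = λ u v eq → to-centre u ◅◅ Star-weaken (λ { (e , p) → e , trans p (sym eq) })
        (subst (λ z → Star (λ x y → E x y × centre y ≡ centre v) z v) (sym eq) (Star-reverse E-sym refl (to-centre v)))
    ; c-local = λ u v p → local u (centre v) (Assigned.centre (ok v)) p }

-- Logarithms and the choice of constants

binary-logarithm : ∀ W w → 0 < w → w ≤ W → ∃ λ ℓ → 2 ^ ℓ * w ≤ W × W < 2 * (2 ^ ℓ * w)
binary-logarithm W w w-pos w≤W = go W 0 (≤-trans (≤-reflexive (+-identityʳ w)) w≤W) (≤-trans (n<2^n W) (≤-trans (≤-reflexive (sym (*-identityʳ (2 ^ W))))
    (≤-trans (*-monoʳ-≤ (2 ^ W) w-pos) (≤-reflexive (cong (λ n → 2 ^ n * w) (sym (+-identityʳ W)))))))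
  where
  go : ∀ fuel m → 2 ^ m * w ≤ W → W < 2 ^ (fuel + m) * w → ∃ λ ℓ → 2 ^ ℓ * w ≤ W × W < 2 * (2 ^ ℓ * w)
  go zero m lo hi = ⊥-elim (<⇒≱ hi lo)
  go (suc fuel) m lo hi with W <? 2 * (2 ^ m * w)
  ... | yes lt = m , lo , lt
  ... | no ge = go fuel (suc m) (≤-trans (≤-reflexive (*-assoc 2 (2 ^ m) w)) (≮⇒≥ ge)) (subst (λ n → W < 2 ^ n * w) (sym (+-suc fuel m)) hi)

n²≤2·2^n : ∀ n → n * n ≤ 2 * 2 ^ n
n²≤2·2^n 0 = z≤n
n²≤2·2^n 1 = s≤s z≤n
n²≤2·2^n 2 = m≤m+n 4 4
n²≤2·2^n 3 = m≤m+n 9 7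
n²≤2·2^n (suc (suc (suc (suc m)))) = begin
  (4 + m) * (4 + m) ≤⟨ m≤m+n _ (m * m + 4 * m + 2) ⟩
  (4 + m) * (4 + m) + (m * m + 4 * m + 2) ≡⟨ r1 m ⟩
  2 * ((3 + m) * (3 + m)) ≤⟨ *-monoʳ-≤ 2 (n²≤2·2^n (suc (suc (suc m)))) ⟩
  2 * (2 * 2 ^ (3 + m)) ∎
  where
  open ≤-Reasoning
  r1 : ∀ m → (4 + m) * (4 + m) + (m * m + 4 * m + 2) ≡ 2 * ((3 + m) * (3 + m))
  r1 = solve-∀

-- The logarithm is absorbed here: as `ℓ²` is at most `2 * 2 ^ ℓ`, a ratio of order `c²` suffices
-- for `c * ℓ`.
exponential-beats : ∀ c ℓ → 4 * (c * c) < 2 * 2 ^ ℓ → c * ℓ ≤ 2 ^ ℓ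
exponential-beats c ℓ lt = square-cancel (begin
  (c * ℓ) * (c * ℓ) ≡⟨ r1 c ℓ ⟩
  (c * c) * (ℓ * ℓ) ≤⟨ *-monoʳ-≤ (c * c) (n²≤2·2^n ℓ) ⟩
  (c * c) * (2 * 2 ^ ℓ) ≡⟨ r2 (c * c) (2 ^ ℓ) ⟩
  (2 * (c * c)) * 2 ^ ℓ ≤⟨ *-monoˡ-≤ (2 ^ ℓ) (*-cancelˡ-≤ {2 * (c * c)} {2 ^ ℓ} 2 (≤-trans (≤-reflexive (r3 (c * c))) (<⇒≤ lt))) ⟩
  2 ^ ℓ * 2 ^ ℓ ∎)
  where
  open ≤-Reasoning
  r1 : ∀ c l → (c * l) * (c * l) ≡ (c * c) * (l * l)
  r1 = solve-∀
  r2 : ∀ c p → c * (2 * p) ≡ (2 * c) * p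
  r2 = solve-∀
  r3 : ∀ c → 2 * (2 * c) ≡ 4 * c
  r3 = solve-∀

-- The numerical hypotheses of ExpanderMinor hold as soon as W / w exceeds a constant times Λ⁴.
room-suffices : ∀ k Λ κ w wmax W c → 1 ≤ k → 4 ≤ Λ → 0 < w → wmax ≤ κ * w → 1 ≤ c →
  168 * ((k * k) * (Λ * Λ)) * κ ≤ c → 4 * (c * c) * w ≤ W →
  ∃ λ ℓ → W < 2 * (2 ^ ℓ * w) × 8 * ((2 * Λ + 2) * (k * ((k * (2 * (2 + 2 * (Λ * ℓ))) + 1) * wmax))) ≤ W
room-suffices k Λ κ w wmax W c k-pos 4≤Λ w-pos wmax≤ c-pos c-large W-large = ℓ , hi , (begin
  8 * ((2 * Λ + 2) * (k * ((k * (2 * (2 + 2 * (Λ * ℓ))) + 1) * wmax)))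
    ≤⟨ *-monoʳ-≤ 8 (*-mono-≤ a1 (*-monoʳ-≤ k (*-mono-≤ (+-mono-≤ (*-monoʳ-≤ k a2) a3) wmax≤))) ⟩
  -- `168 = 8 * 3 * 7`, the 7 being `6 + 1` from the two terms of the tree length.
  8 * ((3 * Λ) * (k * ((k * (6 * (Λ * ℓ)) + k * (Λ * ℓ)) * (κ * w)))) ≡⟨ r1 k Λ ℓ κ w ⟩
  168 * ((k * k) * (Λ * Λ)) * κ * ℓ * w ≤⟨ *-monoˡ-≤ w (*-monoˡ-≤ ℓ c-large) ⟩
  c * ℓ * w ≤⟨ *-monoˡ-≤ w (exponential-beats c ℓ c<) ⟩
  2 ^ ℓ * w ≤⟨ lo ⟩
  W ∎)
  where
  open ≤-Reasoning
  instance
    w≢0 : ℕ.NonZero w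
    w≢0 = ℕ.>-nonZero w-pos
  c²-pos : 1 ≤ 4 * (c * c)
  c²-pos = *-mono-≤ {1} {4} (s≤s z≤n) (*-mono-≤ c-pos c-pos)
  log = binary-logarithm W w w-pos (≤-trans (m≤n*m w (4 * (c * c)) {{ℕ.>-nonZero c²-pos}}) W-large)
  ℓ = proj₁ log
  lo = proj₁ (proj₂ log)
  hi = proj₂ (proj₂ log)
  c< : 4 * (c * c) < 2 * 2 ^ ℓ
  c< = *-cancelʳ-< w _ _ (≤-<-trans W-large (<-≤-trans hi (≤-reflexive (sym (*-assoc 2 (2 ^ ℓ) w)))))
  ℓ-pos : 1 ≤ ℓ
  ℓ-pos = positive ℓ c<
    where
    positive : ∀ ℓ → 4 * (c * c) < 2 * 2 ^ ℓ → 1 ≤ ℓ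
    positive (suc ℓ) _ = s≤s z≤n
    positive zero lt = ⊥-elim (<⇒≱ lt (≤-trans (s≤s (s≤s z≤n)) (*-monoʳ-≤ 4 (*-mono-≤ c-pos c-pos))))
  Λℓ≥4 : 4 ≤ Λ * ℓ
  Λℓ≥4 = ≤-trans (≤-reflexive refl) (*-mono-≤ 4≤Λ ℓ-pos)
  a1 : 2 * Λ + 2 ≤ 3 * Λ
  a1 = ≤-trans (+-monoʳ-≤ (2 * Λ) (≤-trans (s≤s (s≤s z≤n)) 4≤Λ)) (≤-reflexive (r2 Λ))
    where
    r2 : ∀ l → 2 * l + l ≡ 3 * l
    r2 = solve-∀
  a2 : 2 * (2 + 2 * (Λ * ℓ)) ≤ 6 * (Λ * ℓ)
  a2 = ≤-trans (≤-reflexive (r2 (Λ * ℓ))) (≤-trans (+-monoˡ-≤ (4 * (Λ * ℓ)) Λℓ≥4) (≤-trans (+-monoˡ-≤ (4 * (Λ * ℓ)) (m≤m+n (Λ * ℓ) (Λ * ℓ))) (≤-reflexive (r3 (Λ * ℓ)))))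
    where
    r2 : ∀ x → 2 * (2 + 2 * x) ≡ 4 + 4 * x
    r2 = solve-∀
    r3 : ∀ x → (x + x) + 4 * x ≡ 6 * x
    r3 = solve-∀
  a3 : 1 ≤ k * (Λ * ℓ)
  a3 = *-mono-≤ k-pos (≤-trans (s≤s z≤n) Λℓ≥4)
  r1 : ∀ k l n κ w → 8 * ((3 * l) * (k * ((k * (6 * (l * n)) + k * (l * n)) * (κ * w)))) ≡ 168 * ((k * k) * (l * l)) * κ * n * w
  r1 = solve-∀

scale-bound : ∀ a k b p c Λ κ → Λ ≤ b * p → κ ≤ c → a * (k * (Λ * Λ)) * κ ≤ a * (k * (b * b)) * c * (p * p)
scale-bound a k b p c Λ κ Λ≤ κ≤ = ≤-trans (*-mono-≤ (*-monoʳ-≤ a (*-monoʳ-≤ k (*-mono-≤ Λ≤ Λ≤))) κ≤) (≤-reflexive (ring a k b p c))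
  where
  ring : ∀ a k b p c → a * (k * ((b * p) * (b * p))) * c ≡ a * (k * (b * b)) * c * (p * p)
  ring = solve-∀

Λ-bound : ∀ a b c p κ → κ ≤ c → a * (b * p) * κ ≤ (a * b * c) * p
Λ-bound a b c p κ κ≤ = ≤-trans (*-monoʳ-≤ (a * (b * p)) κ≤) (≤-reflexive (ring a b c p))
  where
  ring : ∀ a b c p → a * (b * p) * c ≡ (a * b * c) * p
  ring = solve-∀

opaque
  -- `1048576 = 16 * 256 * 256` bounds `Λ / p`, since `Λ = 16 * L * κ` with `L = 256 * p` and
  -- `κ ≤ 256`; the last 256 is `κ` again. The `c` of `room-suffices` is `scale k * p²`, so that
  -- `4 * c²` is `threshold k * p⁴`.
  scale : ℕ → ℕ
  scale k = 168 * ((k * k) * (1048576 * 1048576)) * 256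

  threshold : ℕ → ℕ
  threshold k = 4 * (scale k * scale k)

  threshold-≡ : ∀ k p x → 4 * ((scale k * (p * p)) * (scale k * (p * p))) * x ≡ x * (threshold k * ((p * p) * (p * p)))
  threshold-≡ k p x = ring (scale k) (p * p) x
    where
    ring : ∀ s q x → 4 * ((s * q) * (s * q)) * x ≡ x * (4 * (s * s) * (q * q))
    ring = solve-∀

  scale-pos : ∀ {k} → 1 ≤ k → 1 ≤ scale k
  scale-pos k-pos = *-mono-≤ {1} {_} {1} (*-mono-≤ {1} {168} {1} (s≤s z≤n) (*-mono-≤ {1} {_} {1} (*-mono-≤ k-pos k-pos) (s≤s z≤n))) (s≤s z≤n)

  scale-large : ∀ k p κ → κ ≤ 256 → 168 * ((k * k) * ((16 * (256 * p) * κ) * (16 * (256 * p) * κ))) * κ ≤ scale k * (p * p)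
  scale-large k p κ κ≤ = scale-bound 168 (k * k) 1048576 p 256 (16 * (256 * p) * κ) κ (Λ-bound 16 256 256 p κ κ≤) κ≤

-- Edge orbits

-- The group acts on Fin N; the graph E is the orbit of one edge (v₀ , v₁), and vertex sets are measured
-- by the number of translates of v₀ and v₁ that they contain.
module EdgeOrbit {K N : ℕ} (𝔾 : SimpleGroup K) (act : Fin K → Fin N → Fin N)
  (act-e : ∀ v → act (SimpleGroup.e 𝔾) v ≡ v)
  (act-∙ : ∀ g h v → act (SimpleGroup._∙_ 𝔾 g h) v ≡ act g (act h v))
  (v₀ v₁ : Fin N) (v₀≢v₁ : v₀ ≢ v₁)
  where
  open SimpleGroup 𝔾

  E : Fin N → Fin N → Set
  E u v = ∃ λ g → (u ≡ act g v₀ × v ≡ act g v₁) ⊎ (u ≡ act g v₁ × v ≡ act g v₀)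

  E? : ∀ u v → Dec (E u v)
  E? u v = any? (λ g → ((u ≟ act g v₀) ×-dec (v ≟ act g v₁)) ⊎-dec ((u ≟ act g v₁) ×-dec (v ≟ act g v₀)))

  E-sym : ∀ {u v} → E u v → E v u
  E-sym (g , inj₁ (p , q)) = g , inj₂ (q , p)
  E-sym (g , inj₂ (p , q)) = g , inj₁ (q , p)

  E-act : ∀ g {u v} → E u v → E (act g u) (act g v)
  E-act g (h , inj₁ (p , q)) = g ∙ h , inj₁ (trans (cong (act g) p) (sym (act-∙ g h v₀)) , trans (cong (act g) q) (sym (act-∙ g h v₁)))
  E-act g (h , inj₂ (p , q)) = g ∙ h , inj₂ (trans (cong (act g) p) (sym (act-∙ g h v₁)) , trans (cong (act g) q) (sym (act-∙ g h v₀)))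

  R : ℕ → Fin N → Fin N → Set
  R = Reach E

  R? : ∀ n x y → Dec (R n x y)
  R? = reach? E?

  R-sym : ∀ {n x y} → R n x y → R n y x
  R-sym = reach-sym E-sym

  R-act : ∀ g {n x y} → R n x y → R n (act g x) (act g y)
  R-act g = reach-map (act g) (E-act g)

  act-inv : ∀ g v → act (inv g) (act g v) ≡ v
  act-inv g v = trans (sym (act-∙ (inv g) g v)) (trans (cong (λ h → act h v) (invˡ g)) (act-e v))

  R-act⁻ : ∀ g {n x y} → R n (act g x) (act g y) → R n x y
  R-act⁻ g {n} p = subst₂ (R n) (act-inv g _) (act-inv g _) (R-act (inv g) p)

  Translate : Fin N → Set
  Translate v = ∃ λ g → v ≡ act g v₀ ⊎ v ≡ act g v₁

  E-translate : ∀ {u v} → E u v → Translate u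
  E-translate (g , inj₁ (p , _)) = g , inj₁ p
  E-translate (g , inj₂ (p , _)) = g , inj₂ p

  v₀~v₁ : E v₀ v₁
  v₀~v₁ = e , inj₁ (sym (act-e v₀) , sym (act-e v₁))

  Set′ : Set
  Set′ = Fin N → Bool

  orb : Fin N → Set′ → ℕ
  orb v p = count (λ g → p (act g v))

  wt : Set′ → ℕ
  wt p = orb v₀ p + orb v₁ p

  pts : Fin (K + K) → Fin N
  pts i = [ (λ g → act g v₀) , (λ g → act g v₁) ]′ (Fin.splitAt K i)

  count-pts : ∀ p → count (p ∘ pts) ≡ wt p
  count-pts p = trans (Σℕ-splitAt K (λ i → 𝟙 (p (pts i)))) (cong₂ _+_
    (Σℕ-cong (λ g → cong (λ s → 𝟙 (p ([ (λ g → act g v₀) , (λ g → act g v₁) ]′ s))) (Finₚ.splitAt-↑ˡ K g K)))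
    (Σℕ-cong (λ g → cong (λ s → 𝟙 (p ([ (λ g → act g v₀) , (λ g → act g v₁) ]′ s))) (Finₚ.splitAt-↑ʳ K K g))))

  translate-pts : ∀ {v} → Translate v → ∃ λ i → v ≡ pts i
  translate-pts (g , inj₁ p) = g Fin.↑ˡ K , trans p (cong [ (λ g → act g v₀) , (λ g → act g v₁) ]′ (sym (Finₚ.splitAt-↑ˡ K g K)))
  translate-pts (g , inj₂ p) = K Fin.↑ʳ g , trans p (cong [ (λ g → act g v₀) , (λ g → act g v₁) ]′ (sym (Finₚ.splitAt-↑ʳ K K g)))

  orb-mono : ∀ v {p p′ : Set′} → (∀ u → p u ≡ true → p′ u ≡ true) → orb v p ≤ orb v p′
  orb-mono v h = count-mono (λ g → h (act g v))

  wt-mono : ∀ {p p′ : Set′} → (∀ u → p u ≡ true → p′ u ≡ true) → wt p ≤ wt p′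
  wt-mono {p} {p′} h = +-mono-≤ (orb-mono v₀ {p} {p′} h) (orb-mono v₁ {p} {p′} h)

  orb-act : ∀ g v p → orb (act g v) p ≡ orb v p
  orb-act g v p = trans (Σℕ-cong (λ h → cong (λ u → 𝟙 (p u)) (sym (act-∙ h g v)))) (Σℕ-right g (λ h → 𝟙 (p (act h v))))

  orb-shift : ∀ g v p → orb v (λ u → p (act g u)) ≡ orb v p
  orb-shift g v p = trans (Σℕ-cong (λ h → cong (λ u → 𝟙 (p u)) (sym (act-∙ g h v)))) (Σℕ-left g (λ h → 𝟙 (p (act h v))))

  orb≤wt : ∀ {v} → Translate v → ∀ p → orb v p ≤ wt p
  orb≤wt (g , inj₁ refl) p = ≤-trans (≤-reflexive (orb-act g v₀ p)) (m≤m+n _ _)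
  orb≤wt (g , inj₂ refl) p = ≤-trans (≤-reflexive (orb-act g v₁ p)) (m≤n+m _ _)

  Bl : ℕ → Fin N → Set′
  Bl n v u = ⌊ R? n v u ⌋

  wt-ball-act : ∀ n g v → wt (Bl n (act g v)) ≡ wt (Bl n v)
  wt-ball-act n g v = cong₂ _+_ (same v₀) (same v₁)
    where
    same : ∀ w → orb w (Bl n (act g v)) ≡ orb w (Bl n v)
    same w = trans (sym (orb-shift g w (Bl n (act g v)))) (Σℕ-cong (λ h → cong 𝟙 (iff (act h w))))
      where
      iff : ∀ u → Bl n (act g v) (act g u) ≡ Bl n v u
      iff u with R? n v u
      ... | yes p = ⇒true (R? n (act g v) (act g u)) (R-act g p)
      ... | no ¬p = ¬⇒false (R? n (act g v) (act g u)) (λ p → ¬p (R-act⁻ g p))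

  f : ℕ → ℕ
  f n = wt (Bl n v₀)

  -- The two orbits of vertices may have different balls, but `v₀` and `v₁` are adjacent: one more
  -- step compares every ball with one around `v₀`.
  ball≤f : ∀ n {v} → Translate v → wt (Bl n v) ≤ f (suc n)
  ball≤f n (g , inj₁ refl) = ≤-trans (≤-reflexive (wt-ball-act n g v₀)) (wt-mono {Bl n v₀} {Bl (suc n) v₀} (λ u p → ⇒true (R? (suc n) v₀ u) (reach-mono (n≤1+n n) (true⇒ (R? n v₀ u) p))))
  ball≤f n (g , inj₂ refl) = ≤-trans (≤-reflexive (wt-ball-act n g v₁)) (wt-mono {Bl n v₁} {Bl (suc n) v₀} (λ u p → ⇒true (R? (suc n) v₀ u) (hop v₀~v₁ (true⇒ (R? n v₁ u) p))))

  f≤ball : ∀ n {v} → Translate v → f n ≤ wt (Bl (suc n) v)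
  f≤ball n (g , inj₁ refl) = ≤-trans (wt-mono {Bl n v₀} {Bl (suc n) v₀} (λ u p → ⇒true (R? (suc n) v₀ u) (reach-mono (n≤1+n n) (true⇒ (R? n v₀ u) p)))) (≤-reflexive (sym (wt-ball-act (suc n) g v₀)))
  f≤ball n (g , inj₂ refl) = ≤-trans (wt-mono {Bl n v₀} {Bl (suc n) v₁} (λ u p → ⇒true (R? (suc n) v₁ u) (hop (E-sym v₀~v₁) (true⇒ (R? n v₀ u) p)))) (≤-reflexive (sym (wt-ball-act (suc n) g v₁)))

  t₀ : Translate v₀
  t₀ = e , inj₁ (sym (act-e v₀))

  t₁ : Translate v₁
  t₁ = e , inj₂ (sym (act-e v₁))

  translate-act : ∀ {v} → Translate v → ∀ h → Translate (act h v)
  translate-act (g , inj₁ p) h = h ∙ g , inj₁ (trans (cong (act h) p) (sym (act-∙ h g v₀)))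
  translate-act (g , inj₂ p) h = h ∙ g , inj₂ (trans (cong (act h) p) (sym (act-∙ h g v₁)))

  -- A random translate of a chain from C to D must cross Y.
  module Crossing (C D Y : Set′) (disjoint : ∀ v → C v ≡ true → D v ≡ false) (ρ : ℕ)
    (cross : ∀ {x y} → D x ≡ true → R ρ x y → D y ≡ true ⊎ (Y x ≡ true ⊎ Y y ≡ true)) where

    crossings : ∀ {L x y} → Reach (R ρ) L x y → Translate x →
      count (λ g → D (act g x) ∧ C (act g y)) ≤ L * (2 * wt Y)
    crossings stay tx = ≤-trans (≤-reflexive (Σℕ-zero (λ g → none (D (act g _)) (C (act g _)) (disjoint (act g _))))) z≤n
      where
      none : ∀ d c → (c ≡ true → d ≡ false) → 𝟙 (d ∧ c) ≡ 0
      none false c h = refl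
      none true false h = refl
      none true true h = ⊥-elim (true≢false refl (h refl))
    crossings {suc L} {x} {z} (hop {y = y} p chain) tx = begin
      count (λ g → D (act g x) ∧ C (act g z)) ≤⟨ Σℕ-mono (λ g → one (D (act g x)) (C (act g z)) (D (act g y)) (Y (act g x)) (Y (act g y)) (λ d → cross d (R-act g p))) ⟩
      Σℕ (λ g → (𝟙 (Y (act g x)) + 𝟙 (Y (act g y))) + 𝟙 (D (act g y) ∧ C (act g z))) ≡⟨ trans (Σℕ-+ _ _) (cong (_+ count (λ g → D (act g y) ∧ C (act g z))) (Σℕ-+ _ _)) ⟩
      (orb x Y + orb y Y) + count (λ g → D (act g y) ∧ C (act g z)) ≤⟨ +-mono-≤ (+-mono-≤ (orb≤wt tx Y) (orb≤wt ty Y)) (crossings chain ty) ⟩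
      (wt Y + wt Y) + L * (2 * wt Y) ≡⟨ cong (_+ L * (2 * wt Y)) (cong (wt Y +_) (sym (+-identityʳ (wt Y)))) ⟩
      suc L * (2 * wt Y) ∎
      where
      open ≤-Reasoning
      ty : Translate y
      ty = reach-closed Translate (λ e _ → E-translate (E-sym e)) p tx
      one : ∀ d c d′ a b → (d ≡ true → d′ ≡ true ⊎ (a ≡ true ⊎ b ≡ true)) → 𝟙 (d ∧ c) ≤ (𝟙 a + 𝟙 b) + 𝟙 (d′ ∧ c)
      one false c d′ a b h = z≤n
      one true false d′ a b h = z≤n
      one true true d′ a b h with h refl
      ... | inj₁ refl = m≤n+m 1 (𝟙 a + 𝟙 b)
      ... | inj₂ (inj₁ refl) = s≤s z≤n
      ... | inj₂ (inj₂ refl) = ≤-trans (m≤n+m 1 (𝟙 a)) (m≤m+n _ _)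

    module _ (L : ℕ) (chain : ∀ {x y} → Translate x → Translate y → Reach (R ρ) L x y) where

      -- Writing the second element as `g ∙ h` turns each pair into the translate by `g` of a chain
      -- from `a` to `act h b` that does not depend on `g`.
      pairs : ∀ {a b} → Translate a → Translate b → orb a D * orb b C ≤ K * (L * (2 * wt Y))
      pairs {a} {b} ta tb = begin
        orb a D * orb b C ≡⟨ Σℕ-*Σℕ _ _ ⟩
        Σℕ (λ g → Σℕ (λ h → 𝟙 (D (act g a)) * 𝟙 (C (act h b)))) ≡⟨ Σℕ-cong (λ g → sym (Σℕ-left g (λ h → 𝟙 (D (act g a)) * 𝟙 (C (act h b))))) ⟩
        Σℕ (λ g → Σℕ (λ h → 𝟙 (D (act g a)) * 𝟙 (C (act (g ∙ h) b)))) ≡⟨ Σℕ-comm (λ g h → 𝟙 (D (act g a)) * 𝟙 (C (act (g ∙ h) b))) ⟩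
        Σℕ (λ h → Σℕ (λ g → 𝟙 (D (act g a)) * 𝟙 (C (act (g ∙ h) b)))) ≡⟨ Σℕ-cong (λ h → Σℕ-cong (λ g → trans (cong (λ u → 𝟙 (D (act g a)) * 𝟙 (C u)) (act-∙ g h b)) (conj-𝟙 (D (act g a)) (C (act g (act h b)))))) ⟩
        Σℕ (λ h → count (λ g → D (act g a) ∧ C (act g (act h b)))) ≤⟨ Σℕ-mono (λ h → crossings (chain ta (translate-act tb h)) ta) ⟩
        Σℕ {K} (λ h → L * (2 * wt Y)) ≡⟨ Σℕ-const K _ ⟩
        K * (L * (2 * wt Y)) ∎
        where
        open ≤-Reasoning
        conj-𝟙 : ∀ x y → 𝟙 x * 𝟙 y ≡ 𝟙 (x ∧ y)
        conj-𝟙 true y = +-identityʳ (𝟙 y)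
        conj-𝟙 false y = refl

      isoperimetric : 0 < K → K + K ≤ 4 * wt C → wt D ≤ 16 * L * wt Y
      isoperimetric K-pos half = *-cancelˡ-≤ (2 * K) {{ℕ.>-nonZero (*-mono-≤ {1} {2} (s≤s z≤n) K-pos)}} (begin
        2 * K * wt D ≡⟨ r1 K (wt D) ⟩
        (K + K) * wt D ≤⟨ *-monoˡ-≤ (wt D) half ⟩
        4 * wt C * wt D ≡⟨ r2 (orb v₀ C) (orb v₁ C) (orb v₀ D) (orb v₁ D) ⟩
        4 * ((orb v₀ D * orb v₀ C + orb v₀ D * orb v₁ C) + (orb v₁ D * orb v₀ C + orb v₁ D * orb v₁ C)) ≤⟨ *-monoʳ-≤ 4 (+-mono-≤ (+-mono-≤ (pairs t₀ t₀) (pairs t₀ t₁)) (+-mono-≤ (pairs t₁ t₀) (pairs t₁ t₁))) ⟩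
        4 * ((p + p) + (p + p)) ≡⟨ r3 K L (wt Y) ⟩
        2 * K * (16 * L * wt Y) ∎)
        where
        open ≤-Reasoning
        p = K * (L * (2 * wt Y))
        r1 : ∀ k d → 2 * k * d ≡ (k + k) * d
        r1 = solve-∀
        r2 : ∀ a b c d → 4 * (a + b) * (c + d) ≡ 4 * ((c * a + c * b) + (d * a + d * b))
        r2 = solve-∀
        r3 : ∀ k l y → 4 * ((k * (l * (2 * y)) + k * (l * (2 * y))) + (k * (l * (2 * y)) + k * (l * (2 * y)))) ≡ 2 * k * (16 * l * y)
        r3 = solve-∀

  Chained : ℕ → ℕ → Set
  Chained ρ L = ∀ {x y} → Translate x → Translate y → Reach (R ρ) L x y

  module Partition (c : Fin N → Fin N) (fibre : ∀ u v → c u ≡ c v → Star (λ x y → E x y × c y ≡ c u) u v) (K-pos : 0 < K) where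

    H : Fin N → Fin N → Set
    H a b = a ≢ b × ∃₂ λ u v → c u ≡ a × c v ≡ b × E u v

    H? : ∀ a b → Dec (H a b)
    H? a b = ¬? (a ≟ b) ×-dec any? (λ u → any? (λ v → (c u ≟ a) ×-dec (c v ≟ b) ×-dec E? u v))

    H-sym : ∀ {a b} → H a b → H b a
    H-sym (ne , u , v , p , q , r) = ne ∘ sym , v , u , q , p , E-sym r

    -- The links of a chain are walks of up to `ρ` steps and can leap over a separating cell. The
    -- barrier `Y` is therefore a thickening of the separator, at a cost of `κ` in measure.
    Crossable : ℕ → ℕ → Set
    Crossable κ ρ = ∀ (C D : Set′) → (∀ v → C v ≡ true → D v ≡ false) → (∀ u v → C u ≡ true → D v ≡ true → ¬ H u v) →
      ∃ λ (Y : Set′) → wt Y ≤ κ * wt (λ v → not (C (c v)) ∧ not (D (c v))) ×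
        (∀ {x y} → D (c x) ≡ true → R ρ x y → D (c y) ≡ true ⊎ (Y x ≡ true ⊎ Y y ≡ true))

    -- Here `Λ = 16 * L * κ`: `isoperimetric` loses `16 * L` and the barrier loses `κ`.
    level : ∀ {κ ρ L k w₁ wmax ℓ} → 1 ≤ κ → 1 ≤ L → Chained ρ L → Crossable κ ρ →
      (∀ v → wt (λ u → ⌊ v ≟ c u ⌋) ≤ wmax) →
      (∀ {u v} → E u v → c u ≢ c v → w₁ ≤ wt (λ x → ⌊ c u ≟ c x ⌋ ∨ ⌊ c v ≟ c x ⌋)) →
      K + K < 2 * (2 ^ ℓ * w₁) →
      8 * ((2 * (16 * L * κ) + 2) * (k * ((k * (2 * (2 + 2 * ((16 * L * κ) * ℓ))) + 1) * wmax))) ≤ K + K → CliqueModel E k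
    level {κ} {ρ} {L} {k} {w₁} {wmax} {ℓ} κ-pos L-pos chain crossable wmax-ok w₁-ok ℓ-ok room =
      pull-back c fibre (λ { (_ , r) → r }) (proj₁ result) (λ i → let (j , eq) = proj₂ result i in pts j , sym eq)
      where
      iso : ∀ (C D : Set′) → (∀ v → C v ≡ true → D v ≡ false) → (∀ u v → C u ≡ true → D v ≡ true → ¬ H u v) →
        K + K ≤ 4 * count (C ∘ c ∘ pts) → count (D ∘ c ∘ pts) ≤ 16 * L * κ * count (λ i → not (C (c (pts i))) ∧ not (D (c (pts i))))
      iso C D disjoint apart half = let (Y , small , cross) = crossable C D disjoint apart in begin
        count (D ∘ c ∘ pts) ≡⟨ count-pts (D ∘ c) ⟩
        wt (D ∘ c) ≤⟨ Crossing.isoperimetric (C ∘ c) (D ∘ c) Y (λ v → disjoint (c v)) ρ cross L chain K-pos (subst (λ n → K + K ≤ 4 * n) (count-pts (C ∘ c)) half) ⟩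
        16 * L * wt Y ≤⟨ *-monoʳ-≤ (16 * L) small ⟩
        16 * L * (κ * wt (λ v → not (C (c v)) ∧ not (D (c v)))) ≡⟨ sym (*-assoc (16 * L) κ _) ⟩
        16 * L * κ * wt (λ v → not (C (c v)) ∧ not (D (c v))) ≡⟨ cong (16 * L * κ *_) (sym (count-pts (λ v → not (C (c v)) ∧ not (D (c v))))) ⟩
        16 * L * κ * count (λ i → not (C (c (pts i))) ∧ not (D (c (pts i)))) ∎
        where open ≤-Reasoning
      result : Σ (CliqueModel H k) λ m → ∀ i → ∃ λ j → CliqueModel.root m i ≡ c (pts j)
      result = ExpanderMinor.clique-model (c ∘ pts) H H? H-sym k (16 * L * κ) ℓ w₁ wmax
        (*-mono-≤ {4} {16 * L} {1} (*-mono-≤ {4} {16} {1} (m≤m+n 4 12) L-pos) κ-pos)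
        (≤-trans K-pos (m≤m+n K K))
        (λ v → ≤-trans (≤-reflexive (count-pts (λ u → ⌊ v ≟ c u ⌋))) (wmax-ok v))
        (λ { (_ , u , v , p , _ , r) → let (j , eq) = translate-pts (E-translate r) in j , trans (sym p) (cong c eq) })
        (λ { {a} {b} (ne , u , v , refl , refl , r) → ≤-trans (w₁-ok r ne) (≤-reflexive (sym (count-pts (λ x → ⌊ c u ≟ c x ⌋ ∨ ⌊ c v ≟ c x ⌋)))) })
        ℓ-ok iso room

  translate? : ∀ v → Dec (Translate v)
  translate? v = any? (λ g → (v ≟ act g v₀) ⊎-dec (v ≟ act g v₁))

  R-translate : ∀ {n u v} → R n u v → Translate u → Translate v
  R-translate = reach-closed Translate (λ r _ → E-translate (E-sym r))

  wt-Σ : ∀ {m} (h : Fin m → ℕ) (p : Fin m → Set′) → Σℕ (λ z → h z * wt (p z)) ≡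
    Σℕ (λ g → Σℕ (λ z → h z * 𝟙 (p z (act g v₀)))) + Σℕ (λ g → Σℕ (λ z → h z * 𝟙 (p z (act g v₁))))
  wt-Σ h p = trans (Σℕ-cong (λ z → *-distribˡ-+ (h z) (orb v₀ (p z)) (orb v₁ (p z)))) (trans (Σℕ-+ _ _) (cong₂ _+_ (part′ v₀) (part′ v₁)))
    where
    part′ : ∀ v → Σℕ (λ z → h z * orb v (p z)) ≡ Σℕ (λ g → Σℕ (λ z → h z * 𝟙 (p z (act g v))))
    part′ v = trans (Σℕ-cong (λ z → sym (Σℕ-*ˡ (h z) (λ g → 𝟙 (p z (act g v)))))) (Σℕ-comm (λ z g → h z * 𝟙 (p z (act g v))))

  module CellLevel (K-pos : 0 < K) (n n′ κ : ℕ) (3r : 3 * suc n + 1 ≤ n′) (doubling : f n′ ≤ κ * f n) where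

    open Cells (Voronoi.cells E? E-sym (suc n))
    open Partition c c-fibre K-pos

    r : ℕ
    r = suc n

    cell⊇ball : ∀ v u → R r u (c v) → c u ≡ c v
    cell⊇ball v u = c-local u v

    c-translate : ∀ {u} → Translate u → Translate (c u)
    c-translate = R-translate (c-near _)

    cell-large : ∀ {z v} → z ≡ c v → Translate z → f n ≤ wt (λ u → ⌊ z ≟ c u ⌋)
    cell-large {v = v} refl t = ≤-trans (f≤ball n t) (wt-mono {Bl r (c v)} {λ u → ⌊ c v ≟ c u ⌋}
      (λ u p → ⇒true (c v ≟ c u) (sym (cell⊇ball v u (R-sym (true⇒ (R? r (c v) u) p))))))

    -- `Y` is the `r`-neighbourhood of the separating cells. It is covered by balls of radius
    -- `3 * r` around their centres, whereas the cells contain balls of radius `r`, and `doubling`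
    -- compares the two. A walk of at most `r` steps leaving `D` passes through a separating cell,
    -- because cells of `C` and `D` are not adjacent.
    crossable : Crossable κ r
    crossable C D disjoint apart = Y , thin , cross
      where
      X : Set′
      X v = not (C v) ∧ not (D v)
      Y : Set′
      Y x = ⌊ any? (λ w → R? r x w ×-dec true? (X (c w))) ⌋
      -- Only translates have balls bounded by `f`, so other centres are given coefficient 0; no
      -- walk from a translate reaches them.
      S : Fin N → ℕ
      S z = 𝟙 (X z) * 𝟙 ⌊ any? (λ w → (z ≟ c w) ×-dec translate? z) ⌋
      Y-cover : ∀ v → Translate v → 𝟙 (Y v) ≤ Σℕ (λ z → S z * 𝟙 (Bl (3 * r) z v))
      Y-cover v t = cover (any? (λ w → R? r v w ×-dec true? (X (c w))))
        where
        cover : ∀ d → 𝟙 ⌊ d ⌋ ≤ Σℕ (λ z → S z * 𝟙 (Bl (3 * r) z v))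
        cover (no _) = z≤n
        cover (yes (w , p , Xw)) = ≤-trans (≤-reflexive (sym one)) (term≤Σℕ (λ z → S z * 𝟙 (Bl (3 * r) z v)) (c w))
          where
          to-c : R (3 * r) v (c w)
          to-c = reach-trans p (c-near w)
          one : S (c w) * 𝟙 (Bl (3 * r) (c w) v) ≡ 1
          one = cong₂ _*_ (cong₂ _*_ (𝟙-true Xw) (𝟙-true (⇒true (any? (λ w′ → (c w ≟ c w′) ×-dec translate? (c w))) (w , refl , R-translate to-c t))))
            (𝟙-true (⇒true (R? (3 * r) (c w) v) (R-sym to-c)))
      each : ∀ z → S z * wt (Bl (3 * r) z) ≤ κ * (𝟙 (X z) * wt (λ u → ⌊ z ≟ c u ⌋))
      each z = bound (any? (λ w → (z ≟ c w) ×-dec translate? z))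
        where
        bound : ∀ d → 𝟙 (X z) * 𝟙 ⌊ d ⌋ * wt (Bl (3 * r) z) ≤ κ * (𝟙 (X z) * wt (λ u → ⌊ z ≟ c u ⌋))
        bound (no _) = ≤-trans (≤-reflexive (cong (_* wt (Bl (3 * r) z)) (*-zeroʳ (𝟙 (X z))))) z≤n
        bound (yes (w , z≡ , t)) = begin
          𝟙 (X z) * 1 * wt (Bl (3 * r) z) ≡⟨ cong (_* wt (Bl (3 * r) z)) (*-identityʳ (𝟙 (X z))) ⟩
          𝟙 (X z) * wt (Bl (3 * r) z) ≤⟨ *-monoʳ-≤ (𝟙 (X z)) (≤-trans (ball≤f (3 * r) t) (≤-trans f-mono (≤-trans doubling (*-monoʳ-≤ κ (cell-large z≡ t))))) ⟩
          𝟙 (X z) * (κ * wt (λ u → ⌊ z ≟ c u ⌋)) ≡⟨ swap (𝟙 (X z)) κ _ ⟩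
          κ * (𝟙 (X z) * wt (λ u → ⌊ z ≟ c u ⌋)) ∎
          where
          open ≤-Reasoning
          swap : ∀ a b c → a * (b * c) ≡ b * (a * c)
          swap = solve-∀
          f-mono : f (suc (3 * r)) ≤ f n′
          f-mono = wt-mono {Bl (suc (3 * r)) v₀} {Bl n′ v₀} (λ u p → ⇒true (R? n′ v₀ u) (reach-mono (≤-trans (≤-reflexive (+-comm 1 (3 * r))) 3r) (true⇒ (R? (suc (3 * r)) v₀ u) p)))
      thin : wt Y ≤ κ * wt (X ∘ c)
      thin = begin
        wt Y ≤⟨ +-mono-≤ (Σℕ-mono (λ g → Y-cover _ (g , inj₁ refl))) (Σℕ-mono (λ g → Y-cover _ (g , inj₂ refl))) ⟩
        Σℕ (λ g → Σℕ (λ z → S z * 𝟙 (Bl (3 * r) z (act g v₀)))) + Σℕ (λ g → Σℕ (λ z → S z * 𝟙 (Bl (3 * r) z (act g v₁)))) ≡⟨ sym (wt-Σ S (Bl (3 * r))) ⟩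
        Σℕ (λ z → S z * wt (Bl (3 * r) z)) ≤⟨ Σℕ-mono each ⟩
        Σℕ (λ z → κ * (𝟙 (X z) * wt (λ u → ⌊ z ≟ c u ⌋))) ≡⟨ Σℕ-*ˡ κ _ ⟩
        κ * Σℕ (λ z → 𝟙 (X z) * wt (λ u → ⌊ z ≟ c u ⌋)) ≡⟨ cong (κ *_) (trans (wt-Σ (λ z → 𝟙 (X z)) (λ z u → ⌊ z ≟ c u ⌋)) (cong₂ _+_ (Σℕ-cong (λ g → Σℕ-δ (λ z → 𝟙 (X z)) (c (act g v₀)))) (Σℕ-cong (λ g → Σℕ-δ (λ z → 𝟙 (X z)) (c (act g v₁)))))) ⟩
        κ * wt (X ∘ c) ∎
        where open ≤-Reasoning
      cross : ∀ {x y} → D (c x) ≡ true → R r x y → D (c y) ≡ true ⊎ (Y x ≡ true ⊎ Y y ≡ true)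
      cross {x} {y} Dx p = decide (any? (λ w → R? r x w ×-dec true? (X (c w)))) refl
        where
        walk : (∀ w → R r x w → ¬ (X (c w) ≡ true)) → ∀ {i j z} → i + j ≤ r → R i x z → D (c z) ≡ true → R j z y → D (c y) ≡ true
        walk free le xz Dz stay = Dz
        walk free {i} {suc j} {z} le xz Dz (hop {y = z′} h q) = walk free {i + 1} {j} (≤-trans (≤-reflexive (+-assoc i 1 j)) le) xz′ (next (D (c z′)) (C (c z′)) refl refl) q
          where
          xz′ : R (i + 1) x z′
          xz′ = reach-trans xz (hop {n = 0} h stay)
          next : ∀ d k → D (c z′) ≡ d → C (c z′) ≡ k → D (c z′) ≡ true
          next true _ d _ = d
          next false false d k = ⊥-elim (free z′ (reach-mono (≤-trans (+-monoʳ-≤ i (s≤s z≤n)) le) xz′) (true-∧ (true-not k) (true-not d)))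
          next false true d k with c z ≟ c z′
          ... | yes eq = subst (λ t → D t ≡ true) eq Dz
          ... | no ne = ⊥-elim (apart (c z′) (c z) k Dz (ne ∘ sym , z′ , z , refl , refl , E-sym h))
        decide : ∀ d → ⌊ d ⌋ ≡ Y x → D (c y) ≡ true ⊎ (Y x ≡ true ⊎ Y y ≡ true)
        decide (yes _) eq = inj₂ (inj₁ (sym eq))
        decide (no none) eq = inj₁ (walk (λ w q Xw → none (w , q , Xw)) {0} ≤-refl stay Dx p)

    wmax-ok : ∀ v → wt (λ u → ⌊ v ≟ c u ⌋) ≤ κ * f n
    wmax-ok v = bound (translate? v)
      where
      bound : Dec (Translate v) → wt (λ u → ⌊ v ≟ c u ⌋) ≤ κ * f n
      bound (yes t) = ≤-trans (wt-mono {λ u → ⌊ v ≟ c u ⌋} {Bl (2 * r) v} (λ u p → ⇒true (R? (2 * r) v u) (R-sym (subst (R (2 * r) u) (sym (true⇒ (v ≟ c u) p)) (c-near u)))))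
        (≤-trans (ball≤f (2 * r) t) (≤-trans (wt-mono {Bl (suc (2 * r)) v₀} {Bl n′ v₀} (λ u p → ⇒true (R? n′ v₀ u) (reach-mono le (true⇒ (R? (suc (2 * r)) v₀ u) p)))) doubling))
        where
        le : suc (2 * r) ≤ n′
        le = ≤-trans (≤-trans (≤-reflexive (+-comm 1 (2 * r))) (+-monoˡ-≤ 1 (*-monoˡ-≤ r (m≤m+n 2 1)))) 3r
      bound (no ¬t) = ≤-trans (≤-reflexive (cong₂ _+_ (Σℕ-zero (λ g → zero-at (act g v₀) (g , inj₁ refl))) (Σℕ-zero (λ g → zero-at (act g v₁) (g , inj₂ refl))))) z≤n
        where
        zero-at : ∀ u → Translate u → 𝟙 ⌊ v ≟ c u ⌋ ≡ 0
        zero-at u t = cong 𝟙 (¬⇒false (v ≟ c u) (λ eq → ¬t (subst Translate (sym eq) (c-translate t))))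

    w₁-ok : ∀ {u v} → E u v → c u ≢ c v → f n ≤ wt (λ x → ⌊ c u ≟ c x ⌋ ∨ ⌊ c v ≟ c x ⌋)
    w₁-ok {u} {v} h _ = ≤-trans (cell-large refl (c-translate (E-translate h))) (wt-mono {λ x → ⌊ c u ≟ c x ⌋} {λ x → ⌊ c u ≟ c x ⌋ ∨ ⌊ c v ≟ c x ⌋} (λ x p → true-∨ˡ p))

  singleton-fibre : ∀ u v → u ≡ v → Star (λ x y → E x y × y ≡ u) u v
  singleton-fibre u .u refl = ε

  module VertexLevel (K-pos : 0 < K) where

    open Partition id singleton-fibre K-pos

    -- Every edge is a translate of the first one, so its two ends together weigh at least `w`,
    -- although a single end may have almost none of it. This is why growth in `ExpanderMinor`
    -- starts from an edge.
    w : ℕ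
    w = wt (λ u → ⌊ v₀ ≟ u ⌋) + wt (λ u → ⌊ v₁ ≟ u ⌋)

    crossable : Crossable 1 1
    crossable C D disjoint apart = X , ≤-reflexive (sym (*-identityˡ (wt X))) , λ Dx p → cross Dx p
      where
      X : Set′
      X v = not (C v) ∧ not (D v)
      cross : ∀ {x y} → D x ≡ true → R 1 x y → D y ≡ true ⊎ (X x ≡ true ⊎ X y ≡ true)
      cross Dx stay = inj₁ Dx
      cross {x} {y} Dx (hop h stay) = next (D y) (C y) refl refl
        where
        next : ∀ d k → D y ≡ d → C y ≡ k → D y ≡ true ⊎ (X x ≡ true ⊎ X y ≡ true)
        next true _ d _ = inj₁ d
        next false false d k = inj₂ (inj₂ (true-∧ (true-not k) (true-not d)))
        next false true d k with x ≟ y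
        ... | yes refl = inj₁ Dx
        ... | no ne = ⊥-elim (apart y x k Dx (ne ∘ sym , y , x , refl , refl , E-sym h))

    point-act : ∀ g v → wt (λ u → ⌊ act g v ≟ u ⌋) ≡ wt (λ u → ⌊ v ≟ u ⌋)
    point-act g v = cong₂ _+_ (same v₀) (same v₁)
      where
      same : ∀ z → orb z (λ u → ⌊ act g v ≟ u ⌋) ≡ orb z (λ u → ⌊ v ≟ u ⌋)
      same z = trans (sym (orb-shift g z (λ u → ⌊ act g v ≟ u ⌋))) (Σℕ-cong (λ h → cong 𝟙 (iff (act h z))))
        where
        iff : ∀ u → ⌊ act g v ≟ act g u ⌋ ≡ ⌊ v ≟ u ⌋
        iff u with v ≟ u
        ... | yes eq = ⇒true (act g v ≟ act g u) (cong (act g) eq)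
        ... | no ne = ¬⇒false (act g v ≟ act g u) (λ eq → ne (trans (sym (act-inv g v)) (trans (cong (act (inv g)) eq) (act-inv g u))))

    wmax-ok : ∀ v → wt (λ u → ⌊ v ≟ u ⌋) ≤ w
    wmax-ok v = bound (translate? v)
      where
      bound : Dec (Translate v) → wt (λ u → ⌊ v ≟ u ⌋) ≤ w
      bound (yes (g , inj₁ refl)) = ≤-trans (≤-reflexive (point-act g v₀)) (m≤m+n _ _)
      bound (yes (g , inj₂ refl)) = ≤-trans (≤-reflexive (point-act g v₁)) (m≤n+m (wt (λ u → ⌊ v₁ ≟ u ⌋)) (wt (λ u → ⌊ v₀ ≟ u ⌋)))
      bound (no ¬t) = ≤-trans (≤-reflexive (cong₂ _+_ (Σℕ-zero (λ g → zero-at (act g v₀) (g , inj₁ refl))) (Σℕ-zero (λ g → zero-at (act g v₁) (g , inj₂ refl))))) z≤n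
        where
        zero-at : ∀ u → Translate u → 𝟙 ⌊ v ≟ u ⌋ ≡ 0
        zero-at u t = cong 𝟙 (¬⇒false (v ≟ u) (λ eq → ¬t (subst Translate (sym eq) t)))

    join : ∀ {a b} → a ≢ b → wt (λ u → ⌊ a ≟ u ⌋) + wt (λ u → ⌊ b ≟ u ⌋) ≤ wt (λ u → ⌊ a ≟ u ⌋ ∨ ⌊ b ≟ u ⌋)
    join {a} {b} a≢b = ≤-trans (≤-reflexive (r (orb v₀ (λ u → ⌊ a ≟ u ⌋)) (orb v₁ (λ u → ⌊ a ≟ u ⌋)) (orb v₀ (λ u → ⌊ b ≟ u ⌋)) (orb v₁ (λ u → ⌊ b ≟ u ⌋)))) (+-mono-≤ (one v₀) (one v₁))
      where
      r : ∀ p q s t → (p + q) + (s + t) ≡ (p + s) + (q + t)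
      r = solve-∀
      one : ∀ z → orb z (λ u → ⌊ a ≟ u ⌋) + orb z (λ u → ⌊ b ≟ u ⌋) ≤ orb z (λ u → ⌊ a ≟ u ⌋ ∨ ⌊ b ≟ u ⌋)
      one z = ≤-trans (≤-reflexive (sym (Σℕ-+ _ _))) (Σℕ-mono (λ g → pt (act g z)))
        where
        pt : ∀ u → 𝟙 ⌊ a ≟ u ⌋ + 𝟙 ⌊ b ≟ u ⌋ ≤ 𝟙 (⌊ a ≟ u ⌋ ∨ ⌊ b ≟ u ⌋)
        pt u with a ≟ u | b ≟ u
        ... | yes p | yes q = ⊥-elim (a≢b (trans p (sym q)))
        ... | yes _ | no _ = ≤-refl
        ... | no _ | yes _ = ≤-refl
        ... | no _ | no _ = ≤-refl

    w₁-ok : ∀ {u v} → E u v → u ≢ v → w ≤ wt (λ x → ⌊ u ≟ x ⌋ ∨ ⌊ v ≟ x ⌋)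
    w₁-ok (g , inj₁ (refl , refl)) ne = ≤-trans (≤-reflexive (cong₂ _+_ (sym (point-act g v₀)) (sym (point-act g v₁)))) (join ne)
    w₁-ok (g , inj₂ (refl , refl)) ne = ≤-trans (≤-reflexive (trans (+-comm (wt (λ u → ⌊ v₀ ≟ u ⌋)) _) (cong₂ _+_ (sym (point-act g v₁)) (sym (point-act g v₀))))) (join ne)

    w≤f : ∀ {m} → 1 ≤ m → w ≤ f m
    w≤f {m} 1≤m = ≤-trans (join v₀≢v₁) (wt-mono {λ u → ⌊ v₀ ≟ u ⌋ ∨ ⌊ v₁ ≟ u ⌋} {Bl m v₀} (λ u p → ⇒true (R? m v₀ u)
      ([ (λ q → subst (R m v₀) (true⇒ (v₀ ≟ u) q) stay) , (λ q → subst (R m v₀) (true⇒ (v₁ ≟ u) q) (reach-mono 1≤m (hop {n = 0} v₀~v₁ stay))) ]′ (∨-true {⌊ v₀ ≟ u ⌋} p))))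

  -- The leading 4 leaves room for the additive constants in `3 * suc (Rad i) + 1 ≤ Rad (suc i)`.
  Rad : ℕ → ℕ
  Rad i = 4 * 4 ^ i

  4^-pos : ∀ i → 1 ≤ 4 ^ i
  4^-pos zero = ≤-refl
  4^-pos (suc i) = ≤-trans (4^-pos i) (m≤m+n (4 ^ i) _)

  f-mono : ∀ {m n} → m ≤ n → f m ≤ f n
  f-mono {m} {n} le = wt-mono {Bl m v₀} {Bl n v₀} (λ u p → ⇒true (R? n v₀ u) (reach-mono le (true⇒ (R? m v₀ u) p)))

  module Descent (k : ℕ) (k-pos : 1 ≤ k) (K-pos : 0 < K) where

    A s : ℕ
    A = threshold k
    s = scale k

    -- p is 4 to the number of scales between the current one and the diameter.
    Weight : ℕ → ℕ → Set
    Weight x p = x * (A * ((p * p) * (p * p))) ≤ K + K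

    room′ : ∀ {x wmax κ} p → 1 ≤ p → 1 ≤ κ → κ ≤ 256 → 0 < x → wmax ≤ κ * x → Weight x p →
      ∃ λ ℓ → K + K < 2 * (2 ^ ℓ * x) × 8 * ((2 * (16 * (256 * p) * κ) + 2) * (k * ((k * (2 * (2 + 2 * ((16 * (256 * p) * κ) * ℓ))) + 1) * wmax))) ≤ K + K
    room′ {x} {wmax} {κ} p p-pos κ-pos κ≤ x-pos wmax≤ weight = room-suffices k (16 * (256 * p) * κ) κ x wmax (K + K) (s * (p * p)) k-pos
      (*-mono-≤ {4} {16 * (256 * p)} {1} (*-mono-≤ {4} {16} {1} (m≤m+n 4 12) (*-mono-≤ {1} {256} {1} (s≤s z≤n) p-pos)) κ-pos)
      x-pos wmax≤ (*-mono-≤ (scale-pos k-pos) (*-mono-≤ p-pos p-pos)) (scale-large k p κ κ≤)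
      (≤-trans (≤-reflexive (threshold-≡ k p x)) weight)

    finish-cells : ∀ i p → 1 ≤ p → f (Rad (suc i)) ≤ 256 * f (Rad i) → 0 < f (Rad i) → Weight (f (Rad i)) p → Chained (suc (Rad i)) (256 * p) → CliqueModel E k
    finish-cells i p p-pos doubling pos weight chain =
      let (ℓ , hi , room) = room′ {κ = 256} p p-pos (s≤s z≤n) ≤-refl pos ≤-refl weight in
      L.level {κ = 256} {L = 256 * p} {ℓ = ℓ} (s≤s z≤n) (*-mono-≤ {1} {256} {1} (s≤s z≤n) p-pos) chain C.crossable C.wmax-ok C.w₁-ok hi room
      where
      3r : 3 * suc (Rad i) + 1 ≤ Rad (suc i)
      3r = ≤-trans (≤-reflexive (r1 (Rad i))) (≤-trans (+-monoʳ-≤ (3 * Rad i) (*-monoʳ-≤ 4 (4^-pos i))) (≤-reflexive (r2 (4 ^ i))))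
        where
        r1 : ∀ x → 3 * suc x + 1 ≡ 3 * x + 4
        r1 = solve-∀
        r2 : ∀ x → 3 * (4 * x) + 4 * x ≡ 4 * (4 * x)
        r2 = solve-∀
      module C = CellLevel K-pos (Rad i) (Rad (suc i)) 256 3r doubling
      module L = Partition (Cells.c (Voronoi.cells E? E-sym (suc (Rad i)))) (Cells.c-fibre (Voronoi.cells E? E-sym (suc (Rad i)))) K-pos

    module V = VertexLevel K-pos

    w-pos : 0 < V.w
    w-pos = ≤-trans (≤-trans (≤-reflexive (sym (𝟙-true (⇒true (v₀ ≟ act e v₀) (sym (act-e v₀))))))
      (term≤Σℕ (λ g → 𝟙 ⌊ v₀ ≟ act g v₀ ⌋) e)) (≤-trans (m≤m+n _ (orb v₁ (λ u → ⌊ v₀ ≟ u ⌋))) (m≤m+n _ (wt (λ u → ⌊ v₁ ≟ u ⌋))))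

    finish-vertices : ∀ p → 1 ≤ p → Weight V.w p → Chained 1 (256 * p) → CliqueModel E k
    finish-vertices p p-pos weight chain =
      let (ℓ , hi , room) = room′ {κ = 1} p p-pos ≤-refl (s≤s z≤n) w-pos (≤-reflexive (sym (*-identityˡ V.w))) weight in
      L.level {κ = 1} {L = 256 * p} {ℓ = ℓ} ≤-refl (*-mono-≤ {1} {256} {1} (s≤s z≤n) p-pos) chain V.crossable V.wmax-ok V.w₁-ok hi room
      where
      module L = Partition id singleton-fibre K-pos

    weight-mono : ∀ {x y p} → x ≤ y → Weight y p → Weight x p
    weight-mono le = ≤-trans (*-monoˡ-≤ _ le)

    Spread : ℕ → Set
    Spread n = ∀ {x y} → Translate x → Translate y → R n x y

    -- The product `p * 4 ^ i` is constant during the descent, so the distance bound persists. If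
    -- `f` grows by at most 256 between the two radii, cells of this scale work; otherwise `f` falls
    -- by a factor of at least 256, exactly what replacing `p` by `4 * p` costs in `Weight`.
    descend : ∀ i p → 1 ≤ p → Weight (f (Rad i)) p → Spread (256 * (p * 4 ^ i)) → CliqueModel E k
    descend zero p p-pos weight spr = finish-vertices p p-pos (weight-mono {p = p} (V.w≤f (s≤s z≤n)) weight)
      (λ tx ty → reach-blocks (256 * p) (reach-mono (≤-reflexive (sym (*-assoc 256 p 1))) (spr tx ty)))
    descend (suc i) p p-pos weight spr = step′ (f (Rad (suc i)) ≤? 256 * f (Rad i))
      where
      step′ : Dec (f (Rad (suc i)) ≤ 256 * f (Rad i)) → CliqueModel E k
      step′ (yes doubling) = finish-cells i p p-pos doubling (≤-trans w-pos (V.w≤f (≤-trans (s≤s z≤n) (*-monoʳ-≤ 4 (4^-pos i)))))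
        (weight-mono {p = p} (f-mono (*-monoʳ-≤ 4 (m≤m+n (4 ^ i) _))) weight)
        (λ tx ty → reach-blocks (256 * p) (reach-mono (≤-trans (≤-reflexive (sym (*-assoc 256 p (4 ^ suc i)))) (*-monoʳ-≤ (256 * p) (n≤1+n _))) (spr tx ty)))
      step′ (no growing) = descend i (4 * p) (≤-trans p-pos (m≤m+n p _)) (≤-trans (≤-reflexive (r1 (f (Rad i)) A p)) (≤-trans (*-monoˡ-≤ (A * ((p * p) * (p * p))) (≰⇒≥ growing)) weight))
        (λ tx ty → reach-mono (≤-reflexive (cong (256 *_) (r2 p (4 ^ i)))) (spr tx ty))
        where
        r1 : ∀ x a p → x * (a * (((4 * p) * (4 * p)) * ((4 * p) * (4 * p)))) ≡ (256 * x) * (a * ((p * p) * (p * p)))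
        r1 = solve-∀
        r2 : ∀ p q → p * (4 * q) ≡ (4 * p) * q
        r2 = solve-∀

  module Main (k : ℕ) (k-pos : 1 ≤ k) (K-large : order-bound (2 * threshold k) < K)
    (linked : ∀ g → ∃ λ m → R m v₀ (act g v₀))
    (moved₀ : ∃ λ g → act g v₀ ≢ v₀) (moved₁ : ∃ λ g → act g v₁ ≢ v₁) where

    K-pos : 0 < K
    K-pos = ≤-trans (s≤s z≤n) K-large

    open Descent k k-pos K-pos

    -- Elements are related when they carry `v` to points at distance at most `n`; five such steps
    -- cover only `5 * n`, so `order-bounded` excludes high density. The 2 in `2 * A` allows for the
    -- second orbit of vertices.
    sparse : ∀ v n → (∃ λ y → ¬ R (5 * n) v (act y v)) → 2 * A * orb v (Bl n v) < K
    sparse v n (y , far) = ≰⇒> (λ dense → <⇒≱ K-large (SlowGrowth.order-bounded 𝔾 Q Q-sym Q-inv (2 * A)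
        (≤-trans dense (≤-reflexive (cong (2 * A *_) (Σℕ-cong (λ g → cong (λ u → 𝟙 (Bl n u (act g v))) (sym (act-e v))))))) e y slow))
      where
      Q : Fin K → Fin K → Bool
      Q x z = Bl n (act x v) (act z v)
      Q-sym : ∀ x z → Q x z ≡ Q z x
      Q-sym x z with R? n (act x v) (act z v)
      ... | yes p = sym (⇒true (R? n (act z v) (act x v)) (R-sym p))
      ... | no ¬p = sym (¬⇒false (R? n (act z v) (act x v)) (λ p → ¬p (R-sym p)))
      Q-inv : ∀ g x z → Q (g ∙ x) (g ∙ z) ≡ Q x z
      Q-inv g x z with R? n (act x v) (act z v)
      ... | yes p = ⇒true (R? n (act (g ∙ x) v) (act (g ∙ z) v)) (subst₂ (R n) (sym (act-∙ g x v)) (sym (act-∙ g z v)) (R-act g p))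
      ... | no ¬p = ¬⇒false (R? n (act (g ∙ x) v) (act (g ∙ z) v)) (λ p → ¬p (R-act⁻ g (subst₂ (R n) (act-∙ g x v) (act-∙ g z v) p)))
      slow : ∀ z₁ z₂ z₃ z₄ → Q e z₁ ≡ true → Q z₁ z₂ ≡ true → Q z₂ z₃ ≡ true → Q z₃ z₄ ≡ true → Q z₄ y ≡ true → ⊥
      slow z₁ z₂ z₃ z₄ q₁ q₂ q₃ q₄ q₅ = far (subst (λ u → R (5 * n) u (act y v)) (act-e v) (reach-mono (≤-reflexive (r n))
        (reach-trans (dec q₁) (reach-trans (dec q₂) (reach-trans (dec q₃) (reach-trans (dec q₄) (dec q₅)))))))
        where
        r : ∀ n → n + (n + (n + (n + n))) ≡ 5 * n
        r = solve-∀
        dec : ∀ {x z} → Q x z ≡ true → R n (act x v) (act z v)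
        dec {x} {z} = true⇒ (R? n (act x v) (act z v))

    Far : ℕ → Set
    Far i = ∃ λ y → ¬ R (5 * suc (Rad i)) v₀ (act y v₀)

    Far? : ∀ i → Dec (Far i)
    Far? i = any? (λ y → ¬? (R? (5 * suc (Rad i)) v₀ (act y v₀)))

    spread-from : ∀ {n n′} → n + 2 ≤ n′ → (∀ y → R n v₀ (act y v₀)) → Spread n′
    spread-from {n} le all tx ty = reach-mono (≤-trans (≤-reflexive (r n)) le) (connect tx ty)
      where
      r : ∀ n → 1 + (n + 1) ≡ n + 2
      r = solve-∀
      near : ∀ {x} → Translate x → ∃ λ g → R 1 (act g v₀) x
      near (g , inj₁ refl) = g , stay
      near (g , inj₂ refl) = g , hop (E-act g v₀~v₁) stay
      connect : ∀ {x y} → Translate x → Translate y → R (1 + (n + 1)) x y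
      connect tx ty = let (g , p) = near tx ; (h , q) = near ty in
        reach-trans (R-sym p) (reach-trans (subst (R n (act g v₀)) (trans (sym (act-∙ g (inv g ∙ h) v₀)) (cong (λ t → act t v₀) (cancelˡ-inv g h))) (R-act g (all (inv g ∙ h)))) q)

    near-all : ∀ i → ¬ Far i → ∀ y → R (5 * suc (Rad i)) v₀ (act y v₀)
    near-all i ¬far y = decidable-stable (R? _ _ _) (λ ¬p → ¬far (y , ¬p))

    -- At the last radius that is still `Far`, the ball is sparse and `p = 1`. The diameter is at
    -- most `5 * suc (Rad (suc i)) + 2`, thus at most `87 * 4 ^ i`, well within the 256 of
    -- `descend`.
    from-top : ∀ i → Far i → ¬ Far (suc i) → CliqueModel E k
    from-top i far ¬far = descend i 1 ≤-refl weight (spread-from bound (near-all (suc i) ¬far))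
      where
      bound : 5 * suc (Rad (suc i)) + 2 ≤ 256 * (1 * 4 ^ i)
      bound = ≤-trans (≤-reflexive (r1 (4 ^ i))) (≤-trans (+-monoʳ-≤ (80 * 4 ^ i) (*-monoʳ-≤ 7 (4^-pos i))) (≤-trans (m≤m+n _ (169 * 4 ^ i)) (≤-reflexive (r2 (4 ^ i)))))
        where
        r1 : ∀ x → 5 * suc (4 * (4 * x)) + 2 ≡ 80 * x + 7 * 1
        r1 = solve-∀
        r2 : ∀ x → (80 * x + 7 * x) + 169 * x ≡ 256 * (1 * x)
        r2 = solve-∀
      v₁-side : orb v₁ (Bl (Rad i) v₀) ≤ orb v₀ (Bl (suc (Rad i)) v₀)
      v₁-side = count-mono (λ g p → ⇒true (R? (suc (Rad i)) v₀ (act g v₀)) (subst (λ t → R t v₀ (act g v₀)) (+-comm (Rad i) 1)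
        (reach-trans (true⇒ (R? (Rad i) v₀ (act g v₁)) p) (hop {n = 0} (E-sym (E-act g v₀~v₁)) stay))))
      v₀-side : orb v₀ (Bl (Rad i) v₀) ≤ orb v₀ (Bl (suc (Rad i)) v₀)
      v₀-side = count-mono (λ g p → ⇒true (R? (suc (Rad i)) v₀ (act g v₀)) (reach-mono (n≤1+n _) (true⇒ (R? (Rad i) v₀ (act g v₀)) p)))
      weight : Weight (f (Rad i)) 1
      weight = begin
        f (Rad i) * (A * 1) ≤⟨ *-monoˡ-≤ (A * 1) (+-mono-≤ v₀-side v₁-side) ⟩
        (b + b) * (A * 1) ≡⟨ r b A ⟩
        2 * A * b ≤⟨ <⇒≤ (sparse v₀ (suc (Rad i)) far) ⟩
        K ≤⟨ m≤m+n K K ⟩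
        K + K ∎
        where
        open ≤-Reasoning
        b = orb v₀ (Bl (suc (Rad i)) v₀)
        r : ∀ b a → (b + b) * (a * 1) ≡ 2 * a * b
        r = solve-∀

    -- The diameter is at most `27 = 5 * 5 + 2`, so single vertices serve. Their sparsity is
    -- `sparse` at radius 0: a ball of radius 0 counts a stabiliser, and any number of steps in a
    -- proper subgroup stays inside it.
    from-bottom : ¬ Far 0 → CliqueModel E k
    from-bottom ¬far = finish-vertices 1 ≤-refl weight (λ tx ty → reach-blocks 256 (reach-mono (m≤m+n 27 229) (spread-from (≤-refl {27}) (near-all 0 ¬far) tx ty)))
      where
      stabiliser : ∀ v → (∃ λ y → act y v ≢ v) → ∀ u → 2 * A * orb v (λ x → ⌊ u ≟ x ⌋) ≤ K
      stabiliser v (y , moved) u = ≤-trans (*-monoʳ-≤ (2 * A) at-most) (<⇒≤ (sparse v 0 (y , λ p → moved (sym (zero-step p)))))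
        where
        zero-step : ∀ {x z} → R 0 x z → x ≡ z
        zero-step stay = refl
        at-most : orb v (λ x → ⌊ u ≟ x ⌋) ≤ orb v (Bl 0 v)
        at-most = bound (any? (λ g → u ≟ act g v))
          where
          bound : Dec (∃ λ g → u ≡ act g v) → orb v (λ x → ⌊ u ≟ x ⌋) ≤ orb v (Bl 0 v)
          bound (no none) = ≤-trans (≤-reflexive (Σℕ-zero (λ g → cong 𝟙 (¬⇒false (u ≟ act g v) (λ eq → none (g , eq)))))) z≤n
          bound (yes (g , u≡)) = ≤-trans (≤-reflexive (sym (orb-shift g v (λ x → ⌊ u ≟ x ⌋)))) (count-mono (λ h p → ⇒true (R? 0 v (act h v))
            (subst (λ x → R 0 x (act h v)) (trans (sym (act-inv g (act h v))) (trans (cong (act (inv g)) (sym (trans (sym u≡) (true⇒ (u ≟ act g (act h v)) p)))) (act-inv g v))) stay)))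
      weight : Weight V.w 1
      weight = *-cancelˡ-≤ 2 (begin
        2 * (V.w * (A * 1)) ≡⟨ r1 a b c d A ⟩
        (2 * A * a + 2 * A * b) + (2 * A * c + 2 * A * d) ≤⟨ +-mono-≤ (+-mono-≤ (stabiliser v₀ moved₀ v₀) (stabiliser v₁ moved₁ v₀)) (+-mono-≤ (stabiliser v₀ moved₀ v₁) (stabiliser v₁ moved₁ v₁)) ⟩
        (K + K) + (K + K) ≡⟨ r2 K ⟩
        2 * (K + K) ∎)
        where
        open ≤-Reasoning
        a = orb v₀ (λ u → ⌊ v₀ ≟ u ⌋)
        b = orb v₁ (λ u → ⌊ v₀ ≟ u ⌋)
        c = orb v₀ (λ u → ⌊ v₁ ≟ u ⌋)
        d = orb v₁ (λ u → ⌊ v₁ ≟ u ⌋)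
        r1 : ∀ a b c d A → 2 * (((a + b) + (c + d)) * (A * 1)) ≡ (2 * A * a + 2 * A * b) + (2 * A * c + 2 * A * d)
        r1 = solve-∀
        r2 : ∀ k → (k + k) + (k + k) ≡ 2 * (k + k)
        r2 = solve-∀

    never-far : ∃ λ n → ¬ Far n
    never-far = Σℕ (λ g → proj₁ (linked g)) , λ { (y , ¬p) → ¬p (reach-mono (≤-trans (term≤Σℕ (λ g → proj₁ (linked g)) y) (big _)) (proj₂ (linked y))) }
      where
      n<4^n : ∀ n → n ≤ 4 ^ n
      n<4^n zero = z≤n
      n<4^n (suc n) = ≤-trans (+-mono-≤ (4^-pos n) (n<4^n n)) (+-monoʳ-≤ (4 ^ n) (m≤m+n _ _))
      big : ∀ n → n ≤ 5 * suc (Rad n)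
      big n = ≤-trans (n<4^n n) (≤-trans (m≤m+n (4 ^ n) _) (≤-trans (n≤1+n _) (m≤m+n (suc (Rad n)) _)))

    clique-model : CliqueModel E k
    clique-model = start′ (Far? 0)
      where
      search : ∀ n i → Far i → ¬ Far (n + i) → CliqueModel E k
      search zero i far ¬far = ⊥-elim (¬far far)
      search (suc n) i far ¬far = next (Far? (suc i))
        where
        next : Dec (Far (suc i)) → CliqueModel E k
        next (yes far′) = search n (suc i) far′ (subst (λ m → ¬ Far m) (sym (+-suc n i)) ¬far)
        next (no ¬far′) = from-top i far ¬far′
      start′ : Dec (Far 0) → CliqueModel E k
      start′ (no ¬far) = from-bottom ¬far
      start′ (yes far) = let (n , ¬far) = never-far in search n 0 far (subst (λ m → ¬ Far m) (sym (+-identityʳ n)) ¬far)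

-- Quotients by edge orbits

¬¬-∀ : ∀ {n} {P : Fin n → Set} → (∀ i → ¬ ¬ P i) → ¬ ¬ (∀ i → P i)
¬¬-∀ {zero} h k = k λ ()
¬¬-∀ {suc n} h k = h zero λ p → ¬¬-∀ (h ∘ suc) λ ps → k λ { zero → p ; (suc i) → ps i }

¬¬-Dec : ∀ {P : Set} → ¬ ¬ Dec P
¬¬-Dec k = k (no λ p → k (yes p))

-- Reachability by edge orbits and the like is put to use only in refutations, where finitely many
-- instances of excluded middle may be assumed.
¬¬-decidable : ∀ {n} (R : Fin n → Fin n → Set) → ¬ ¬ (∀ x y → Dec (R x y))
¬¬-decidable R = ¬¬-∀ λ x → ¬¬-∀ λ y → ¬¬-Dec

record Quotient {n : ℕ} (R : Fin n → Fin n → Set) : Set where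
  field
    m : ℕ
    π : Fin n → Fin m
    s : Fin m → Fin n
    π-s : ∀ a → π (s a) ≡ a
    to-R : ∀ {x y} → π x ≡ π y → R x y
    from-R : ∀ {x y} → R x y → π x ≡ π y

  -- The section `s` misses at least one of `x` and `y`; adding that vertex injects `suc m` values.
  -- This makes `contract` terminate.
  smaller : ∀ {x y} → x ≢ y → R x y → m < n
  smaller {x} {y} x≢y r = injective⇒≤ {f = f} inj
    where
    z : Fin n
    z with x ≟ s (π x)
    ... | yes _ = y
    ... | no _ = x
    z∉ : ∀ a → s a ≢ z
    z∉ a p with x ≟ s (π x)
    ... | yes q = x≢y (trans q (trans (cong s (trans (from-R r) (trans (cong π (sym p)) (π-s a)))) p))
    ... | no ne = ne (trans (sym p) (cong s (trans (sym (π-s a)) (cong π p))))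
    f : Fin (suc m) → Fin n
    f zero = z
    f (suc a) = s a
    inj : ∀ {a b} → f a ≡ f b → a ≡ b
    inj {zero} {zero} _ = refl
    inj {zero} {suc b} p = ⊥-elim (z∉ b (sym p))
    inj {suc a} {zero} p = ⊥-elim (z∉ a p)
    inj {suc a} {suc b} p = cong suc (trans (sym (π-s a)) (trans (cong π p) (π-s b)))

quotient-by : ∀ {n} {R : Fin n → Fin n → Set} → (∀ x y → Dec (R x y)) → (∀ x → R x x) → (∀ {x y} → R x y → R y x) →
  (∀ {x y z} → R x y → R y z → R x z) → Quotient R
quotient-by {R = R} R? R-refl R-sym R-trans = record
  { m = size ; π = λ x → proj₁ (covers x) ; s = points
  ; π-s = λ a → sym (separated a _ (proj₂ (covers (points a))))
  ; to-R = λ {x} {y} eq → R-trans (proj₂ (covers x)) (R-sym (subst (λ a → R y (points a)) (sym eq) (proj₂ (covers y))))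
  ; from-R = λ {x} {y} r → separated _ _ (R-trans (R-sym (proj₂ (covers x))) (R-trans r (proj₂ (covers y)))) }
  where open SeparatedCover (separated-cover {R = R} R? R-refl R-sym id)

Star-symmetric : ∀ {A : Set} {R : A → A → Set} → (∀ {x y} → R x y → R y x) → ∀ {x y} → Star R x y → Star R y x
Star-symmetric {R = R} R-sym p = go p ε
  where
  go : ∀ {x y z} → Star R x y → Star R x z → Star R y z
  go ε acc = acc
  go (r ◅ p) acc = go p (R-sym r ◅ acc)

Star-map : ∀ {A B : Set} {R : A → A → Set} {T : B → B → Set} (f : A → B) → (∀ {x y} → R x y → T (f x) (f y)) → ∀ {x y} → Star R x y → Star T (f x) (f y)
Star-map f h ε = ε
Star-map f h (r ◅ p) = h r ◅ Star-map f h p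

module QuotientAction {K n : ℕ} (𝔾 : SimpleGroup K) (act : Fin K → Fin n → Fin n)
  (act-e : ∀ v → act (SimpleGroup.e 𝔾) v ≡ v)
  (act-∙ : ∀ g h v → act (SimpleGroup._∙_ 𝔾 g h) v ≡ act g (act h v))
  {R : Fin n → Fin n → Set} (R-act : ∀ g {x y} → R x y → R (act g x) (act g y)) (Q : Quotient R) where
  open SimpleGroup 𝔾
  open Quotient Q

  act′ : Fin K → Fin m → Fin m
  act′ g a = π (act g (s a))

  π-act : ∀ g x → π (act g x) ≡ act′ g (π x)
  π-act g x = from-R (R-act g (to-R (sym (π-s (π x)))))

  act′-e : ∀ a → act′ e a ≡ a
  act′-e a = trans (cong π (act-e (s a))) (π-s a)

  act′-∙ : ∀ g h a → act′ (g ∙ h) a ≡ act′ g (act′ h a)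
  act′-∙ g h a = trans (cong π (act-∙ g h (s a))) (π-act g (act h (s a)))

  act′-inv : ∀ g a → act′ (inv g) (act′ g a) ≡ a
  act′-inv g a = trans (sym (act′-∙ (inv g) g a)) (trans (cong (λ h → act′ h a) (invˡ g)) (act′-e a))

-- Contract the connected blocks spanned by an edge orbit as long as they are moved by the group.
module Contraction {K : ℕ} (𝔾 : SimpleGroup K) (k : ℕ) (k-pos : 1 ≤ k) (K-large : order-bound (2 * threshold k) < K) where
  open SimpleGroup 𝔾

  -- `U` is an invariant connected set without fixed vertices, so `x₀` has an edge inside it. If the
  -- blocks of that edge's orbit link all translates of `x₀`, `EdgeOrbit.Main` applies. Otherwise
  -- the quotient by blocks is smaller, has the same properties, and its clique models pull back.
  contract : ∀ fuel {N} → N < fuel → (R : Fin N → Fin N → Set) → (∀ {x y} → R x y → R y x) → (∀ {x} → ¬ R x x) →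
    (act : Fin K → Fin N → Fin N) → (∀ v → act e v ≡ v) → (∀ g h v → act (g ∙ h) v ≡ act g (act h v)) →
    (∀ g {x y} → R x y → R (act g x) (act g y)) →
    (U : Fin N → Set) → (∀ g {x} → U x → U (act g x)) → (∀ {x y} → U x → U y → Star (λ u v → R u v × U v) x y) →
    (∀ {x} → U x → ∃ λ g → act g x ≢ x) → (x₀ : Fin N) → U x₀ → ¬ ¬ CliqueModel R k
  contract (suc fuel) {N} (s≤s N≤) R R-sym R-irrefl act act-e act-∙ R-act U U-act U-conn U-moved x₀ Ux₀ no-model =
    first-edge (U-moved Ux₀)
    where
    module _ (v₁ : Fin N) (edge : R x₀ v₁) (Uv₁ : U v₁) where
      v₀≢v₁ : x₀ ≢ v₁
      v₀≢v₁ eq = R-irrefl (subst (R x₀) (sym eq) edge)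

      module O = EdgeOrbit 𝔾 act act-e act-∙ x₀ v₁ v₀≢v₁
      open O using (E ; E-sym ; E-act ; Translate)

      E⇒R : ∀ {u v} → E u v → R u v
      E⇒R (g , inj₁ (refl , refl)) = R-act g edge
      E⇒R (g , inj₂ (refl , refl)) = R-sym (R-act g edge)

      Block : Fin N → Fin N → Set
      Block = Star E

      whole : (∀ g → Block x₀ (act g x₀)) → ⊥
      whole linked = no-model record
        { CliqueModel m ; branch-connected = λ i x l → Star-weaken (λ { (r , p) → E⇒R r , p }) (CliqueModel.branch-connected m i x l)
        ; touching = λ i j ne → let (u , v , lu , lv , r) = CliqueModel.touching m i j ne in u , v , lu , lv , E⇒R r }
        where
        m : CliqueModel E k
        m = O.Main.clique-model k k-pos K-large (λ g → Star⇒reach (linked g)) (U-moved Ux₀) (U-moved Uv₁)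

      module _ (block? : ∀ x y → Dec (Block x y)) (g₀ : Fin K) (moved : ¬ Block x₀ (act g₀ x₀)) where
        Q : Quotient Block
        Q = quotient-by block? (λ x → ε) (Star-symmetric E-sym) _◅◅_
        Block-act : ∀ g {x y} → Block x y → Block (act g x) (act g y)
        Block-act g = Star-map (act g) (E-act g)
        open Quotient Q
        open QuotientAction 𝔾 act act-e act-∙ Block-act Q

        R′ : Fin m → Fin m → Set
        R′ a b = a ≢ b × ∃₂ λ u v → π u ≡ a × π v ≡ b × R u v

        U′ : Fin m → Set
        U′ a = ∃ λ u → π u ≡ a × U u

        R′-act : ∀ g {a b} → R′ a b → R′ (act′ g a) (act′ g b)
        R′-act g {a} {b} (ne , u , v , refl , refl , r) =
          (λ eq → ne (trans (sym (act′-inv g a)) (trans (cong (act′ (inv g)) eq) (act′-inv g b)))) ,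
          act g u , act g v , π-act g u , π-act g v , R-act g r

        U′-conn : ∀ {u v} → Star (λ u v → R u v × U v) u v → Star (λ a b → R′ a b × U′ b) (π u) (π v)
        U′-conn ε = ε
        U′-conn {u} {v} (_◅_ {j = w} (r , Uw) p) with π u ≟ π w
        ... | yes eq = subst (λ a → Star (λ a b → R′ a b × U′ b) a (π v)) (sym eq) (U′-conn p)
        ... | no ne = ((ne , u , w , refl , refl , r) , (w , refl , Uw)) ◅ U′-conn p

        -- If `g₀` moves the block of `x₀`, then its conjugate by `h` moves the block of `act h x₀`.
        base-moved : ∀ h {x} → Block x (act h x₀) → ¬ (∀ g → Block x (act g x))
        base-moved h {x} p all = moved (subst₂ Block (O.act-inv h x₀) eq (Block-act (inv h) (Star-symmetric E-sym p ◅◅ (all (conj h g₀) ◅◅ Block-act (conj h g₀) p))))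
          where
          eq : act (inv h) (act (conj h g₀) (act h x₀)) ≡ act g₀ x₀
          eq = trans (sym (act-∙ (inv h) _ _)) (trans (sym (act-∙ _ h x₀)) (cong (λ t → act t x₀)
            (trans (cong (_∙ h) (trans (cong (inv h ∙_) (assoc h g₀ (inv h))) (inv-cancelˡ h (g₀ ∙ inv h)))) (cancelʳ-inv g₀ h))))

        U′-moved : ∀ {a} → U′ a → ∃ λ g → act′ g a ≢ a
        U′-moved {a} (u , refl , Uu) = ¬∀⟶∃¬ K _ (λ g → act′ g (π u) ≟ π u) λ all → fixed (λ g → to-R (sym (trans (π-act g u) (all g)))) (O.translate? u)
          where
          fixed : (∀ g → Block u (act g u)) → Dec (Translate u) → ⊥
          fixed all (yes (h , inj₁ refl)) = base-moved h ε all
          fixed all (yes (h , inj₂ refl)) = base-moved h (E-sym (E-act h O.v₀~v₁) ◅ ε) all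
          -- A vertex outside the edge orbit is a block by itself, and it is moved because it lies
          -- in `U`.
          fixed all (no ¬t) = let (g , ne) = U-moved Uu in stuck ne (all g)
            where
            stuck : ∀ {v} → v ≢ u → Block u v → ⊥
            stuck ne ε = ne refl
            stuck ne (r ◅ _) = ¬t (O.E-translate r)

        in-class : ∀ {u v w} → Block w u → Block u v → Star (λ x y → R x y × π y ≡ π w) u v
        in-class p ε = ε
        in-class p (r ◅ q) = (E⇒R r , from-R (Star-symmetric E-sym (p ◅◅ (r ◅ ε)))) ◅ in-class (p ◅◅ (r ◅ ε)) q

        recurse : ⊥
        recurse = contract fuel (≤-trans (smaller v₀≢v₁ (O.v₀~v₁ ◅ ε)) N≤) R′
          (λ { (ne , u , v , p , q , r) → ne ∘ sym , v , u , q , p , R-sym r }) (λ { (ne , _) → ne refl })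
          act′ act′-e act′-∙ R′-act U′ (λ { g (u , refl , Uu) → act g u , π-act g u , U-act g Uu })
          (λ { (u , refl , Uu) (v , refl , Uv) → U′-conn (U-conn Uu Uv) }) U′-moved (π x₀) (x₀ , refl , Ux₀)
          (λ m → no-model (pull-back π (λ u v eq → in-class ε (to-R eq)) proj₂ m (λ i → s (CliqueModel.root m i) , π-s _)))

      at-edge : ⊥
      at-edge = ¬¬-decidable Block λ block? → decide block? (all? (λ g → block? x₀ (act g x₀)))
        where
        decide : (∀ x y → Dec (Block x y)) → Dec (∀ g → Block x₀ (act g x₀)) → ⊥
        decide block? (yes all) = whole all
        decide block? (no ¬all) = let (g , moved) = ¬∀⟶∃¬ K _ (λ g → block? x₀ (act g x₀)) ¬all in recurse block? g moved

    first-edge : (∃ λ g → act g x₀ ≢ x₀) → ⊥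
    first-edge (g , ne) = go ne (U-conn Ux₀ (U-act g Ux₀))
      where
      go : ∀ {y} → y ≢ x₀ → Star (λ u v → R u v × U v) x₀ y → ⊥
      go ne ε = ne refl
      go ne ((r , Uv) ◅ _) = at-edge _ r Uv

-- Transpositions

odd : ℕ → Bool
odd zero = false
odd (suc n) = not (odd n)

not-xor : ∀ a b → not (a xor b) ≡ not a xor b
not-xor true true = refl
not-xor true false = refl
not-xor false b = refl

odd-+ : ∀ m n → odd (m + n) ≡ odd m xor odd n
odd-+ zero n = refl
odd-+ (suc m) n = trans (cong not (odd-+ m n)) (not-xor (odd m) (odd n))

xor-same : ∀ a → a xor a ≡ false
xor-same true = refl
xor-same false = refl

xor-false : ∀ a → a xor false ≡ a
xor-false true = refl
xor-false false = refl

odd-double : ∀ n → odd (2 * n) ≡ false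
odd-double n = trans (odd-+ n (n + 0)) (trans (cong (λ t → odd n xor odd t) (+-identityʳ n)) (xor-same (odd n)))

-- The sign, computed by counting inversions, would be a non-trivial homomorphism to a group of order 2.
module NoTransposition {K m : ℕ} (𝔾 : SimpleGroup K) (act : Fin K → Fin m → Fin m)
  (act-e : ∀ v → act (SimpleGroup.e 𝔾) v ≡ v)
  (act-∙ : ∀ g h v → act (SimpleGroup._∙_ 𝔾 g h) v ≡ act g (act h v))
  (t : Fin K) (α β : Fin m) (α≢β : α ≢ β) (t-α : act t α ≡ β) (t-β : act t β ≡ α) (t-other : ∀ x → x ≢ α → x ≢ β → act t x ≡ x)
  where
  open SimpleGroup 𝔾

  act-inv : ∀ g v → act (inv g) (act g v) ≡ v
  act-inv g v = trans (sym (act-∙ (inv g) g v)) (trans (cong (λ h → act h v) (invˡ g)) (act-e v))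

  inv-act : ∀ g v → act g (act (inv g) v) ≡ v
  inv-act g v = trans (sym (act-∙ g (inv g) v)) (trans (cong (λ h → act h v) (invʳ g)) (act-e v))

  -- Any linear order gives the same sign; in this one α and β come first, so t has a single inversion.
  rank : ∀ x → Dec (x ≡ α) → Dec (x ≡ β) → ℕ
  rank x (yes _) _ = 0
  rank x (no _) (yes _) = 1
  rank x (no _) (no _) = 2 + toℕ x

  ord : Fin m → ℕ
  ord x = rank x (x ≟ α) (x ≟ β)

  ord-injective : ∀ {x y} → ord x ≡ ord y → x ≡ y
  ord-injective {x} {y} eq = go (x ≟ α) (x ≟ β) (y ≟ α) (y ≟ β) eq
    where
    go : ∀ a b c d → rank x a b ≡ rank y c d → x ≡ y
    go (yes p) _ (yes q) _ _ = trans p (sym q)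
    go (yes _) _ (no _) (yes _) ()
    go (yes _) _ (no _) (no _) ()
    go (no _) (yes _) (yes _) _ ()
    go (no _) (no _) (yes _) _ ()
    go (no _) (yes p) (no _) (yes q) _ = trans p (sym q)
    go (no _) (yes _) (no _) (no _) ()
    go (no _) (no _) (no _) (yes _) ()
    go (no _) (no _) (no _) (no _) eq = Finₚ.toℕ-injective (ℕₚ.suc-injective (ℕₚ.suc-injective eq))

  lt : Fin m → Fin m → Bool
  lt x y = ⌊ ord x <? ord y ⌋

  lt-flip : ∀ {x y} → x ≢ y → lt y x ≡ not (lt x y)
  lt-flip {x} {y} ne with ord x <? ord y
  ... | yes p = ¬⇒false (ord y <? ord x) (<⇒≯ p)
  ... | no ¬p = ⇒true (ord y <? ord x) (≤∧≢⇒< (≮⇒≥ ¬p) (λ eq → ne (sym (ord-injective eq))))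

  lt-irrefl : ∀ x → lt x x ≡ false
  lt-irrefl x = ¬⇒false (ord x <? ord x) (<-irrefl refl)

  reversed : Fin K → Fin m → Fin m → Bool
  reversed g x y = lt x y xor lt (act g x) (act g y)

  not-xor-not : ∀ a b → not a xor not b ≡ a xor b
  not-xor-not true true = refl
  not-xor-not true false = refl
  not-xor-not false true = refl
  not-xor-not false false = refl

  act-≢ : ∀ g {x y} → x ≢ y → act g x ≢ act g y
  act-≢ g ne eq = ne (trans (sym (act-inv g _)) (trans (cong (act (inv g)) eq) (act-inv g _)))

  reversed-sym : ∀ g x y → reversed g y x ≡ reversed g x y
  reversed-sym g x y with x ≟ y
  ... | yes refl = refl
  ... | no ne = trans (cong₂ _xor_ (lt-flip ne) (lt-flip (act-≢ g ne))) (not-xor-not (lt x y) (lt (act g x) (act g y)))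

  reversed-diag : ∀ g x → reversed g x x ≡ false
  reversed-diag g x = cong₂ _xor_ (lt-irrefl x) (lt-irrefl (act g x))

  reversed-∙ : ∀ g h x y → reversed (g ∙ h) x y ≡ reversed h x y xor reversed g (act h x) (act h y)
  reversed-∙ g h x y = trans (cong (lt x y xor_) (cong₂ lt (act-∙ g h x) (act-∙ g h y)))
    (telescope (lt x y) (lt (act h x) (act h y)) (lt (act g (act h x)) (act g (act h y))))
    where
    telescope : ∀ a b c → a xor c ≡ (a xor b) xor (b xor c)
    telescope true true c = refl
    telescope true false true = refl
    telescope true false false = refl
    telescope false true true = refl
    telescope false true false = refl
    telescope false false c = refl

  pairs : (Fin m → Fin m → Bool) → ℕ
  pairs ψ = Σℕ (λ x → count (λ y → lt x y ∧ ψ x y))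

  pairs-double : ∀ ψ → (∀ x y → ψ y x ≡ ψ x y) → (∀ x → ψ x x ≡ false) → 2 * pairs ψ ≡ Σℕ (λ x → count (ψ x))
  pairs-double ψ ψ-sym ψ-diag = begin
    pairs ψ + (pairs ψ + 0) ≡⟨ cong (pairs ψ +_) (trans (+-identityʳ _) (Σℕ-comm (λ x y → 𝟙 (lt x y ∧ ψ x y)))) ⟩
    Σℕ (λ x → count (λ y → lt x y ∧ ψ x y)) + Σℕ (λ x → count (λ y → lt y x ∧ ψ y x)) ≡⟨ trans (sym (Σℕ-+ _ _)) (Σℕ-cong (λ x → trans (sym (Σℕ-+ _ _)) (Σℕ-cong (λ y → both x y)))) ⟩
    Σℕ (λ x → count (ψ x)) ∎
    where
    open ≡-Reasoning
    split : ∀ l p → 𝟙 (l ∧ p) + 𝟙 (not l ∧ p) ≡ 𝟙 p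
    split true p = +-identityʳ (𝟙 p)
    split false p = refl
    both : ∀ x y → 𝟙 (lt x y ∧ ψ x y) + 𝟙 (lt y x ∧ ψ y x) ≡ 𝟙 (ψ x y)
    both x y with x ≟ y
    ... | yes refl = trans (cong (λ b → 𝟙 (b ∧ ψ x x) + 𝟙 (b ∧ ψ x x)) (lt-irrefl x)) (cong 𝟙 (sym (ψ-diag x)))
    ... | no ne = trans (cong₂ (λ b p → 𝟙 (lt x y ∧ ψ x y) + 𝟙 (b ∧ p)) (lt-flip ne) (ψ-sym x y)) (split (lt x y) (ψ x y))

  -- The order `lt` is not invariant, but for symmetric `ψ` the count is half of the count over all
  -- pairs, which a permutation preserves.
  pairs-act : ∀ g ψ → (∀ x y → ψ y x ≡ ψ x y) → (∀ x → ψ x x ≡ false) → pairs (λ x y → ψ (act g x) (act g y)) ≡ pairs ψ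
  pairs-act g ψ ψ-sym ψ-diag = *-cancelˡ-≡ _ _ 2 (begin
    2 * pairs (λ x y → ψ (act g x) (act g y)) ≡⟨ pairs-double _ (λ x y → ψ-sym (act g x) (act g y)) (λ x → ψ-diag (act g x)) ⟩
    Σℕ (λ x → Σℕ (λ y → 𝟙 (ψ (act g x) (act g y)))) ≡⟨ Σℕ-cong (λ x → Σℕ-bij (λ y → 𝟙 (ψ (act g x) y)) (act g) (act (inv g)) (inv-act g) (act-inv g)) ⟩
    Σℕ (λ x → Σℕ (λ y → 𝟙 (ψ (act g x) y))) ≡⟨ Σℕ-bij (λ x → Σℕ (λ y → 𝟙 (ψ x y))) (act g) (act (inv g)) (inv-act g) (act-inv g) ⟩
    Σℕ (λ x → count (ψ x)) ≡⟨ sym (pairs-double ψ ψ-sym ψ-diag) ⟩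
    2 * pairs ψ ∎)
    where open ≡-Reasoning

  pairs-xor : ∀ ψ χ → pairs (λ x y → ψ x y xor χ x y) + 2 * pairs (λ x y → ψ x y ∧ χ x y) ≡ pairs ψ + pairs χ
  pairs-xor ψ χ = begin
    pairs (λ x y → ψ x y xor χ x y) + 2 * pairs (λ x y → ψ x y ∧ χ x y) ≡⟨ cong (pairs (λ x y → ψ x y xor χ x y) +_) (trans (sym (Σℕ-*ˡ 2 _)) (Σℕ-cong (λ x → sym (Σℕ-*ˡ 2 _)))) ⟩
    pairs (λ x y → ψ x y xor χ x y) + Σℕ (λ x → Σℕ (λ y → 2 * 𝟙 (lt x y ∧ (ψ x y ∧ χ x y)))) ≡⟨ trans (sym (Σℕ-+ _ _)) (Σℕ-cong (λ x → trans (sym (Σℕ-+ _ _)) (trans (Σℕ-cong (λ y → pt (lt x y) (ψ x y) (χ x y))) (Σℕ-+ _ _)))) ⟩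
    Σℕ (λ x → count (λ y → lt x y ∧ ψ x y) + count (λ y → lt x y ∧ χ x y)) ≡⟨ Σℕ-+ _ _ ⟩
    pairs ψ + pairs χ ∎
    where
    open ≡-Reasoning
    pt : ∀ l a b → 𝟙 (l ∧ (a xor b)) + 2 * 𝟙 (l ∧ (a ∧ b)) ≡ 𝟙 (l ∧ a) + 𝟙 (l ∧ b)
    pt false a b = refl
    pt true true true = refl
    pt true true false = refl
    pt true false true = refl
    pt true false false = refl

  sgn : Fin K → Bool
  sgn g = odd (pairs (reversed g))

  -- The pairs reversed by a product form a symmetric difference, whose parity is additive;
  -- relabelling by `h` removes the twist in the second set.
  sgn-∙ : ∀ g h → sgn (g ∙ h) ≡ sgn h xor sgn g
  sgn-∙ g h = begin
    odd (pairs (reversed (g ∙ h))) ≡⟨ cong odd (Σℕ-cong (λ x → Σℕ-cong (λ y → cong (λ b → 𝟙 (lt x y ∧ b)) (reversed-∙ g h x y)))) ⟩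
    odd (pairs (λ x y → reversed h x y xor rg x y)) ≡⟨ sym (xor-false _) ⟩
    odd (pairs (λ x y → reversed h x y xor rg x y)) xor false ≡⟨ cong (odd (pairs (λ x y → reversed h x y xor rg x y)) xor_) (sym (odd-double X)) ⟩
    odd (pairs (λ x y → reversed h x y xor rg x y)) xor odd (2 * X) ≡⟨ sym (odd-+ (pairs (λ x y → reversed h x y xor rg x y)) (2 * X)) ⟩
    odd (pairs (λ x y → reversed h x y xor rg x y) + 2 * X) ≡⟨ cong odd (pairs-xor (reversed h) rg) ⟩
    odd (pairs (reversed h) + pairs rg) ≡⟨ odd-+ (pairs (reversed h)) (pairs rg) ⟩
    sgn h xor odd (pairs rg) ≡⟨ cong (λ n → sgn h xor odd n) (pairs-act h (reversed g) (reversed-sym g) (reversed-diag g)) ⟩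
    sgn h xor sgn g ∎
    where
    open ≡-Reasoning
    rg : Fin m → Fin m → Bool
    rg x y = reversed g (act h x) (act h y)
    X = pairs (λ x y → reversed h x y ∧ rg x y)

  sgn-e : sgn e ≡ false
  sgn-e = idem (trans (cong sgn (sym (idˡ e))) (sgn-∙ e e))
    where
    idem : ∀ {a} → a ≡ a xor a → a ≡ false
    idem {a} p = trans p (xor-same a)

  sgn-inv : ∀ g → sgn (inv g) ≡ sgn g
  sgn-inv g = xor-eq (sgn g) (sgn (inv g)) (trans (sym (sgn-∙ (inv g) g)) (trans (cong sgn (invˡ g)) sgn-e))
    where
    xor-eq : ∀ a b → a xor b ≡ false → b ≡ a
    xor-eq true true _ = refl
    xor-eq false false _ = refl

  ord-α : ord α ≡ 0
  ord-α with α ≟ α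
  ... | yes _ = refl
  ... | no ne = ⊥-elim (ne refl)

  ord-β : ord β ≡ 1
  ord-β with β ≟ α | β ≟ β
  ... | yes eq | _ = ⊥-elim (α≢β (sym eq))
  ... | no _ | yes _ = refl
  ... | no _ | no ne = ⊥-elim (ne refl)

  ord-other : ∀ {x} → x ≢ α → x ≢ β → ord x ≡ 2 + toℕ x
  ord-other {x} a b with x ≟ α | x ≟ β
  ... | yes p | _ = ⊥-elim (a p)
  ... | no _ | yes p = ⊥-elim (b p)
  ... | no _ | no _ = refl

  lt-from : ∀ x y {i j} → ord x ≡ i → ord y ≡ j → lt x y ≡ ⌊ i <? j ⌋
  lt-from x y refl refl = refl

  one-inversion : ∀ x y → lt x y ∧ reversed t x y ≡ ⌊ x ≟ α ⌋ ∧ ⌊ y ≟ β ⌋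
  one-inversion x y = go x y (x ≟ α) (x ≟ β) (y ≟ α) (y ≟ β)
    where
    ∧-false : ∀ p → p ∧ false ≡ false
    ∧-false true = refl
    ∧-false false = refl
    go : ∀ x y (a : Dec (x ≡ α)) (b : Dec (x ≡ β)) (c : Dec (y ≡ α)) (d : Dec (y ≡ β)) → lt x y ∧ reversed t x y ≡ ⌊ a ⌋ ∧ ⌊ d ⌋
    go x y (yes refl) _ (yes refl) (yes q) = ⊥-elim (α≢β q)
    go x y (yes refl) _ (yes refl) (no _) = cong (_∧ reversed t α α) (lt-irrefl α)
    go x y (yes refl) _ (no _) (yes refl) = cong₂ (λ a b → a ∧ (a xor b)) (lt-from α β ord-α ord-β) (trans (cong₂ lt t-α t-β) (lt-from β α ord-β ord-α))
    go x y (yes refl) _ (no a) (no b) = cong₂ (λ c d → c ∧ (c xor d)) (lt-from α y ord-α (ord-other a b)) (trans (cong₂ lt t-α (t-other y a b)) (lt-from β y ord-β (ord-other a b)))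
    go x y (no _) (yes refl) (yes refl) _ = cong (_∧ reversed t β α) (lt-from β α ord-β ord-α)
    go x y (no _) (yes refl) (no _) (yes refl) = cong (_∧ reversed t β β) (lt-irrefl β)
    go x y (no _) (yes refl) (no a) (no b) = cong₂ (λ c d → c ∧ (c xor d)) (lt-from β y ord-β (ord-other a b)) (trans (cong₂ lt t-β (t-other y a b)) (lt-from α y ord-α (ord-other a b)))
    go x y (no a) (no b) (yes refl) _ = cong (_∧ reversed t x α) (lt-from x α (ord-other a b) ord-α)
    go x y (no a) (no b) (no _) (yes refl) = cong (_∧ reversed t x β) (lt-from x β (ord-other a b) ord-β)
    go x y (no a) (no b) (no c) (no d) = trans (cong (lt x y ∧_) (trans (cong (lt x y xor_) (cong₂ lt (t-other x a b) (t-other y c d))) (xor-same (lt x y)))) (∧-false (lt x y))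

  sgn-t : sgn t ≡ true
  sgn-t = cong odd (begin
    pairs (reversed t) ≡⟨ Σℕ-cong (λ x → Σℕ-cong (λ y → trans (cong 𝟙 (one-inversion x y)) (conj-𝟙 ⌊ x ≟ α ⌋ ⌊ y ≟ β ⌋))) ⟩
    Σℕ (λ x → Σℕ (λ y → 𝟙 ⌊ x ≟ α ⌋ * 𝟙 ⌊ y ≟ β ⌋)) ≡⟨ Σℕ-cong (λ x → Σℕ-δ (λ _ → 𝟙 ⌊ x ≟ α ⌋) β) ⟩
    Σℕ (λ x → 𝟙 ⌊ x ≟ α ⌋) ≡⟨ trans (Σℕ-cong (λ x → sym (+-identityʳ _))) (Σℕ-δ (λ _ → 1) α) ⟩
    1 ∎)
    where
    open ≡-Reasoning
    conj-𝟙 : ∀ a b → 𝟙 (a ∧ b) ≡ 𝟙 a * 𝟙 b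
    conj-𝟙 true b = sym (+-identityʳ (𝟙 b))
    conj-𝟙 false b = refl

  -- The even elements form a normal subgroup that misses `t`.
  even-trivial : ∀ g → sgn g ≡ false → g ≡ e
  even-trivial g even = decidable-stable (g ≟ e) λ g≢e → true≢false sgn-t (simple (λ x → sgn x ≡ false) sgn-e
    (λ x y p q → trans (sgn-∙ x y) (cong₂ _xor_ q p)) (λ x p → trans (sgn-inv x) p)
    (λ k x p → trans (sgn-∙ (k ∙ x) (inv k)) (trans (cong₂ _xor_ (sgn-inv k) (trans (sgn-∙ k x) (cong (_xor sgn k) p))) (xor-same (sgn k)))) g even g≢e t)

  -- Only the identity is even, so the group has at most two elements and commutes.
  absurd : ⊥
  absurd = nonabelian commute
    where
    commute : ∀ x y → x ∙ y ≡ y ∙ x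
    commute x y with sgn x in sx | sgn y in sy
    ... | false | _ = trans (cong (_∙ y) (even-trivial x sx)) (trans (idˡ y) (sym (trans (cong (y ∙_) (even-trivial x sx)) (idʳ y))))
    ... | true | false = trans (cong (x ∙_) (even-trivial y sy)) (trans (idʳ x) (sym (trans (cong (_∙ x) (even-trivial y sy)) (idˡ x))))
    ... | true | true = trans (even-trivial (x ∙ y) (trans (sgn-∙ x y) (cong₂ _xor_ sy sx))) (sym (even-trivial (y ∙ x) (trans (sgn-∙ y x) (cong₂ _xor_ sx sy))))

-- Automorphism groups

module FullAutomorphismGroup (G : Graph) {K : ℕ} (𝔾 : SimpleGroup K) (act : Fin K → Fin (Graph.n G) → Fin (Graph.n G))
  (act-e : ∀ v → act (SimpleGroup.e 𝔾) v ≡ v)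
  (act-∙ : ∀ g h v → act (SimpleGroup._∙_ 𝔾 g h) v ≡ act g (act h v))
  (act-adj : ∀ g x y → Graph.adj G (act g x) (act g y) ≡ Graph.adj G x y)
  (full : (θ : Automorphism G) → ∃ λ t → ∀ x → act t x ≡ Automorphism.to θ x)
  (faithful : ∀ g → (∀ x → act g x ≡ x) → g ≡ SimpleGroup.e 𝔾)
  (k : ℕ) (k-pos : 1 ≤ k) (K-large : order-bound (2 * threshold k) < K)
  where
  open SimpleGroup 𝔾
  open Contraction 𝔾 k k-pos K-large

  V : Set
  V = Fin (Graph.n G)

  A : V → V → Set
  A u v = Graph.adj G u v ≡ true

  A-sym : ∀ {u v} → A u v → A v u
  A-sym {u} {v} p = trans (Graph.adj-sym G v u) p

  A-irrefl : ∀ {u} → ¬ A u u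
  A-irrefl {u} p = true≢false p (Graph.adj-irrefl G u)

  A-act : ∀ g {u v} → A u v → A (act g u) (act g v)
  A-act g {u} {v} p = trans (act-adj g u v) p

  act-inv : ∀ g v → act (inv g) (act g v) ≡ v
  act-inv g v = trans (sym (act-∙ (inv g) g v)) (trans (cong (λ h → act h v) (invˡ g)) (act-e v))

  inv-act : ∀ g v → act g (act (inv g) v) ≡ v
  inv-act g v = trans (sym (act-∙ g (inv g) v)) (trans (cong (λ h → act h v) (invʳ g)) (act-e v))

  Moved : V → Set
  Moved x = ∃ λ g → act g x ≢ x

  moved? : ∀ x → Dec (Moved x)
  moved? x = any? (λ g → ¬? (act g x ≟ x))

  unmoved : ∀ {x} → ¬ Moved x → ∀ g → act g x ≡ x
  unmoved {x} ¬m g = decidable-stable (act g x ≟ x) (λ ne → ¬m (g , ne))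

  Moved-act : ∀ h {x} → Moved x → Moved (act h x)
  Moved-act h {x} (g , ne) = conj h g , λ eq → ne (begin
    act g x ≡⟨ sym (act-inv h (act g x)) ⟩
    act (inv h) (act h (act g x)) ≡⟨ cong (act (inv h)) (trans (sym (act-∙ h g x)) (trans (cong (λ t → act t x) (sym (cancelʳ-inv (h ∙ g) h))) (trans (act-∙ (conj h g) h x) eq))) ⟩
    act (inv h) (act h x) ≡⟨ act-inv h x ⟩
    x ∎)
    where open ≡-Reasoning

  B : V → V → Set
  B u v = A u v × Moved u × Moved v

  B-sym : ∀ {u v} → B u v → B v u
  B-sym (a , p , q) = A-sym a , q , p

  Component : V → V → Set
  Component = Star B

  Component-sym : ∀ {x y} → Component x y → Component y x
  Component-sym = Star-symmetric B-sym

  Component-act : ∀ g {x y} → Component x y → Component (act g x) (act g y)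
  Component-act g = Star-map (act g) (λ { (a , p , q) → A-act g a , Moved-act g p , Moved-act g q })

  Component-moved : ∀ {x y} → Component x y → Moved x → Moved y
  Component-moved ε m = m
  Component-moved ((_ , _ , q) ◅ p) m = Component-moved p q

  -- If the component of x₀ is not invariant, exchanging it with its image under s is an automorphism.
  module Exchange (comp? : ∀ x y → Dec (Component x y)) (x₀ : V) (moved₀ : Moved x₀) (s : Fin K) (apart : ¬ Component x₀ (act s x₀)) where

    In In′ : V → Set
    In = Component x₀
    In′ = Component (act s x₀)

    disjoint : ∀ {x} → In x → In′ x → ⊥
    disjoint p q = apart (p ◅◅ Component-sym q)

    swap : ∀ x → Dec (In x) → Dec (In′ x) → V
    swap x (yes _) _ = act s x
    swap x (no _) (yes _) = act (inv s) x
    swap x (no _) (no _) = x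

    θ : V → V
    θ x = swap x (comp? x₀ x) (comp? (act s x₀) x)

    data Place (x : V) : Set where
      left : In x → θ x ≡ act s x → Place x
      right : In′ x → θ x ≡ act (inv s) x → Place x
      other : ¬ In x → ¬ In′ x → θ x ≡ x → Place x

    place : ∀ x → Place x
    place x = go (comp? x₀ x) (comp? (act s x₀) x) refl
      where
      go : ∀ p q → θ x ≡ swap x p q → Place x
      go (yes p) _ eq = left p eq
      go (no _) (yes q) eq = right q eq
      go (no p) (no q) eq = other p q eq

    In-s : ∀ {x} → In x → In′ (act s x)
    In-s = Component-act s

    In-inv : ∀ {x} → In′ x → In (act (inv s) x)
    In-inv {x} q = subst (λ y → Component y (act (inv s) x)) (act-inv s x₀) (Component-act (inv s) q)

    θ-left : ∀ {x} → In x → θ x ≡ act s x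
    θ-left {x} p with place x
    ... | left _ eq = eq
    ... | right q _ = ⊥-elim (disjoint p q)
    ... | other ¬p _ _ = ⊥-elim (¬p p)

    θ-right : ∀ {x} → In′ x → θ x ≡ act (inv s) x
    θ-right {x} q with place x
    ... | left p _ = ⊥-elim (disjoint p q)
    ... | right _ eq = eq
    ... | other _ ¬q _ = ⊥-elim (¬q q)

    θ-other : ∀ {x} → ¬ In x → ¬ In′ x → θ x ≡ x
    θ-other {x} ¬p ¬q with place x
    ... | left p _ = ⊥-elim (¬p p)
    ... | right q _ = ⊥-elim (¬q q)
    ... | other _ _ eq = eq

    involutive : ∀ x → θ (θ x) ≡ x
    involutive x with place x
    ... | left p eq = trans (cong θ eq) (trans (θ-right (In-s p)) (act-inv s x))
    ... | right q eq = trans (cong θ eq) (trans (θ-left (In-inv q)) (inv-act s x))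
    ... | other _ _ eq = trans (cong θ eq) eq

    α : V → V → Bool
    α = Graph.adj G

    no-edge : ∀ {x y} → (A x y → ⊥) → α x y ≡ false
    no-edge f = ¬true⇒false f

    -- An edge leaving a component ends in a fixed vertex.
    stays : ∀ {z x y} → Component z x → Moved z → A x y → Moved y → Component z y
    stays p m a my = p ◅◅ ((a , Component-moved p m , my) ◅ ε)

    left-right : ∀ {x y} → In x → In′ y → α x y ≡ false
    left-right p q = no-edge (λ a → disjoint (stays p moved₀ a (Component-moved q (Moved-act s moved₀))) q)

    -- A moved `y` outside both components has no edge to either. A fixed `y` equals `act s y`, so
    -- its adjacency is carried along by `s`.
    left-other : ∀ {x y} → In x → ¬ In y → ¬ In′ y → α (act s x) y ≡ α x y
    left-other {x} {y} p ¬p ¬q = go (moved? y)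
      where
      go : Dec (Moved y) → α (act s x) y ≡ α x y
      go (yes m) = trans (no-edge (λ a → ¬q (stays (In-s p) (Moved-act s moved₀) a m))) (sym (no-edge (λ a → ¬p (stays p moved₀ a m))))
      go (no ¬m) = trans (cong (α (act s x)) (sym (unmoved ¬m s))) (act-adj s x y)

    right-other : ∀ {x y} → In′ x → ¬ In y → ¬ In′ y → α (act (inv s) x) y ≡ α x y
    right-other {x} {y} q ¬p ¬q = sym (trans (cong (λ z → α z y) (sym (inv-act s x))) (left-other (In-inv q) ¬p ¬q))

    preserved : ∀ x y → α (θ x) (θ y) ≡ α x y
    preserved x y with place x | place y
    ... | left p e₁ | left p′ e₂ = trans (cong₂ α e₁ e₂) (act-adj s x y)
    ... | left p e₁ | right q e₂ = trans (cong₂ α e₁ e₂) (trans (Graph.adj-sym G _ _) (trans (left-right (In-inv q) (In-s p)) (sym (left-right p q))))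
    ... | left p e₁ | other ¬p ¬q e₂ = trans (cong₂ α e₁ e₂) (left-other p ¬p ¬q)
    ... | right q e₁ | left p e₂ = trans (cong₂ α e₁ e₂) (trans (left-right (In-inv q) (In-s p)) (trans (sym (left-right p q)) (Graph.adj-sym G _ _)))
    ... | right q e₁ | right q′ e₂ = trans (cong₂ α e₁ e₂) (act-adj (inv s) x y)
    ... | right q e₁ | other ¬p ¬q e₂ = trans (cong₂ α e₁ e₂) (right-other q ¬p ¬q)
    ... | other ¬p ¬q e₁ | left p e₂ = trans (cong₂ α e₁ e₂) (trans (Graph.adj-sym G _ _) (trans (left-other p ¬p ¬q) (Graph.adj-sym G _ _)))
    ... | other ¬p ¬q e₁ | right q e₂ = trans (cong₂ α e₁ e₂) (trans (Graph.adj-sym G _ _) (trans (right-other q ¬p ¬q) (Graph.adj-sym G _ _)))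
    ... | other _ _ e₁ | other _ _ e₂ = cong₂ α e₁ e₂

    Θ : Automorphism G
    Θ = record { to = θ ; from = θ ; to-from = involutive ; from-to = involutive ; preserves = preserved }

    Q : Quotient Component
    Q = quotient-by comp? (λ _ → ε) Component-sym _◅◅_

    open Quotient Q using (π ; π-s ; to-R ; from-R) renaming (s to rep)
    open QuotientAction 𝔾 act act-e act-∙ Component-act Q

    t : Fin K
    t = proj₁ (full Θ)

    act′-t : ∀ a → act′ t a ≡ π (θ (rep a))
    act′-t a = cong π (proj₂ (full Θ) (rep a))

    -- By `full` the exchange is the action of a group element `t`, and on the quotient by
    -- components, where fixed vertices are singletons, `t` is a transposition.
    absurd : ⊥
    absurd = NoTransposition.absurd 𝔾 act′ act′-e act′-∙ t (π x₀) (π (act s x₀)) (apart ∘ to-R)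
      (trans (act′-t _) (trans (cong π (θ-left (to-R (sym (π-s _))))) (from-R (Component-act s (Component-sym (to-R (sym (π-s _))))))))
      (trans (act′-t _) (trans (cong π (θ-right (to-R (sym (π-s _))))) (from-R (Component-sym (In-inv (to-R (sym (π-s _))))))))
      (λ a a≢ a≢′ → trans (act′-t a) (trans (cong π (θ-other (λ p → a≢ (trans (sym (π-s a)) (sym (from-R p)))) (λ q → a≢′ (trans (sym (π-s a)) (sym (from-R q)))))) (π-s a)))

  some-moved : ∃ Moved
  some-moved = decidable-stable (any? moved?) λ none → nonabelian (λ x y → trans (cong (x ∙_) (trivial none y)) (trans (idʳ x)
      (sym (trans (cong (_∙ x) (trivial none y)) (idˡ x)))))
    where
    trivial : ¬ ∃ Moved → ∀ g → g ≡ e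
    trivial none g = faithful g (λ x → unmoved (λ m → none (x , m)) g)

  clique-model : ¬ ¬ CliqueModel A k
  clique-model no-model = ¬¬-decidable Component λ comp? → decide comp? (all? (λ g → comp? x₀ (act g x₀)))
    where
    x₀ : V
    x₀ = proj₁ some-moved
    decide : (∀ x y → Dec (Component x y)) → Dec (∀ g → Component x₀ (act g x₀)) → ⊥
    decide comp? (no ¬all) = let (s , apart) = ¬∀⟶∃¬ K _ (λ g → comp? x₀ (act g x₀)) ¬all in Exchange.absurd comp? x₀ (proj₂ some-moved) s apart
    decide comp? (yes all) = contract (suc (Graph.n G)) ≤-refl A A-sym A-irrefl act act-e act-∙ A-act (Component x₀)
      (λ g p → all g ◅◅ Component-act g p)
      (λ p q → within p (Component-sym p ◅◅ q))
      (λ p → Component-moved p (proj₂ some-moved)) x₀ ε no-model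
      where
      within : ∀ {x y} → Component x₀ x → Component x y → Star (λ u v → A u v × Component x₀ v) x y
      within p ε = ε
      within p (b ◅ q) = (proj₁ b , p ◅◅ (b ◅ ε)) ◅ within (p ◅◅ (b ◅ ε)) q

-- From branch sets to minors

clique-model⇒minor : ∀ (G : Graph) k → CliqueModel (λ u v → Graph.adj G u v ≡ true) k → complete k ≼ G
clique-model⇒minor G k model = Quotient.m Q , P , (λ i → π (root i)) , injective , edges
  where
  open CliqueModel model
  V : Set
  V = Fin (Graph.n G)

  -- A connected partition has to cover all vertices, so those outside the branch sets become parts
  -- of their own.
  Same : V → V → Set
  Same x y = x ≡ y ⊎ ∃ λ i → label x ≡ just i × label y ≡ just i

  label-is? : ∀ (l : Maybe (Fin k)) i → Dec (l ≡ just i)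
  label-is? nothing i = no λ ()
  label-is? (just j) i = map′ (cong just) (λ { refl → refl }) (j ≟ i)

  same-label : ∀ {l : Maybe (Fin k)} {i j} → l ≡ just i → l ≡ just j → i ≡ j
  same-label refl refl = refl

  Q : Quotient Same
  Q = quotient-by (λ x y → (x ≟ y) ⊎-dec any? (λ i → label-is? (label x) i ×-dec label-is? (label y) i))
    (λ x → inj₁ refl) (λ { (inj₁ refl) → inj₁ refl ; (inj₂ (i , p , q)) → inj₂ (i , q , p) })
    (λ { (inj₁ refl) r → r ; r (inj₁ refl) → r
       ; (inj₂ (i , p , q)) (inj₂ (j , p′ , q′)) → inj₂ (i , p , subst (λ t → label _ ≡ just t) (same-label p′ q) q′) })
  open Quotient Q using (π ; s ; π-s ; to-R ; from-R)

  walk : ∀ {S : V → Set} {u v} → S u → Star (λ x y → Graph.adj G x y ≡ true × S y) u v → WalkIn G S u v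
  walk Su ε = WalkIn.stop Su
  walk Su ((a , Sv) ◅ p) = WalkIn.step Su a (walk Sv p)

  P : ConnectedPartition G (Quotient.m Q)
  P = record { part = π ; surjective = λ a → s a , π-s a ; connected = λ u v eq → linked u v (to-R eq) }
    where
    linked : ∀ u v → Same u v → WalkIn G (λ w → π w ≡ π u) u v
    linked u .u (inj₁ refl) = WalkIn.stop refl
    linked u v (inj₂ (i , p , q)) = walk refl (Star-weaken (λ { (a , l) → a , from-R (inj₂ (i , l , p)) })
      (Star-reverse (λ {x} {y} a → trans (Graph.adj-sym G y x) a) (root-label i) (branch-connected i u p) ◅◅ branch-connected i v q))

  injective : ∀ {i j} → π (root i) ≡ π (root j) → i ≡ j
  injective {i} {j} eq = distinct (to-R eq)
    where
    distinct : Same (root i) (root j) → i ≡ j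
    distinct (inj₁ p) = same-label (root-label i) (trans (cong label p) (root-label j))
    distinct (inj₂ (l , p , q)) = trans (same-label (root-label i) p) (same-label q (root-label j))

  edges : ∀ i j → Graph.adj (complete k) i j ≡ true → ContractAdj G P (π (root i)) (π (root j))
  edges i j a = (λ eq → i≢j (injective eq)) ,
    (let (u , v , p , q , r) = touching i j i≢j in u , v , from-R (inj₂ (i , p , root-label i)) , from-R (inj₂ (j , q , root-label j)) , r)
    where
    i≢j : i ≢ j
    i≢j refl = true≢false a (Graph.adj-irrefl (complete k) i)

-- Abelian simple groups

simple-abelian⇒cyclic : ∀ {c ℓ} (S : Group c ℓ) → IsSimple S → (∀ x y → Group._≈_ S (Group._∙_ S x y) (Group._∙_ S y x)) → IsCyclic S
simple-abelian⇒cyclic {c} {ℓ} S S-simple abelian = g , λ x → as-power (lower (power x))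
  where
  module S = Group S
  open Group S hiding (sym; trans; refl; _-_) renaming (ε to 1ₛ)
  open import Algebra.Properties.Group S using (∙-cancelʳ; inverseˡ-unique)
  open import Relation.Binary.Reasoning.Setoid setoid
  g : Carrier
  g = proj₁ (IsSimple.nontrivial S-simple)
  pow : ℕ → Carrier
  pow = powℕ S g
  pow-+ : ∀ a b → pow (a + b) ≈ pow a ∙ pow b
  pow-+ zero b = S.sym (identityˡ _)
  pow-+ (suc a) b = S.trans (∙-congˡ (pow-+ a b)) (S.sym (assoc g (pow a) (pow b)))
  -- Integer powers as quotients of natural powers, so that closure needs no case analysis.
  Power : Carrier → Set ℓ
  Power y = ∃₂ λ a b → y ∙ pow a ≈ pow b
  interchange : ∀ x y a b → (x ∙ y) ∙ (a ∙ b) ≈ (x ∙ a) ∙ (y ∙ b)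
  interchange x y a b = begin
    (x ∙ y) ∙ (a ∙ b) ≈⟨ assoc x y (a ∙ b) ⟩
    x ∙ (y ∙ (a ∙ b)) ≈⟨ ∙-congˡ (S.sym (assoc y a b)) ⟩
    x ∙ ((y ∙ a) ∙ b) ≈⟨ ∙-congˡ (∙-congʳ (abelian y a)) ⟩
    x ∙ ((a ∙ y) ∙ b) ≈⟨ ∙-congˡ (assoc a y b) ⟩
    x ∙ (a ∙ (y ∙ b)) ≈⟨ S.sym (assoc x a (y ∙ b)) ⟩
    (x ∙ a) ∙ (y ∙ b) ∎
  power : ∀ x → Lift c (Power x)
  power = IsSimple.normal-trivial-or-all S-simple (λ x → Lift c (Power x)) (record
    { respects = λ { p (lift (a , b , q)) → lift (a , b , S.trans (∙-congʳ (S.sym p)) q) }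
    ; has-ε = lift (0 , 0 , identityˡ _)
    ; ∙-closed = λ { {x} {y} (lift (a , b , p)) (lift (a′ , b′ , q)) → lift (a + a′ , b + b′ , (begin
        (x ∙ y) ∙ pow (a + a′) ≈⟨ ∙-congˡ (pow-+ a a′) ⟩
        (x ∙ y) ∙ (pow a ∙ pow a′) ≈⟨ interchange x y (pow a) (pow a′) ⟩
        (x ∙ pow a) ∙ (y ∙ pow a′) ≈⟨ ∙-cong p q ⟩
        pow b ∙ pow b′ ≈⟨ S.sym (pow-+ b b′) ⟩
        pow (b + b′) ∎)) }
    ; ⁻¹-closed = λ { {x} (lift (a , b , p)) → lift (b , a , (begin
        x ⁻¹ ∙ pow b ≈⟨ ∙-congˡ (S.sym p) ⟩
        x ⁻¹ ∙ (x ∙ pow a) ≈⟨ S.sym (assoc _ _ _) ⟩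
        (x ⁻¹ ∙ x) ∙ pow a ≈⟨ ∙-congʳ (inverseˡ x) ⟩
        1ₛ ∙ pow a ≈⟨ identityˡ _ ⟩
        pow a ∎)) }
    ; conj-closed = λ { h {x} (lift (a , b , p)) → lift (a , b , S.trans (∙-congʳ (begin
        (h ∙ x) ∙ h ⁻¹ ≈⟨ ∙-congʳ (abelian h x) ⟩
        (x ∙ h) ∙ h ⁻¹ ≈⟨ assoc _ _ _ ⟩
        x ∙ (h ∙ h ⁻¹) ≈⟨ ∙-congˡ (inverseʳ h) ⟩
        x ∙ 1ₛ ≈⟨ identityʳ x ⟩
        x ∎)) p) } })
    (g , lift (0 , 1 , S.refl) , proj₂ (IsSimple.nontrivial S-simple))
  as-power : ∀ {x} → Power x → Σ ℤ λ k → x ≈ powℤ S g k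
  as-power {x} (a , b , p) = go (≤-total a b)
    where
    go : a ≤ b ⊎ b ≤ a → Σ ℤ λ k → x ≈ powℤ S g k
    go (inj₁ a≤b) = ⁺ (b ∸ a) , ∙-cancelʳ (pow a) x (pow (b ∸ a)) (S.trans p (S.trans (S.reflexive (cong pow (sym (m∸n+n≡m a≤b)))) (pow-+ (b ∸ a) a)))
    go (inj₂ b≤a) = split (a ∸ b) (∙-cancelʳ (pow b) (x ∙ pow (a ∸ b)) 1ₛ (begin
        (x ∙ pow (a ∸ b)) ∙ pow b ≈⟨ assoc _ _ _ ⟩
        x ∙ (pow (a ∸ b) ∙ pow b) ≈⟨ ∙-congˡ (S.sym (pow-+ (a ∸ b) b)) ⟩
        x ∙ pow ((a ∸ b) + b) ≈⟨ ∙-congˡ (S.reflexive (cong pow (m∸n+n≡m b≤a))) ⟩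
        x ∙ pow a ≈⟨ p ⟩
        pow b ≈⟨ S.sym (identityˡ _) ⟩
        1ₛ ∙ pow b ∎))
      where
      split : ∀ d → x ∙ pow d ≈ 1ₛ → Σ ℤ λ k → x ≈ powℤ S g k
      split zero q = ⁺ 0 , S.trans (S.sym (identityʳ x)) q
      split (suc d) q = -[1+ d ] , inverseˡ-unique x (pow (suc d)) q

-- Numbering automorphisms and groups

record Enumeration {M : ℕ} (P : Fin M → Set) : Set where
  field
    size : ℕ
    el : Fin size → Fin M
    el-P : ∀ i → P (el i)
    el-injective : ∀ {i j} → el i ≡ el j → i ≡ j
    index : ∀ {x} → P x → ∃ λ i → el i ≡ x

enumerate : ∀ {M} {P : Fin M → Set} → (∀ x → Dec (P x)) → Enumeration P
enumerate {zero} P? = record { size = 0 ; el = λ () ; el-P = λ () ; el-injective = λ { {()} } ; index = λ { {()} } }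
enumerate {suc M} {P} P? = extend (enumerate (P? ∘ suc)) (P? zero)
  where
  extend : Enumeration (P ∘ suc) → Dec (P zero) → Enumeration P
  extend E (no ¬p) = record { size = size ; el = suc ∘ el ; el-P = el-P ; el-injective = λ eq → el-injective (Finₚ.suc-injective eq)
    ; index = λ { {zero} p → ⊥-elim (¬p p) ; {suc x} p → let (i , eq) = index p in i , cong suc eq } }
    where open Enumeration E
  extend E (yes p) = record { size = suc size ; el = el′ ; el-P = λ { zero → p ; (suc i) → el-P i } ; el-injective = inj
    ; index = λ { {zero} _ → zero , refl ; {suc x} q → let (i , eq) = index q in suc i , cong suc eq } }
    where
    open Enumeration E
    el′ : Fin (suc size) → Fin (suc M)
    el′ zero = zero
    el′ (suc i) = suc (el i)
    inj : ∀ {i j} → el′ i ≡ el′ j → i ≡ j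
    inj {zero} {zero} _ = refl
    inj {suc i} {suc j} eq = cong suc (el-injective (Finₚ.suc-injective eq))

module AutomorphismCodes (G : Graph) where
  private
    N = Graph.n G
    F = Fin (N ^ N)

  fun : F → Fin N → Fin N
  fun = finToFun

  -- The inverse is sought among codes as well, which makes the property decidable by finite search.
  IsAut : F → Set
  IsAut c = ∃ λ (d : F) → (∀ x → fun c (fun d x) ≡ x) × (∀ x → fun d (fun c x) ≡ x) ×
    (∀ i j → Graph.adj G (fun c i) (fun c j) ≡ Graph.adj G i j)

  isAut? : ∀ c → Dec (IsAut c)
  isAut? c = any? λ d → all? (λ x → fun c (fun d x) ≟ x) ×-dec all? (λ x → fun d (fun c x) ≟ x) ×-dec
    all? (λ i → all? (λ j → Graph.adj G (fun c i) (fun c j) Data.Bool.Properties.≟ Graph.adj G i j))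
    where import Data.Bool.Properties

  open Enumeration (enumerate isAut?) public renaming (size to order)

  aut : Fin order → Automorphism G
  aut i = let (d , p , q , r) = el-P i in record { to = fun (el i) ; from = fun d ; to-from = p ; from-to = q ; preserves = r }

  act : Fin order → Fin N → Fin N
  act i = fun (el i)

  act-injective : ∀ {i j} → (∀ x → act i x ≡ act j x) → i ≡ j
  act-injective {i} {j} same = el-injective (trans (sym (funToFin-finToFin {N} {N} (el i))) (trans (funToFin-cong same) (funToFin-finToFin {N} {N} (el j))))
    where
    funToFin-cong : ∀ {m n} {f g : Fin m → Fin n} → (∀ x → f x ≡ g x) → funToFin f ≡ funToFin g
    funToFin-cong {zero} same = refl
    funToFin-cong {suc m} same = cong₂ combine (same zero) (funToFin-cong (same ∘ suc))

  number : (σ : Automorphism G) → ∃ λ i → ∀ x → act i x ≡ Automorphism.to σ x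
  number σ = let (i , eq) = index is-aut in i , λ x → trans (cong (λ c → fun c x) eq) (to-code x)
    where
    open Automorphism σ renaming (to to τ ; from to τ⁻¹)
    to-code : ∀ x → fun (funToFin τ) x ≡ τ x
    to-code = finToFun-funToFin τ
    from-code : ∀ x → fun (funToFin τ⁻¹) x ≡ τ⁻¹ x
    from-code = finToFun-funToFin τ⁻¹
    is-aut : IsAut (funToFin τ)
    is-aut = funToFin τ⁻¹ , (λ x → trans (to-code _) (trans (cong τ (from-code x)) (Automorphism.to-from σ x))) ,
      (λ x → trans (from-code _) (trans (cong τ⁻¹ (to-code x)) (Automorphism.from-to σ x))) ,
      (λ i j → trans (cong₂ (Graph.adj G) (to-code i) (to-code j)) (Automorphism.preserves σ i j))

  index-of : Automorphism G → Fin order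
  index-of σ = proj₁ (number σ)

  act-index : ∀ σ x → act (index-of σ) x ≡ Automorphism.to σ x
  act-index σ = proj₂ (number σ)

  mul : Fin order → Fin order → Fin order
  mul i j = index-of (_∘ᴬ_ G (aut i) (aut j))

  unit : Fin order
  unit = index-of (idᴬ G)

  inverse : Fin order → Fin order
  inverse i = index-of (invᴬ G (aut i))

  act-mul : ∀ i j x → act (mul i j) x ≡ act i (act j x)
  act-mul i j = act-index (_∘ᴬ_ G (aut i) (aut j))

  act-unit : ∀ x → act unit x ≡ x
  act-unit = act-index (idᴬ G)

  act-inverseˡ : ∀ i x → act (inverse i) (act i x) ≡ x
  act-inverseˡ i x = trans (act-index (invᴬ G (aut i)) (act i x)) (Automorphism.from-to (aut i) x)

  act-inverseʳ : ∀ i x → act i (act (inverse i) x) ≡ x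
  act-inverseʳ i x = trans (cong (act i) (act-index (invᴬ G (aut i)) x)) (Automorphism.to-from (aut i) x)

  mul-assoc : ∀ x y z → mul (mul x y) z ≡ mul x (mul y z)
  mul-assoc x y z = act-injective λ v → trans (act-mul (mul x y) z v) (trans (act-mul x y (act z v))
    (sym (trans (act-mul x (mul y z) v) (cong (act x) (act-mul y z v)))))

  mul-unitˡ : ∀ x → mul unit x ≡ x
  mul-unitˡ x = act-injective λ v → trans (act-mul unit x v) (act-unit (act x v))

  mul-unitʳ : ∀ x → mul x unit ≡ x
  mul-unitʳ x = act-injective λ v → trans (act-mul x unit v) (cong (act x) (act-unit v))

  mul-inverseˡ : ∀ x → mul (inverse x) x ≡ unit
  mul-inverseˡ x = act-injective λ v → trans (act-mul (inverse x) x v) (trans (act-inverseˡ x v) (sym (act-unit v)))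

  mul-inverseʳ : ∀ x → mul x (inverse x) ≡ unit
  mul-inverseʳ x = act-injective λ v → trans (act-mul x (inverse x) v) (trans (act-inverseʳ x v) (sym (act-unit v)))

-- Groups as multiplication tables

GroupLaws : ∀ {K} → (Fin K → Fin K → Fin K) → Fin K → (Fin K → Fin K) → Set
GroupLaws _∙_ e inv = (∀ x y z → (x ∙ y) ∙ z ≡ x ∙ (y ∙ z)) × (∀ x → e ∙ x ≡ x) × (∀ x → x ∙ e ≡ x) ×
  (∀ x → inv x ∙ x ≡ e) × (∀ x → x ∙ inv x ≡ e)

groupLaws? : ∀ {K} (_∙_ : Fin K → Fin K → Fin K) e inv → Dec (GroupLaws _∙_ e inv)
groupLaws? _∙_ e inv = all? (λ x → all? (λ y → all? (λ z → ((x ∙ y) ∙ z) ≟ (x ∙ (y ∙ z))))) ×-dec all? (λ x → (e ∙ x) ≟ x) ×-dec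
  all? (λ x → (x ∙ e) ≟ x) ×-dec all? (λ x → (inv x ∙ x) ≟ e) ×-dec all? (λ x → (x ∙ inv x) ≟ e)

tableGroup : ∀ {K} (_∙_ : Fin K → Fin K → Fin K) e inv → GroupLaws _∙_ e inv → Group 0ℓ 0ℓ
tableGroup {K} _∙_ e inv (as , il , ir , vl , vr) = record
  { Carrier = Fin K ; _≈_ = _≡_ ; _∙_ = _∙_ ; ε = e ; _⁻¹ = inv
  ; isGroup = record
    { isMonoid = record
      { isSemigroup = record { isMagma = record { isEquivalence = Relation.Binary.PropositionalEquality.isEquivalence ; ∙-cong = cong₂ _∙_ } ; assoc = as }
      ; identity = il , ir }
    ; inverse = vl , vr ; ⁻¹-cong = cong inv } }

decode₂ : ∀ {K} → Fin ((K ^ K) ^ K) → Fin K → Fin K → Fin K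
decode₂ c x = finToFun (finToFun c x)

encode₂ : ∀ {K} → (Fin K → Fin K → Fin K) → Fin ((K ^ K) ^ K)
encode₂ f = funToFin (λ x → funToFin (f x))

decode-encode₂ : ∀ {K} (f : Fin K → Fin K → Fin K) x y → decode₂ (encode₂ f) x y ≡ f x y
decode-encode₂ f x y = trans (cong (λ c → finToFun c y) (finToFun-funToFin (λ x → funToFin (f x)) x)) (finToFun-funToFin (f x) y)

candidate : ∀ {K} → Fin ((K ^ K) ^ K) → Fin K → Fin (K ^ K) → List (Group 0ℓ 0ℓ)
candidate c e d = accept (groupLaws? (decode₂ c) e (finToFun d))
  where
  accept : Dec (GroupLaws (decode₂ c) e (finToFun d)) → List (Group 0ℓ 0ℓ)
  accept (yes laws) = tableGroup (decode₂ c) e (finToFun d) laws ∷ []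
  accept (no _) = []

groups-of-order : ℕ → List (Group 0ℓ 0ℓ)
groups-of-order K = List.concat (List.tabulate λ c → List.concat (List.tabulate λ e → List.concat (List.tabulate λ d → candidate {K} c e d)))

-- A decoded table agrees with the given operation only pointwise, so `P` is demanded for all
-- pointwise equal tables.
groups-of-order-complete : ∀ {p} K (P : Group 0ℓ 0ℓ → Set p) (mul : Fin K → Fin K → Fin K) e inv → GroupLaws mul e inv →
  (∀ mul′ inv′ (laws : GroupLaws mul′ e inv′) → (∀ x y → mul′ x y ≡ mul x y) → (∀ x → inv′ x ≡ inv x) → P (tableGroup mul′ e inv′ laws)) →
  Any P (groups-of-order K)
groups-of-order-complete K P mul e inv (as , il , ir , vl , vr) holds =
  concat⁺ (tabulate⁺ c (concat⁺ (tabulate⁺ e (concat⁺ (tabulate⁺ d accepted)))))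
  where
  open import Data.List.Relation.Unary.Any.Properties using (concat⁺; tabulate⁺)
  c = encode₂ mul
  d = funToFin inv
  m : ∀ x y → decode₂ c x y ≡ mul x y
  m = decode-encode₂ mul
  v : ∀ x → finToFun d x ≡ inv x
  v = finToFun-funToFin inv
  laws : GroupLaws (decode₂ c) e (finToFun d)
  laws = (λ x y z → trans (trans (m _ z) (cong (λ t → mul t z) (m x y))) (trans (as x y z) (sym (trans (m x _) (cong (mul x) (m y z)))))) ,
    (λ x → trans (m e x) (il x)) , (λ x → trans (m x e) (ir x)) ,
    (λ x → trans (m _ x) (trans (cong (λ t → mul t x) (v x)) (vl x))) , (λ x → trans (m x _) (trans (cong (mul x) (v x)) (vr x)))
  accepted : Any P (candidate {K} c e d)
  accepted with groupLaws? (decode₂ c) e (finToFun d)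
  ... | yes laws′ = here (holds (decode₂ c) (finToFun d) laws′ m v)
  ... | no ¬laws = ⊥-elim (¬laws laws)

-- Transport to numbered automorphisms

module Transported {c ℓ} (S : Group c ℓ) (S-simple : IsSimple S) (S-noncyclic : ¬ IsCyclic S) (G : Graph) (iso : S ≅ Aut G) where
  private
    module S = Group S
    open GroupMorphisms (Group.rawGroup S) (Group.rawGroup (Aut G)) using (module IsGroupIsomorphism)
    module I = IsGroupIsomorphism (proj₂ iso)
  open AutomorphismCodes G

  f : S.Carrier → Automorphism G
  f = proj₁ iso

  φ : S.Carrier → Fin order
  φ s = index-of (f s)

  act-φ : ∀ s x → act (φ s) x ≡ Automorphism.to (f s) x
  act-φ s = act-index (f s)

  φ-cong : ∀ {s t} → s S.≈ t → φ s ≡ φ t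
  φ-cong {s} {t} p = act-injective λ x → trans (act-φ s x) (trans (I.⟦⟧-cong p x) (sym (act-φ t x)))

  φ-injective : ∀ {s t} → φ s ≡ φ t → s S.≈ t
  φ-injective {s} {t} eq = I.injective λ x → trans (sym (act-φ s x)) (trans (cong (λ i → act i x) eq) (act-φ t x))

  φ-surjective : ∀ i → ∃ λ s → φ s ≡ i
  φ-surjective i = let (s , h) = I.surjective (aut i) in s , act-injective (λ x → trans (act-φ s x) (h S.refl x))

  φ-∙ : ∀ s t → φ (s S.∙ t) ≡ mul (φ s) (φ t)
  φ-∙ s t = act-injective λ x → trans (act-φ (s S.∙ t) x) (trans (I.∙-homo s t x) (sym (trans (act-mul (φ s) (φ t) x)
    (trans (act-φ s _) (cong (Automorphism.to (f s)) (act-φ t x))))))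

  φ-ε : φ S.ε ≡ unit
  φ-ε = act-injective λ x → trans (act-φ S.ε x) (trans (I.ε-homo x) (sym (act-unit x)))

  φ-⁻¹ : ∀ s → φ (s S.⁻¹) ≡ inverse (φ s)
  φ-⁻¹ s = act-injective λ x → sym (trans (sym (cong (act (inverse (φ s))) (to-id x))) (act-inverseˡ (φ s) (act (φ (s S.⁻¹)) x)))
    where
    to-id : ∀ x → act (φ s) (act (φ (s S.⁻¹)) x) ≡ x
    to-id x = trans (sym (act-mul (φ s) (φ (s S.⁻¹)) x)) (trans (cong (λ i → act i x) (trans (sym (φ-∙ s (s S.⁻¹))) (trans (φ-cong (S.inverseʳ s)) φ-ε))) (act-unit x))

  𝔾 : SimpleGroup order
  𝔾 = record
    { _∙_ = mul ; e = unit ; inv = inverse ; assoc = mul-assoc ; idˡ = mul-unitˡ ; idʳ = mul-unitʳ ; invˡ = mul-inverseˡ ; invʳ = mul-inverseʳ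
    ; simple = simple
    ; nonabelian = λ comm → S-noncyclic (simple-abelian⇒cyclic S S-simple (λ x y → φ-injective (trans (φ-∙ x y) (trans (comm (φ x) (φ y)) (sym (φ-∙ y x)))))) }
    where
    -- A predicate on numbers pulls back along `φ` to a normal subgroup of `S`, lifted to the level
    -- over which simplicity quantifies.
    simple : (P : Fin order → Set) → P unit → (∀ x y → P x → P y → P (mul x y)) → (∀ x → P x → P (inverse x)) →
      (∀ g x → P x → P (mul (mul g x) (inverse g))) → (x : Fin order) → P x → x ≢ unit → ∀ y → P y
    simple P P-e P-∙ P-inv P-conj x Px x≢e y =
      let (s , φs) = φ-surjective x ; (t , φt) = φ-surjective y in
      subst P φt (lower (IsSimple.normal-trivial-or-all S-simple (λ s → Lift (c ⊔ ℓ) (P (φ s))) (record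
        { respects = λ { p (lift q) → lift (subst P (φ-cong p) q) }
        ; has-ε = lift (subst P (sym φ-ε) P-e)
        ; ∙-closed = λ { {s} {t} (lift p) (lift q) → lift (subst P (sym (φ-∙ s t)) (P-∙ _ _ p q)) }
        ; ⁻¹-closed = λ { {s} (lift p) → lift (subst P (sym (φ-⁻¹ s)) (P-inv _ p)) }
        ; conj-closed = λ { g {s} (lift p) → lift (subst P (sym (trans (φ-∙ (g S.∙ s) (g S.⁻¹)) (cong₂ mul (φ-∙ g s) (φ-⁻¹ g)))) (P-conj (φ g) (φ s) p)) } })
        (s , lift (subst P (sym φs) Px) , λ s≈ε → x≢e (trans (sym φs) (trans (φ-cong s≈ε) φ-ε))) t))

  -- A larger order would give a clique minor on `suc h` vertices. The inequality is proved by
  -- refuting its opposite, so a doubly negated clique model is enough.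
  order-bound-holds : ∀ h → HadwigerAtMost h G → order ≤ order-bound (2 * threshold (suc h))
  order-bound-holds h hadwiger = ≮⇒≥ λ large →
    FullAutomorphismGroup.clique-model G 𝔾 act act-unit act-mul (λ g → Automorphism.preserves (aut g)) number
      (λ g fix → act-injective (λ x → trans (fix x) (sym (act-unit x)))) (suc h) (s≤s z≤n) large
      (λ model → 1+n≰n (hadwiger (suc h) (clique-model⇒minor G (suc h) model)))

  in-list : Any (λ T → S ≅ T) (groups-of-order order)
  in-list = groups-of-order-complete order (λ T → S ≅ T) mul unit inverse (mul-assoc , mul-unitˡ , mul-unitʳ , mul-inverseˡ , mul-inverseʳ)
    λ mul′ inv′ laws m v → φ , record
      { isGroupMonomorphism = record
        { isGroupHomomorphism = record
          { isMonoidHomomorphism = record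
            { isMagmaHomomorphism = record { isRelHomomorphism = record { cong = φ-cong } ; homo = λ s t → trans (φ-∙ s t) (sym (m (φ s) (φ t))) }
            ; ε-homo = φ-ε }
          ; ⁻¹-homo = λ s → trans (φ-⁻¹ s) (sym (v (φ s))) }
        ; injective = φ-injective }
      ; surjective = λ i → let (s , φs) = φ-surjective i in s , λ z≈s → trans (φ-cong z≈s) φs }

theorem6p2 : ∀ {c ℓ : Level} (h : ℕ) →
    Σ (List (Group 0ℓ 0ℓ)) λ L →
    ∀ (S : Group c ℓ) → IsSimple S → ¬ IsCyclic S →
    (Σ Graph λ G → HadwigerAtMost h G × (S ≅ Aut G)) →
    Any (λ T → S ≅ T) L
-- The list contains the groups of every order up to `bound`, simple or not; bounding the order is
-- all that finiteness takes.
theorem6p2 h = List.concat (List.tabulate {n = suc bound} (λ i → groups-of-order (toℕ i))) ,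
  λ S S-simple S-noncyclic (G , hadwiger , iso) →
    let open Transported S S-simple S-noncyclic G iso
        order< = s≤s (order-bound-holds h hadwiger)
    in concat⁺ (tabulate⁺ {f = λ (i : Fin (suc bound)) → groups-of-order (toℕ i)} (fromℕ< order<) (subst (λ k → Any (λ T → S ≅ T) (groups-of-order k)) (sym (Finₚ.toℕ-fromℕ< order<)) in-list))
  where
  open import Data.List.Relation.Unary.Any.Properties using (concat⁺; tabulate⁺)
  bound : ℕ
  bound = order-bound (2 * threshold (suc h))
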